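{- Let $\mu\subset\lambda$ be partitions and let $r\ge1$ be an integer with $r\ge\ell(\lambda)$ (pad $\lambda,\mu$ with zeros to $r$ parts). Then $$g_{\lambda/\mu}(x)=\det\left(\sum_{n=0}^\infty\binom{j-i}{n}\beta^n\,h_{\lambda_i-\mu_j-i+j-n}(x)\right)_{1\le i,j\le r}.$$
   Context: $k=\mathbb{C}(\beta)$; $\Lambda$ is the $k$-algebra of symmetric functions in $x=(x_1,x_2,\dots)$, with Schur functions $s_\lambda$, complete symmetric functions $h_m$ ($h_0=1$, $h_m=0$ for $m<0$), and Hall inner product $\langle s_\lambda,s_\mu\rangle=\delta_{\lambda,\mu}$. $I_n=\mathrm{span}_k\{s_\lambda:\ell(\lambda)>n\}$ and $\widehat\Lambda=\varprojlim\Lambda/I_n$; elements of $\widehat\Lambda$ are formal sums $\sum c_\lambda s_\lambda$ such that for every $n$ only finitely many $\lambda$ with $\ell(\lambda)\le n$ have $c_\lambda\neq0$. The Hall product extends to $\widehat\Lambda\times\Lambda\to k$. The stable Grothendieck polynomial $G_\lambda(x)\in\widehat\Lambda$ is the unique element such that for all $n\ge\ell(\lambda)$, $G_\lambda(x_1,\dots,x_n,0,0,\dots)=\det\bigl(x_i^{\lambda_j+n-j}(1+\beta x_i)^{j-1}\bigr)_{1\le i,j\le n}/\prod_{1\le i<j\le n}(x_i-x_j)$. The dual stable Grothendieck polynomials $g_\mu\in\Lambda$ are determined by $\langle G_\lambda,g_\mu\rangle=\delta_{\lambda,\mu}$. The skew dual stable Grothendieck polynomial is $g_{\lambda/\mu}=G_\mu^\perp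 g_\lambda\in\Lambda$, i.e. $\langle g_{\lambda/\mu},h\rangle=\langle G_\mu h,g_\lambda\rangle$ for all $h\in\Lambda$ (equivalently $g_\lambda(x,y)=\sum_{\mu\subset\lambda}g_\mu(x)g_{\lambda/\mu}(y)$). Binomials: $\binom{a}{n}=a(a-1)\cdots(a-n+1)/n!$ for $a\in\mathbb Z$, $n\ge0$. -}

module Defs where

open import Algebra.Bundles using (CommutativeRing)
open import Algebra.Bundles.Raw using (RawRing)
import Algebra.Definitions.RawMonoid as RawMonoidDefs
import Algebra.Definitions.RawSemiring as RawSemiringDefs
import Algebra.Properties.CommutativeMonoid.Sum as SumProperties
import Algebra.Properties.Ring as RingProperties
open import Data.Fin.Base using (Fin; zero; suc; toℕ; punchIn)
import Data.Fin.Properties as Fin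
open import Data.Integer.Base as ℤ using (ℤ; +_; -[1+_])
open import Data.List.Base using (List; []; _∷_; _∷ʳ_; length)
open import Data.List.Properties using (≡-dec)
open import Data.List.Relation.Binary.Permutation.Propositional using (_↭_; refl; prep; swap; trans)
open import Data.List.Relation.Unary.All using (All)
open import Data.List.Relation.Unary.Linked using (Linked)
open import Data.Nat.Base as ℕ using (ℕ; zero; suc; _∸_; _≤_; _<_; _≥_; _!)
open import Data.Nat.ListAction using () renaming (sum to total)
open import Data.Nat.ListAction.Properties using () renaming (sum-↭ to total-↭)
import Data.Nat.Properties as ℕ
open import Data.Nat.Solver using (module +-*-Solver)
open import Data.Product.Base using (Σ-syntax; ∃-syntax; _×_; _,_)
open import Data.Sum.Base using (_⊎_; inj₁; inj₂)
open import Level using (_⊔_)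
open import Relation.Binary.PropositionalEquality as ≡ using (_≡_)
open import Relation.Nullary.Decidable.Core using (Dec; does; yes; no)
open import Relation.Nullary.Negation.Core using (¬_; contradiction)
open import Data.Bool.Base using (if_then_else_)

record Partition : Set where
  field
    parts    : List ℕ
    sorted   : Linked _≥_ parts
    positive : All (0 <_) parts

open Partition public

ℓ : Partition → ℕ
ℓ ν = length (parts ν)

nth : List ℕ → ℕ → ℕ
nth []       _       = 0
nth (n ∷ ns) zero    = n
nth (n ∷ ns) (suc i) = nth ns i

-- Parts are numbered from 0: part ν i is ν_{i+1}, and it is 0 for i ≥ ℓ ν.
part : Partition → ℕ → ℕ
part ν = nth (parts ν)

infix 4 _⊂_
_⊂_ : Partition → Partition → Set
μ ⊂ ν = ∀ i → part μ i ≤ part ν i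

falling : ℤ → ℕ → ℤ
falling a zero    = + 1
falling a (suc n) = falling a n ℤ.* (a ℤ.- + n)

-- The division is exact.
binom : ℤ → ℕ → ℤ
binom a n = falling a n ℤ./ℕ (n !)
  where instance _ = n ℕ.!≢0

module Matrix {a b} (R : RawRing a b) where
  open RawRing R
  open RawMonoidDefs +-rawMonoid using (sum)
  open RawSemiringDefs rawSemiring using (_^_)

  det : ∀ {n} → (Fin n → Fin n → Carrier) → Carrier
  det {zero}  M = 1#
  det {suc n} M = sum λ j →
    (- 1#) ^ toℕ j * (M zero j * det (λ p q → M (suc p) (punchIn j q)))

module SymmetricFunctions {a b} (k : CommutativeRing a b) where
  open CommutativeRing k
    using (Carrier; _≈_; 0#; 1#; setoid; +-cong; *-cong; -‿cong;
           +-identityˡ; +-identityʳ; zeroˡ; zeroʳ)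
    renaming (_+_ to _+ᵏ_; _*_ to _*ᵏ_; -_ to -ᵏ_)
  private
    module k = CommutativeRing k
    module kΣ = RawMonoidDefs k.+-rawMonoid
  open SumProperties k.+-commutativeMonoid using (sum; sum-cong-≋; sum-replicate-zero; ∑-comm)
  open RawSemiringDefs (RawRing.rawSemiring k.rawRing) using () renaming (_^_ to _^ᵏ_)

  ι : ℤ → Carrier
  ι (+ n)    = n kΣ.× 1#
  ι -[1+ n ] = -ᵏ (suc n kΣ.× 1#)

  δ : Partition → Partition → Carrier
  δ μ ν = if does (≡-dec ℕ._≟_ (parts μ) (parts ν)) then 1# else 0#

  -- A list α = α₁ ∷ … ∷ αₙ ∷ [] stands for the monomial x₁^α₁ ⋯ xₙ^αₙ and a
  -- series is given by its coefficients.  The lists of length n carry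
  -- f(x₁,…,xₙ,0,0,…); the condition `stable` below makes the coefficient
  -- independent of trailing zeros.

  Series : Set a
  Series = List ℕ → Carrier

  infix 4 _≈ˢ_ _≈[_]_
  _≈ˢ_ : Series → Series → Set b
  f ≈ˢ g = ∀ α → f α ≈ g α

  -- f(x₁,…,xₙ,0,0,…) = g(x₁,…,xₙ,0,0,…)
  _≈[_]_ : Series → ℕ → Series → Set b
  f ≈[ n ] g = ∀ α → length α ≡ n → f α ≈ g α

  infixl 6 _+ˢ_
  infixl 7 _*ˢ_
  infixr 8 _•ˢ_

  0ˢ : Series
  0ˢ _ = 0#

  _+ˢ_ : Series → Series → Series
  (f +ˢ g) α = f α +ᵏ g α

  -ˢ_ : Series → Series
  (-ˢ f) α = -ᵏ f α

  _•ˢ_ : Carrier → Series → Series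
  (c •ˢ f) α = c *ᵏ f α

  -- The sum of f γ * g γ′ over all pairs with γ + γ′ = α.
  _*ˢ_ : Series → Series → Series
  (f *ˢ g) []      = f [] *ᵏ g []
  (f *ˢ g) (n ∷ α) = sum {suc n} λ i →
    ((λ γ → f (toℕ i ∷ γ)) *ˢ (λ γ → g ((n ∸ toℕ i) ∷ γ))) α

  hˢ : ℤ → Series
  hˢ (+ m)    α = if does (total α ℕ.≟ m) then 1# else 0#
  hˢ -[1+ _ ] α = 0#

  1ˢ : Series
  1ˢ = hˢ (+ 0)

  -- The variable x_{i+1}.
  var : ℕ → Series
  var _       []            = 0#
  var zero    (1 ∷ α)       = 1ˢ α
  var zero    (_ ∷ _)       = 0#
  var (suc i) (zero ∷ α)    = var i α
  var (suc i) (suc _ ∷ _)   = 0#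

  seriesRing : RawRing a b
  seriesRing = record
    { Carrier = Series ; _≈_ = _≈ˢ_ ; _+_ = _+ˢ_ ; _*_ = _*ˢ_ ; -_ = -ˢ_ ; 0# = 0ˢ ; 1# = 1ˢ }

  open Matrix seriesRing using () renaming (det to detˢ) public
  open RawSemiringDefs (RawRing.rawSemiring seriesRing) using () renaming (_^_ to _^ˢ_) public
  open RawMonoidDefs (RawRing.*-rawMonoid seriesRing) using () renaming (sum to prodˢ) public

  -- ∏_{1≤i<j≤n} (xᵢ - xⱼ)
  vandermonde : ℕ → Series
  vandermonde n = prodˢ {n} λ i → prodˢ {n} λ j →
    if does (i Fin.<? j) then var (toℕ i) +ˢ (-ˢ var (toℕ j)) else 1ˢ

  record Λ : Set (a ⊔ b) where
    field
      series    : Series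
      symmetric : ∀ {α γ} → α ↭ γ → series α ≈ series γ
      stable    : ∀ α → series (α ∷ʳ 0) ≈ series α
      -- an upper bound for the degree, not necessarily attained
      deg       : ℕ
      bounded   : ∀ α → deg < total α → series α ≈ 0#

  open Λ public

  infix 4 _≈ᴸ_
  _≈ᴸ_ : Λ → Λ → Set b
  f ≈ᴸ g = series f ≈ˢ series g

  private
    open import Relation.Binary.Reasoning.Setoid setoid

    *ˢ-cong : ∀ {f f′ g g′} → f ≈ˢ f′ → g ≈ˢ g′ → f *ˢ g ≈ˢ f′ *ˢ g′
    *ˢ-cong p q []      = *-cong (p []) (q [])
    *ˢ-cong p q (n ∷ α) = sum-cong-≋ λ (i : Fin (suc n)) →
      *ˢ-cong (λ γ → p (toℕ i ∷ γ)) (λ γ → q ((n ∸ toℕ i) ∷ γ)) α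

    *ˢ-symmetric : ∀ {f g} → (∀ {α γ} → α ↭ γ → f α ≈ f γ) → (∀ {α γ} → α ↭ γ → g α ≈ g γ) →
                   ∀ {α γ} → α ↭ γ → (f *ˢ g) α ≈ (f *ˢ g) γ
    *ˢ-symmetric p q refl = k.refl
    *ˢ-symmetric p q (prep n r) = sum-cong-≋ λ (i : Fin (suc n)) →
      *ˢ-symmetric (λ s → p (prep (toℕ i) s)) (λ s → q (prep (n ∸ toℕ i) s)) r
    *ˢ-symmetric {f} {g} p q (swap {α} {γ} m n r) = begin
      sum (λ (i : Fin (suc m)) → sum (λ (j : Fin (suc n)) →
        ((λ ε → f (toℕ i ∷ toℕ j ∷ ε)) *ˢ (λ ε → g ((m ∸ toℕ i) ∷ (n ∸ toℕ j) ∷ ε))) α))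
        ≈⟨ ∑-comm (λ (i : Fin (suc m)) (j : Fin (suc n)) → ((λ ε → f (toℕ i ∷ toℕ j ∷ ε)) *ˢ (λ ε → g ((m ∸ toℕ i) ∷ (n ∸ toℕ j) ∷ ε))) α) ⟩
      sum (λ (j : Fin (suc n)) → sum (λ (i : Fin (suc m)) →
        ((λ ε → f (toℕ i ∷ toℕ j ∷ ε)) *ˢ (λ ε → g ((m ∸ toℕ i) ∷ (n ∸ toℕ j) ∷ ε))) α))
        ≈⟨ sum-cong-≋ (λ (j : Fin (suc n)) → sum-cong-≋ (λ (i : Fin (suc m)) → k.trans
             (*ˢ-cong (λ ε → p (swap (toℕ i) (toℕ j) (refl {xs = ε})))
                      (λ ε → q (swap (m ∸ toℕ i) (n ∸ toℕ j) (refl {xs = ε}))) α)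
             (*ˢ-symmetric (λ s → p (prep (toℕ j) (prep (toℕ i) s)))
                           (λ s → q (prep (n ∸ toℕ j) (prep (m ∸ toℕ i) s))) r))) ⟩
      sum (λ (j : Fin (suc n)) → sum (λ (i : Fin (suc m)) →
        ((λ ε → f (toℕ j ∷ toℕ i ∷ ε)) *ˢ (λ ε → g ((n ∸ toℕ j) ∷ (m ∸ toℕ i) ∷ ε))) γ)) ∎
    *ˢ-symmetric p q (trans r s) = k.trans (*ˢ-symmetric p q r) (*ˢ-symmetric p q s)

    *ˢ-stable : ∀ {f g} → (∀ α → f (α ∷ʳ 0) ≈ f α) → (∀ α → g (α ∷ʳ 0) ≈ g α) →
                ∀ α → (f *ˢ g) (α ∷ʳ 0) ≈ (f *ˢ g) α
    *ˢ-stable p q []      = k.trans (+-identityʳ _) (*-cong (p []) (q []))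
    *ˢ-stable p q (n ∷ α) = sum-cong-≋ λ (i : Fin (suc n)) →
      *ˢ-stable (λ γ → p (toℕ i ∷ γ)) (λ γ → q ((n ∸ toℕ i) ∷ γ)) α

    +-<-split : ∀ {m n s t} → m ℕ.+ n < s ℕ.+ t → m < s ⊎ n < t
    +-<-split {m} {n} {s} {t} p with m ℕ.<? s | n ℕ.<? t
    ... | yes m<s | _       = inj₁ m<s
    ... | no  _   | yes n<t = inj₂ n<t
    ... | no  m≮s | no  n≮t =
      contradiction p (ℕ.≤⇒≯ (ℕ.+-mono-≤ (ℕ.≮⇒≥ m≮s) (ℕ.≮⇒≥ n≮t)))

    *ˢ-bounded : ∀ {f g} m n s t →
                 (∀ α → m < s ℕ.+ total α → f α ≈ 0#) → (∀ α → n < t ℕ.+ total α → g α ≈ 0#) →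
                 ∀ α → m ℕ.+ n < s ℕ.+ t ℕ.+ total α → (f *ˢ g) α ≈ 0#
    *ˢ-bounded m n s t p q [] r
      with +-<-split {m} {n} {s} {t} (≡.subst (m ℕ.+ n <_) (ℕ.+-identityʳ (s ℕ.+ t)) r)
    ... | inj₁ m<s = k.trans (*-cong (p [] (≡.subst (m <_) (≡.sym (ℕ.+-identityʳ s)) m<s)) k.refl) (zeroˡ _)
    ... | inj₂ n<t = k.trans (*-cong k.refl (q [] (≡.subst (n <_) (≡.sym (ℕ.+-identityʳ t)) n<t))) (zeroʳ _)
    *ˢ-bounded m n s t p q (e ∷ α) r = k.trans
      (sum-cong-≋ λ (i : Fin (suc e)) → *ˢ-bounded m n (s ℕ.+ toℕ i) (t ℕ.+ (e ∸ toℕ i))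
        (λ γ u → p (toℕ i ∷ γ) (≡.subst (m <_) (ℕ.+-assoc s (toℕ i) (total γ)) u))
        (λ γ u → q ((e ∸ toℕ i) ∷ γ) (≡.subst (n <_) (ℕ.+-assoc t (e ∸ toℕ i) (total γ)) u))
        α (≡.subst (m ℕ.+ n <_) (regroup (toℕ i) (e ∸ toℕ i) (≡.sym (ℕ.m+[n∸m]≡n (Fin.toℕ≤pred[n] i)))) r))
      (sum-replicate-zero (suc e))
      where
      open +-*-Solver
      regroup : ∀ x y → e ≡ x ℕ.+ y →
                s ℕ.+ t ℕ.+ (e ℕ.+ total α) ≡ s ℕ.+ x ℕ.+ (t ℕ.+ y) ℕ.+ total α
      regroup x y ≡.refl =
        solve 5 (λ S T X Y A → S :+ T :+ (X :+ Y :+ A) := S :+ X :+ (T :+ Y) :+ A) ≡.refl s t x y (total α)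

    hˢ-total : ∀ m {α γ} → total α ≡ total γ → hˢ m α ≈ hˢ m γ
    hˢ-total (+ m)    p = k.reflexive (≡.cong (λ d → if does (d ℕ.≟ m) then 1# else 0#) p)
    hˢ-total -[1+ _ ] _ = k.refl

    total-∷ʳ0 : ∀ α → total (α ∷ʳ 0) ≡ total α
    total-∷ʳ0 []      = ≡.refl
    total-∷ʳ0 (n ∷ α) = ≡.cong (n ℕ.+_) (total-∷ʳ0 α)

    indicator-no : ∀ {p} {P : Set p} (d : Dec P) → ¬ P → (if does d then 1# else 0#) ≈ 0#
    indicator-no (yes x) ¬x = contradiction x ¬x
    indicator-no (no _)  _  = k.refl

    hˢ-bounded : ∀ m α → ℤ.∣ m ∣ < total α → hˢ m α ≈ 0#
    hˢ-bounded (+ m) α p = indicator-no (total α ℕ.≟ m) (λ q → ℕ.<⇒≢ p (≡.sym q))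
    hˢ-bounded -[1+ _ ] α p = k.refl

  h : ℤ → Λ
  h m = record
    { series    = hˢ m
    ; symmetric = λ r → hˢ-total m (total-↭ r)
    ; stable    = λ α → hˢ-total m (total-∷ʳ0 α)
    ; deg       = ℤ.∣ m ∣
    ; bounded   = hˢ-bounded m
    }

  infixl 6 _+_ _-_
  infixl 7 _*_
  infixr 8 _•_
  infix  8 -_

  0ᴸ : Λ
  0ᴸ = record
    { series = 0ˢ ; symmetric = λ _ → k.refl ; stable = λ _ → k.refl
    ; deg = 0 ; bounded = λ _ _ → k.refl }

  1ᴸ : Λ
  1ᴸ = h (+ 0)

  _+_ : Λ → Λ → Λ
  f + g = record
    { series    = series f +ˢ series g
    ; symmetric = λ r → +-cong (symmetric f r) (symmetric g r)
    ; stable    = λ α → +-cong (stable f α) (stable g α)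
    ; deg       = deg f ℕ.⊔ deg g
    ; bounded   = λ α p → k.trans
        (+-cong (bounded f α (ℕ.≤-<-trans (ℕ.m≤m⊔n (deg f) (deg g)) p))
                (bounded g α (ℕ.≤-<-trans (ℕ.m≤n⊔m (deg f) (deg g)) p)))
        (+-identityˡ 0#)
    }

  -_ : Λ → Λ
  - f = record
    { series    = -ˢ series f
    ; symmetric = λ r → -‿cong (symmetric f r)
    ; stable    = λ α → -‿cong (stable f α)
    ; deg       = deg f
    ; bounded   = λ α p → k.trans (-‿cong (bounded f α p)) (RingProperties.-0#≈0# k.ring)
    }

  _-_ : Λ → Λ → Λ
  f - g = f + (- g)

  _•_ : Carrier → Λ → Λ
  c • f = record
    { series    = c •ˢ series f
    ; symmetric = λ r → *-cong k.refl (symmetric f r)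
    ; stable    = λ α → *-cong k.refl (stable f α)
    ; deg       = deg f
    ; bounded   = λ α p → k.trans (*-cong k.refl (bounded f α p)) (zeroʳ c)
    }

  _*_ : Λ → Λ → Λ
  f * g = record
    { series    = series f *ˢ series g
    ; symmetric = *ˢ-symmetric {series f} {series g} (symmetric f) (symmetric g)
    ; stable    = *ˢ-stable {series f} {series g} (stable f) (stable g)
    ; deg       = deg f ℕ.+ deg g
    ; bounded   = *ˢ-bounded (deg f) (deg g) 0 0 (bounded f) (bounded g)
    }

  Λ-ring : RawRing (a ⊔ b) b
  Λ-ring = record
    { Carrier = Λ ; _≈_ = _≈ᴸ_ ; _+_ = _+_ ; _*_ = _*_ ; -_ = -_ ; 0# = 0ᴸ ; 1# = 1ᴸ }

  open Matrix Λ-ring using (det) public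
  open RawMonoidDefs (RawRing.+-rawMonoid Λ-ring) using () renaming (sum to sumᴸ) public

  -- s_ν(x₁,…,xₙ) = det (xᵢ^(νⱼ+n-j)) / ∏_{i<j} (xᵢ - xⱼ) for all n ≥ ℓ(ν);
  -- the denominator, not a zero divisor, is multiplied out.
  IsSchur : Partition → Λ → Set b
  IsSchur ν f = ∀ n → ℓ ν ≤ n →
    series f *ˢ vandermonde n ≈[ n ]
      detˢ {n} (λ i j → var (toℕ i) ^ˢ (part ν (toℕ j) ℕ.+ (n ∸ suc (toℕ j))))

  record HallProduct (s : Partition → Λ) : Set (a ⊔ b) where
    field
      ⟨_,_⟩  : Λ → Λ → Carrier
      cong   : ∀ {f f′ g g′} → f ≈ᴸ f′ → g ≈ᴸ g′ → ⟨ f , g ⟩ ≈ ⟨ f′ , g′ ⟩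
      +-left  : ∀ f f′ g → ⟨ f + f′ , g ⟩ ≈ ⟨ f , g ⟩ +ᵏ ⟨ f′ , g ⟩
      +-right : ∀ f g g′ → ⟨ f , g + g′ ⟩ ≈ ⟨ f , g ⟩ +ᵏ ⟨ f , g′ ⟩
      •-left  : ∀ c f g → ⟨ c • f , g ⟩ ≈ c *ᵏ ⟨ f , g ⟩
      •-right : ∀ c f g → ⟨ f , c • g ⟩ ≈ c *ᵏ ⟨ f , g ⟩
      orthonormal : ∀ μ ν → ⟨ s μ , s ν ⟩ ≈ δ μ ν

    -- The extension to Λ̂ × Λ.  An element of Λ̂ is given by representatives
    -- F n of its images in Λ/Iₙ (see below).  As g has degree at most
    -- N = deg g, it is a combination of s_ν with ℓ(ν) ≤ |ν| ≤ N, and these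
    -- are orthogonal to I_N; so ⟨ F N , g ⟩ does not depend on the
    -- representative, and N may be replaced by any larger number.
    ⟪_,_⟫ : (ℕ → Λ) → Λ → Carrier
    ⟪ F , g ⟫ = ⟨ F (deg g) , g ⟩

  module Completion (s : Partition → Λ) where

    -- Iₙ is the span of the s_ν with ℓ(ν) > n.
    _∈I_ : Λ → ℕ → Set (a ⊔ b)
    f ∈I n = ∃[ m ] Σ[ c ∈ (Fin m → Carrier) ] Σ[ ν ∈ (Fin m → Partition) ]
      (∀ i → n < ℓ (ν i)) × f ≈ᴸ sumᴸ (λ i → c i • s (ν i))

    record Λ̂ : Set (a ⊔ b) where
      field
        image      : ℕ → Λ
        compatible : ∀ n → (image (suc n) - image n) ∈I n

    open Λ̂ public

    -- Λ acts on Λ̂ by multiplication in each quotient Λ/Iₙ.  The result is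
    -- given by its representatives; they are compatible as Iₙ is an ideal.
    infixl 7 _⊛_
    _⊛_ : Λ̂ → Λ → (ℕ → Λ)
    (F ⊛ f) n = image F n * f

    -- G_ν(x₁,…,xₙ,0,0,…) only depends on the image of G_ν in Λ/Iₙ.  The
    -- index j starts from 0 here, so the exponents n-j and j-1 of the usual
    -- formula become n ∸ suc j and j.
    IsStableGrothendieck : Carrier → Partition → Λ̂ → Set b
    IsStableGrothendieck β ν F = ∀ n → ℓ ν ≤ n →
      series (image F n) *ˢ vandermonde n ≈[ n ]
        detˢ {n} (λ i j →
          var (toℕ i) ^ˢ (part ν (toℕ j) ℕ.+ (n ∸ suc (toℕ j)))
          *ˢ (1ˢ +ˢ β •ˢ var (toℕ i)) ^ˢ toℕ j)

    module _ (H : HallProduct s) (G : Partition → Λ̂) where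
      open HallProduct H

      IsDualFamily : (Partition → Λ) → Set b
      IsDualFamily g = ∀ μ ν → ⟪ image (G μ) , g ν ⟫ ≈ δ μ ν

      -- f = G_μ^⊥ g
      IsSkewing : Partition → Λ → Λ → Set (a ⊔ b)
      IsSkewing μ g f = ∀ p → ⟨ f , p ⟩ ≈ ⟪ G μ ⊛ p , g ⟫

  -- Σ_{n≥0} binom(d,n) βⁿ h_{m-n}.  The terms with n > |m| vanish, since
  -- h_{m-n} = 0 for n > m.
  binomialSum : Carrier → ℤ → ℤ → Λ
  binomialSum β d m = sumᴸ {suc ℤ.∣ m ∣} λ n →
    (ι (binom d (toℕ n)) *ᵏ β ^ᵏ toℕ n) • h (m ℤ.- + toℕ n)

{-# OPTIONS --safe #-}
module Submission where

-- Let a = ∏_{i<j} (xᵢ - xⱼ) and δ = (n - 1, …, 1, 0).  In n variables G_μ a is the determinant of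
-- the series xᵢ^(μⱼ+n-j) (1 + βxᵢ)^(j-1), so the coefficient of x^(λ+δ) in G_μ a ∏ (1 + βxᵢ)^(1-i)
-- is a determinant of coefficients of the series (1 + βt)^(j-i), whose zero pattern makes it
-- δ_{λμ}.  Therefore F ↦ [x^(λ+δ)] F a ∏ (1 + βxᵢ)^(1-i) is the pairing with g_λ.  By the
-- Jacobi-Trudi identity the products h_α are dual to the monomials, so the coefficient of y^α in
-- g_{λ/μ} is [x^(λ+δ)] h_α G_μ a ∏ (1 + βxᵢ)^(1-i).  Multiplication by ∏ h_{αᵢ} acts on the rows
-- of the determinant and turns its entries into ∑ binom(j-i,n) βⁿ h_{λᵢ-μⱼ-i+j-n}(y).

open import Algebra.Bundles using (CommutativeRing; RawRing)
import Algebra.Definitions.RawMonoid as RawMonoidDefs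
import Algebra.Definitions.RawSemiring as RawSemiringDefs
open import Algebra.Morphism.Structures using (module RingMorphisms)
import Algebra.Properties.CommutativeMonoid.Sum as CommutativeMonoidSum
import Algebra.Properties.Ring as RingProperties
import Algebra.Properties.Semiring.Mult as SemiringMult
import Algebra.Properties.Semiring.Sum as SemiringSum
import Algebra.Solver.Ring as RingSolver
import Algebra.Solver.Ring.AlmostCommutativeRing as ACR
open import Data.Bool.Base using (if_then_else_)
open import Data.Fin.Base as Fin using (Fin; zero; suc; toℕ; punchIn; fromℕ; inject₁)
import Data.Fin.Properties as Fin
open import Data.Integer.Base as ℤ using (ℤ; +_; -[1+_])
import Data.Integer.DivMod as ℤ
import Data.Integer.Properties as ℤ
import Data.Integer.Solver as ℤSolver
open import Data.List.Base as List using (List; []; _∷_; length)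
open import Data.List.Membership.Propositional using (_∈_)
open import Data.List.Membership.Propositional.Properties using (∈-cartesianProductWith⁺; ∈-upTo⁺)
import Data.List.Properties as List
open import Data.List.Relation.Binary.Permutation.Propositional as Perm using (_↭_; prep; swap)
open import Data.List.Relation.Binary.Permutation.Propositional.Properties using (↭-length; ∷↭∷ʳ)
open import Data.List.Relation.Unary.All using (All; []; _∷_)
open import Data.List.Relation.Unary.Any using (here; there)
open import Data.List.Relation.Unary.Linked as Linked using (Linked; []; [-]; _∷_)
open import Data.Maybe.Base using (Maybe; just; nothing)
open import Data.Nat.Base as ℕ using (ℕ; zero; suc; _∸_; _≤_; _<_; _≥_; _>_; _!; z≤n; s≤s; z<s; s<s)
open import Data.Nat.ListAction using () renaming (sum to total)
open import Data.Nat.ListAction.Properties using () renaming (sum-↭ to total-↭)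
import Data.Nat.Properties as ℕ
open import Data.Nat.Solver using (module +-*-Solver)
open import Data.Product.Base using (Σ-syntax; ∃-syntax; _×_; _,_; proj₁; proj₂)
open import Data.Sum.Base using (_⊎_; inj₁; inj₂)
open import Data.Unit.Polymorphic.Base using (⊤; tt)
open import Data.Vec.Base as Vec using (Vec; []; _∷_; lookup; tabulate)
open import Data.Vec.Functional using () renaming (_∷_ to _∷ᶠ_)
import Data.Vec.Properties as Vec
open import Function.Base using (_∘_)
open import Level using (_⊔_)
import Relation.Binary.Construct.Flip.EqAndOrd as Flip
open import Relation.Binary.Definitions using (tri<; tri≈; tri>)
open import Relation.Binary.PropositionalEquality as ≡ using (_≡_; _≢_)
import Relation.Binary.Reasoning.Setoid as SetoidReasoning
open import Relation.Nullary.Decidable using (_×-dec_)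
open import Relation.Nullary.Decidable.Core using (Dec; does; yes; no)
open import Relation.Nullary.Negation.Core using (¬_; contradiction)
open import Data.List.Sort (Flip.decTotalOrder ℕ.≤-decTotalOrder) using (sort; sort-↭; sort-↗)
open import Defs

-- The columns of the determinant for G_μ carry (1 + βxᵢ)^(j-1). The rows are divided by (1 +
-- βxᵢ)^(i-1) because this leaves pure monomials on the diagonal and, above it, polynomials of
-- degree j - i, just small enough to vanish where the zero pattern asks for it. The factor is not
-- symmetric, so the product is no longer alternating; the functional is identified with the pairing
-- by its values alone. The obstacle is that these values are known on the G_ν, which lie in the
-- completion, while the Hall product is given on the s_ν. Both functionals vanish on series of
-- large order, and G_ν is s_ν plus terms of higher degree, so a descending induction on the order
-- passes from one family to the other. The ring k is arbitrary. Division by a is replaced by the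
-- fact that xᵢ - xⱼ is not a zero divisor for i ≠ j, and an alternating series has to vanish at
-- repeated exponents as a separate condition. The number n of variables is large at first; it is
-- cut down to r at the end, since beyond r both λ and μ have no parts and the last row is (0, ...,
-- 0, 1).

-- Integers in a commutative ring, and a solver with integer coefficients.

module IntegerImage {a b} (R : CommutativeRing a b) where
  open CommutativeRing R
  open SymmetricFunctions R using (ι)
  open RingProperties ring
  open SemiringMult semiring using (×-homo-+; ×1-homo-*) renaming (_×_ to _·_)
  open SetoidReasoning setoid

  ι-⊖ : ∀ m n → ι (m ℤ.⊖ n) ≈ m · 1# - n · 1#
  ι-⊖ zero    zero    = sym (-‿inverseʳ 0#)
  ι-⊖ zero    (suc n) = sym (+-identityˡ _)
  ι-⊖ (suc m) zero    = sym (trans (+-congˡ -0#≈0#) (+-identityʳ _))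
  ι-⊖ (suc m) (suc n) = begin
    ι (suc m ℤ.⊖ suc n)               ≡⟨ ≡.cong ι (ℤ.[1+m]⊖[1+n]≡m⊖n m n) ⟩
    ι (m ℤ.⊖ n)                       ≈⟨ ι-⊖ m n ⟩
    x - y                             ≈⟨ +-congˡ (+-identityˡ (- y)) ⟨
    x + (0# - y)                      ≈⟨ +-congˡ (+-congʳ (-‿inverseʳ 1#)) ⟨
    x + ((1# - 1#) - y)               ≈⟨ +-congˡ (+-assoc 1# (- 1#) (- y)) ⟩
    x + (1# + (- 1# - y))             ≈⟨ +-assoc x 1# (- 1# - y) ⟨
    (x + 1#) + (- 1# - y)             ≈⟨ +-cong (+-comm x 1#) (-‿+-comm 1# y) ⟩
    (1# + x) - (1# + y)               ∎
    where
    x = m · 1#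
    y = n · 1#

  ι-neg : ∀ m → ι (ℤ.- m) ≈ - ι m
  ι-neg (+ zero)  = sym -0#≈0#
  ι-neg (+ suc n) = refl
  ι-neg -[1+ n ]  = sym (-‿involutive _)

  ι-+ : ∀ m n → ι (m ℤ.+ n) ≈ ι m + ι n
  ι-+ (+ m)    (+ n)    = ×-homo-+ 1# m n
  ι-+ (+ m)    -[1+ n ] = ι-⊖ m (suc n)
  ι-+ -[1+ m ] (+ n)    = trans (ι-⊖ n (suc m)) (+-comm _ _)
  ι-+ -[1+ m ] -[1+ n ] = begin
    - (suc (suc (m ℕ.+ n)) · 1#)    ≡⟨ ≡.cong (λ l → - (suc l · 1#)) (ℕ.+-suc m n) ⟨
    - ((suc m ℕ.+ suc n) · 1#)      ≈⟨ -‿cong (×-homo-+ 1# (suc m) (suc n)) ⟩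
    - (suc m · 1# + suc n · 1#)     ≈⟨ -‿+-comm _ _ ⟨
    - (suc m · 1#) - (suc n · 1#)   ∎

  ι-+-* : ∀ m n → ι (+ m ℤ.* + n) ≈ ι (+ m) * ι (+ n)
  ι-+-* m n = trans (reflexive (≡.cong ι (≡.sym (ℤ.pos-* m n)))) (×1-homo-* m n)

  ι-*-+ : ∀ m n → ι (m ℤ.* + n) ≈ ι m * ι (+ n)
  ι-*-+ (+ m)    n = ι-+-* m n
  ι-*-+ -[1+ m ] n = begin
    ι (-[1+ m ] ℤ.* + n)       ≡⟨ ≡.cong ι (ℤ.neg-distribˡ-* (+ suc m) (+ n)) ⟨
    ι (ℤ.- (+ suc m ℤ.* + n))  ≈⟨ ι-neg (+ suc m ℤ.* + n) ⟩
    - ι (+ suc m ℤ.* + n)      ≈⟨ -‿cong (ι-+-* (suc m) n) ⟩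
    - (ι (+ suc m) * ι (+ n))  ≈⟨ -‿distribˡ-* _ _ ⟩
    - ι (+ suc m) * ι (+ n)    ∎

  ι-* : ∀ m n → ι (m ℤ.* n) ≈ ι m * ι n
  ι-* m (+ n)    = ι-*-+ m n
  ι-* m -[1+ n ] = begin
    ι (m ℤ.* -[1+ n ])         ≡⟨ ≡.cong ι (ℤ.neg-distribʳ-* m (+ suc n)) ⟨
    ι (ℤ.- (m ℤ.* + suc n))    ≈⟨ ι-neg (m ℤ.* + suc n) ⟩
    - ι (m ℤ.* + suc n)        ≈⟨ -‿cong (ι-*-+ m (suc n)) ⟩
    - (ι m * ι (+ suc n))      ≈⟨ -‿distribʳ-* _ _ ⟩
    ι m * - ι (+ suc n)        ∎

  private
    ℤ-morphism : ACR._-Raw-AlmostCommutative⟶_ (CommutativeRing.rawRing ℤ.+-*-commutativeRing)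
                   (ACR.fromCommutativeRing R)
    ℤ-morphism = record
      { ⟦_⟧    = ι
      ; +-homo = ι-+
      ; *-homo = ι-*
      ; -‿homo = ι-neg
      ; 0-homo = refl
      ; 1-homo = +-identityʳ 1#
      }

    -- Equality in R is not assumed decidable. The solver computes its coefficients in ℤ, where
    -- equal integers can be recognised.
    coefficient-equal : ∀ m n → Maybe (ι m ≈ ι n)
    coefficient-equal m n with m ℤ.≟ n
    ... | yes m≡n = just (reflexive (≡.cong ι m≡n))
    ... | no  _   = nothing

  module Solver = RingSolver (CommutativeRing.rawRing ℤ.+-*-commutativeRing)
    (ACR.fromCommutativeRing R) ℤ-morphism coefficient-equal

-- Finite sums.

module Summation {a b} (R : CommutativeRing a b) where
  open CommutativeRing R hiding (zero)
  open RingProperties ring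
  private module Σ = SemiringSum semiring

  -- Opaque, so that the summand of a sum over Fin (suc n) can be inferred by unification.
  opaque
    ∑ : ∀ {n} → (Fin n → Carrier) → Carrier
    ∑ = Σ.sum

    ∑-def : ∀ {n} (f : Fin n → Carrier) → Σ.sum f ≡ ∑ f
    ∑-def f = ≡.refl

    ∑-empty : (f : Fin 0 → Carrier) → ∑ f ≡ 0#
    ∑-empty f = ≡.refl

    ∑-suc : ∀ {n} (f : Fin (suc n) → Carrier) → ∑ f ≡ f zero + ∑ (λ i → f (suc i))
    ∑-suc f = ≡.refl

    ∑-cong : ∀ {n} {f g : Fin n → Carrier} → (∀ i → f i ≈ g i) → ∑ f ≈ ∑ g
    ∑-cong {n} {f} {g} p = Σ.sum-cong-≋ {n} {f} {g} p

    ∑-zero : ∀ {n} {f : Fin n → Carrier} → (∀ i → f i ≈ 0#) → ∑ f ≈ 0#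
    ∑-zero {n} {f} p = trans (Σ.sum-cong-≋ {n} {f} {λ _ → 0#} p) (Σ.sum-replicate-zero n)

    ∑-+ : ∀ {n} (f g : Fin n → Carrier) → ∑ (λ i → f i + g i) ≈ ∑ f + ∑ g
    ∑-+ = Σ.∑-distrib-+

    ∑-neg : ∀ {n} (f : Fin n → Carrier) → - ∑ f ≈ ∑ (λ i → - f i)
    ∑-neg {zero}  f = -0#≈0#
    ∑-neg {suc n} f = trans (sym (-‿+-comm _ _)) (+-congˡ (∑-neg (λ i → f (suc i))))

    ∑-*ˡ : ∀ {n} x (f : Fin n → Carrier) → x * ∑ f ≈ ∑ (λ i → x * f i)
    ∑-*ˡ = Σ.*-distribˡ-sum

    ∑-swap : ∀ {m n} (f : Fin m → Fin n → Carrier) → ∑ (λ i → ∑ (f i)) ≈ ∑ (λ j → ∑ (λ i → f i j))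
    ∑-swap = Σ.∑-comm

    ∑-last : ∀ {n} (f : Fin (suc n) → Carrier) → ∑ f ≈ ∑ (λ i → f (inject₁ i)) + f (fromℕ n)
    ∑-last f = Σ.sum-init-last f

  ∑-head : ∀ {n} {f : Fin (suc n) → Carrier} → (∀ i → f (suc i) ≈ 0#) → ∑ f ≈ f zero
  ∑-head {f = f} p = trans (reflexive (∑-suc f)) (trans (+-congˡ (∑-zero p)) (+-identityʳ _))

-- Determinants and alternating multilinear forms.

module Determinant {a b} (R : CommutativeRing a b) where
  open CommutativeRing R hiding (zero)
  open RingProperties ring
  open Summation R public
  open Matrix rawRing using (det)
  open RawSemiringDefs (RawRing.rawSemiring rawRing) using (_^_)
  open SetoidReasoning setoid
  open IntegerImage R

  sign : ∀ {n} → Fin n → Carrier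
  sign j = (- 1#) ^ toℕ j

  minor : ∀ {n} → (Fin (suc n) → Fin (suc n) → Carrier) → Fin (suc n) → Fin (suc n) → Fin n → Fin n → Carrier
  minor M i j p q = M (punchIn i p) (punchIn j q)

  opaque
    unfolding ∑

    -- An opaque copy of `det`: a goal keeps the shape `Det M`, from which M can be inferred, until
    -- `Det-expand` is applied.
    Det : ∀ {n} → (Fin n → Fin n → Carrier) → Carrier
    Det = det

    det-def : ∀ {n} (M : Fin n → Fin n → Carrier) → det M ≡ Det M
    det-def M = ≡.refl

    Det-empty : (M : Fin 0 → Fin 0 → Carrier) → Det M ≡ 1#
    Det-empty M = ≡.refl

    Det-expand : ∀ {n} (M : Fin (suc n) → Fin (suc n) → Carrier) →
                 Det M ≡ ∑ λ j → sign j * (M zero j * Det (minor M zero j))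
    Det-expand M = ≡.refl

  term-cong : ∀ {n} (j : Fin n) {x x′ y y′} → x ≈ x′ → y ≈ y′ → sign j * (x * y) ≈ sign j * (x′ * y′)
  term-cong j p q = *-congˡ (*-cong p q)

  term-zeroˡ : ∀ {n} (j : Fin n) {x y} → x ≈ 0# → sign j * (x * y) ≈ 0#
  term-zeroˡ j p = trans (*-congˡ (trans (*-congʳ p) (zeroˡ _))) (zeroʳ _)

  term-zeroʳ : ∀ {n} (j : Fin n) {x y} → y ≈ 0# → sign j * (x * y) ≈ 0#
  term-zeroʳ j p = trans (*-congˡ (trans (*-congˡ p) (zeroʳ _))) (zeroʳ _)

  Det-cong : ∀ {n} {M N : Fin n → Fin n → Carrier} → (∀ i j → M i j ≈ N i j) → Det M ≈ Det N
  Det-cong {zero}  {M} {N} p = reflexive (≡.trans (Det-empty M) (≡.sym (Det-empty N)))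
  Det-cong {suc n} {M} {N} p = begin
    Det M                                               ≡⟨ Det-expand M ⟩
    ∑ (λ j → sign j * (M zero j * Det (minor M zero j)))
      ≈⟨ ∑-cong (λ j → term-cong j (p zero j) (Det-cong λ i l → p (suc i) (punchIn j l))) ⟩
    ∑ (λ j → sign j * (N zero j * Det (minor N zero j))) ≡⟨ Det-expand N ⟨
    Det N                                               ∎

  Det-zero-row : ∀ {n} (M : Fin (suc n) → Fin (suc n) → Carrier) → (∀ j → M zero j ≈ 0#) → Det M ≈ 0#
  Det-zero-row M p = trans (reflexive (Det-expand M)) (∑-zero λ j → term-zeroˡ j (p j))

  -- Expand along the first row and, by induction, each minor that still contains the first column
  -- along that column. Interchanging the sums gives the row expansions of the minors
  -- `minor M (suc i) zero`: the double minor `D i j` arises in both orders of deletion, each time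
  -- with the sign of i + j + 1.
  Det-first-column : ∀ {n} (M : Fin (suc n) → Fin (suc n) → Carrier) →
                     Det M ≈ ∑ λ i → sign i * (M i zero * Det (minor M i zero))
  Det-first-column {zero} M = begin
    Det M ≡⟨ Det-expand M ⟩
    ∑ (λ j → sign j * (M zero j * Det (minor M zero j)))
      ≈⟨ ∑-cong (λ { zero → term-cong {1} zero refl (Det-cong λ ()) }) ⟩
    ∑ (λ i → sign i * (M i zero * Det (minor M i zero))) ∎
  Det-first-column {suc n} M = begin
    Det M ≡⟨ Det-expand M ⟩
    ∑ (λ j → sign j * (M zero j * Det (minor M zero j)))
      ≡⟨ ∑-suc _ ⟩
    sign {suc (suc n)} zero * (M zero zero * Det (minor M zero zero)) + ∑ (λ j → sign (suc j) * (M zero (suc j) * Det (minor M zero (suc j))))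
      ≈⟨ +-congˡ (begin
    ∑ (λ j → sign (suc j) * (M zero (suc j) * Det (minor M zero (suc j))))
      ≈⟨ ∑-cong (λ j → *-congˡ (trans (*-congˡ (Det-first-column (minor M zero (suc j)))) (∑-*ˡ _ _))) ⟩
    ∑ (λ j → sign (suc j) * ∑ (λ i → M zero (suc j) * (sign i * (M (suc i) zero * D i j))))
      ≈⟨ ∑-cong (λ j → ∑-*ˡ (sign (suc j)) _) ⟩
    ∑ (λ j → ∑ (λ i → sign (suc j) * (M zero (suc j) * (sign i * (M (suc i) zero * D i j)))))
      ≈⟨ ∑-swap (λ j i → sign (suc j) * (M zero (suc j) * (sign i * (M (suc i) zero * D i j)))) ⟩
    ∑ (λ i → ∑ (λ j → sign (suc j) * (M zero (suc j) * (sign i * (M (suc i) zero * D i j)))))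
      ≈⟨ ∑-cong (λ i → ∑-cong (λ j → regroup (- 1#) (sign i) (sign j) (M zero (suc j)) (M (suc i) zero) (D i j))) ⟩
    ∑ (λ i → ∑ (λ j → sign (suc i) * (M (suc i) zero * (sign j * (M zero (suc j) * D i j)))))
      ≈⟨ ∑-cong (λ i → ∑-*ˡ (sign (suc i)) _) ⟨
    ∑ (λ i → sign (suc i) * ∑ (λ j → M (suc i) zero * (sign j * (M zero (suc j) * D i j))))
      ≈⟨ ∑-cong (λ i → *-congˡ (trans (*-congˡ (reflexive (Det-expand (minor M (suc i) zero)))) (∑-*ˡ (M (suc i) zero) _))) ⟨
    ∑ (λ i → sign (suc i) * (M (suc i) zero * Det (minor M (suc i) zero))) ∎) ⟩
    sign {suc (suc n)} zero * (M zero zero * Det (minor M zero zero)) + ∑ (λ i → sign (suc i) * (M (suc i) zero * Det (minor M (suc i) zero)))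
      ≡⟨ ∑-suc _ ⟨
    ∑ (λ i → sign i * (M i zero * Det (minor M i zero))) ∎
    where
    D : Fin (suc n) → Fin (suc n) → Carrier
    D i j = Det (minor (minor M zero (suc j)) i zero)
    open Solver
    regroup : ∀ e s t u v d → (e * t) * (u * (s * (v * d))) ≈ (e * s) * (v * (t * (u * d)))
    regroup = solve 6 (λ e s t u v d → (e :* t) :* (u :* (s :* (v :* d))) := (e :* s) :* (v :* (t :* (u :* d)))) refl

  Det-transpose : ∀ {n} (M : Fin n → Fin n → Carrier) → Det M ≈ Det (λ i j → M j i)
  Det-transpose {zero}  M = Det-cong λ ()
  Det-transpose {suc n} M = begin
    Det M ≡⟨ Det-expand M ⟩
    ∑ (λ j → sign j * (M zero j * Det (minor M zero j)))
      ≈⟨ ∑-cong (λ j → term-cong j refl (Det-transpose (minor M zero j))) ⟩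
    ∑ (λ j → sign j * (M zero j * Det (λ p q → minor M zero j q p)))
      ≈⟨ Det-first-column (λ i j → M j i) ⟨
    Det (λ i j → M j i) ∎

  Det-zero-last-row : ∀ {n} (M : Fin (suc n) → Fin (suc n) → Carrier) → (∀ j → M (fromℕ n) j ≈ 0#) → Det M ≈ 0#
  Det-zero-last-row {zero}  M p = Det-zero-row M p
  Det-zero-last-row {suc n} M p = trans (reflexive (Det-expand M)) (∑-zero λ j →
    term-zeroʳ j (Det-zero-last-row (minor M zero j) (λ q → p (punchIn j q))))

  private
    punchIn-last : ∀ {n} (j : Fin (suc n)) → punchIn (inject₁ j) (fromℕ n) ≡ fromℕ (suc n)
    punchIn-last         zero    = ≡.refl
    punchIn-last {suc n} (suc j) = ≡.cong suc (punchIn-last j)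

    punchIn-inject₁ : ∀ {n} (j : Fin (suc n)) (q : Fin n) → punchIn (inject₁ j) (inject₁ q) ≡ inject₁ (punchIn j q)
    punchIn-inject₁ zero    q       = ≡.refl
    punchIn-inject₁ (suc j) zero    = ≡.refl
    punchIn-inject₁ (suc j) (suc q) = ≡.cong suc (punchIn-inject₁ j q)

    punchIn-fromℕ : ∀ {n} (q : Fin n) → punchIn (fromℕ n) q ≡ inject₁ q
    punchIn-fromℕ zero    = ≡.refl
    punchIn-fromℕ (suc q) = ≡.cong suc (punchIn-fromℕ q)

  -- In the expansion along the first row, the last column leaves a minor whose last row is zero,
  -- and every other minor has a last row of the same kind. This is what shrinks the final
  -- determinant from n to r rows.
  Det-last-row : ∀ {n} (M : Fin (suc n) → Fin (suc n) → Carrier) →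
                 (∀ j → M (fromℕ n) (inject₁ j) ≈ 0#) → M (fromℕ n) (fromℕ n) ≈ 1# →
                 Det M ≈ Det (λ i j → M (inject₁ i) (inject₁ j))
  Det-last-row {zero}  M p q = begin
    Det M                                                 ≡⟨ Det-expand M ⟩
    ∑ (λ j → sign j * (M zero j * Det (minor M zero j)))  ≈⟨ ∑-head (λ ()) ⟩
    1# * (M zero zero * Det (minor M zero zero))          ≈⟨ *-identityˡ _ ⟩
    M zero zero * Det (minor M zero zero)                 ≈⟨ *-congʳ q ⟩
    1# * Det (minor M zero zero)                          ≈⟨ *-identityˡ _ ⟩
    Det (minor M zero zero)                               ≈⟨ Det-cong (λ ()) ⟩
    Det (λ i j → M (inject₁ i) (inject₁ j))               ∎
  Det-last-row {suc n} M p q = begin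
    Det M                                         ≡⟨ Det-expand M ⟩
    ∑ t                                           ≈⟨ ∑-last t ⟩
    ∑ (λ j → t (inject₁ j)) + t (fromℕ (suc n))   ≈⟨ +-cong (∑-cong body) last ⟩
    ∑ (λ j → sign j * (M′ zero j * Det (minor M′ zero j))) + 0#  ≈⟨ +-identityʳ _ ⟩
    ∑ (λ j → sign j * (M′ zero j * Det (minor M′ zero j)))       ≡⟨ Det-expand M′ ⟨
    Det M′                                        ∎
    where
    M′ : Fin (suc n) → Fin (suc n) → Carrier
    M′ i j = M (inject₁ i) (inject₁ j)
    t : Fin (suc (suc n)) → Carrier
    t j = sign j * (M zero j * Det (minor M zero j))
    last : t (fromℕ (suc n)) ≈ 0#
    last = term-zeroʳ (fromℕ (suc n)) (Det-zero-last-row (minor M zero (fromℕ (suc n)))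
      (λ j → trans (reflexive (≡.cong (M (fromℕ (suc n))) (punchIn-fromℕ j))) (p j)))
    body : ∀ j → t (inject₁ j) ≈ sign j * (M′ zero j * Det (minor M′ zero j))
    body j = *-cong (reflexive (≡.cong ((- 1#) ^_) (Fin.toℕ-inject₁ j))) (*-congˡ (trans
      (Det-last-row (minor M zero (inject₁ j))
        (λ s → trans (reflexive (≡.cong (M (fromℕ (suc n))) (punchIn-inject₁ j s))) (p (punchIn j s)))
        (trans (reflexive (≡.cong (M (fromℕ (suc n))) (punchIn-last j))) q))
      (Det-cong λ r s → reflexive (≡.cong (M (inject₁ (suc r))) (punchIn-inject₁ j s)))))

  -- Rows are functions on an index set: power series for I = ℕ, rows of a square matrix for I =
  -- `Fin n`.
  module Alternating {c} (I : Set c) where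

    Row : Set (a ⊔ c)
    Row = I → Carrier

    infix 4 _≋_
    _≋_ : Row → Row → Set (b ⊔ c)
    x ≋ y = ∀ i → x i ≈ y i

    record LinearForm (θ : Row → Carrier) : Set (a ⊔ b ⊔ c) where
      field
        cong     : ∀ {x y} → x ≋ y → θ x ≈ θ y
        additive : ∀ x y → θ (λ i → x i + y i) ≈ θ x + θ y
        scales   : ∀ r x → θ (λ i → r * x i) ≈ r * θ x

    Degenerate : ∀ n → (Vec Row (suc n) → Carrier) → Set (a ⊔ b ⊔ c)
    Degenerate zero    Φ = ⊤
    Degenerate (suc n) Φ = ∀ x v → Φ (x ∷ x ∷ v) ≈ 0#

    -- Recursion on the arguments, so that only adjacent equal rows are required to give zero;
    -- `alternating-swap` and `alternating-repeat` recover the general case.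
    AlternatingForm : ∀ n → (Vec Row n → Carrier) → Set (a ⊔ b ⊔ c)
    AlternatingForm zero    Φ = ⊤
    AlternatingForm (suc n) Φ =
      (∀ v → LinearForm (λ x → Φ (x ∷ v))) × (∀ x → AlternatingForm n (λ v → Φ (x ∷ v))) × Degenerate n Φ

    sum-alternating : ∀ n {m} (s : Fin m → Carrier) (t : Fin m → Carrier) {Ψ : Fin m → Vec Row n → Carrier} →
                      (∀ j → AlternatingForm n (Ψ j)) → AlternatingForm n (λ v → ∑ λ j → s j * (t j * Ψ j v))
    sum-alternating zero    s t alt = tt
    sum-alternating (suc n) {m} s t {Ψ} alt =
      (λ v → record
        { cong = λ p → ∑-cong λ j → *-congˡ {s j} (*-congˡ (LinearForm.cong (proj₁ (alt j) v) p))
        ; additive = λ x y → trans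
            (∑-cong λ j → trans (*-congˡ {s j} (trans (*-congˡ (LinearForm.additive (proj₁ (alt j) v) x y)) (distribˡ (t j) _ _))) (distribˡ (s j) _ _))
            (∑-+ (λ j → s j * (t j * Ψ j (x ∷ v))) (λ j → s j * (t j * Ψ j (y ∷ v))))
        ; scales = λ r x → trans
            (∑-cong λ j → trans (*-congˡ {s j} (*-congˡ (LinearForm.scales (proj₁ (alt j) v) r x)))
              (regroup (s j) (t j) r (Ψ j (x ∷ v))))
            (sym (∑-*ˡ r (λ j → s j * (t j * Ψ j (x ∷ v))))) }) ,
      (λ x → sum-alternating n s t (λ j → proj₁ (proj₂ (alt j)) x)) ,
      degenerate n alt
      where
      open Solver
      regroup : ∀ s t r p → s * (t * (r * p)) ≈ r * (s * (t * p))
      regroup = solve 4 (λ s t r p → s :* (t :* (r :* p)) := r :* (s :* (t :* p))) refl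
      degenerate : ∀ n {Ψ : Fin m → Vec Row (suc n) → Carrier} → (∀ j → AlternatingForm (suc n) (Ψ j)) →
                   Degenerate n (λ v → ∑ λ j → s j * (t j * Ψ j v))
      degenerate zero    alt = tt
      degenerate (suc n) alt x v = ∑-zero λ j → trans (*-congˡ {s j} (trans (*-congˡ (proj₂ (proj₂ (alt j)) x v)) (zeroʳ _))) (zeroʳ _)

    private
      -- Two equal first rows: the terms for the ordered pairs of columns (j, k) and (k, j) cancel.
      pairs-cancel : ∀ n (x : Fin (suc (suc n)) → Carrier) (ω : (Fin n → Fin (suc (suc n))) → Carrier) →
                     (∀ {f g} → (∀ q → f q ≡ g q) → ω f ≈ ω g) →
                     ∑ (λ j → sign j * (x j * ∑ (λ k → sign k * (x (punchIn j k) * ω (λ q → punchIn j (punchIn k q)))))) ≈ 0#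
      -- The pairs of columns that avoid column 0. Both signs lose a factor -1 and column 0 stays
      -- among the columns passed to ω, so this is `pairs-cancel` for the columns 1, 2, ....
      pairs-cancel-suc : ∀ n (x : Fin (suc (suc n)) → Carrier) (ω : (Fin n → Fin (suc (suc n))) → Carrier) →
             (∀ {f g} → (∀ q → f q ≡ g q) → ω f ≈ ω g) →
             ∑ (λ j → sign (suc j) * (x (suc j) * ∑ λ (k : Fin n) →
               sign (suc k) * (x (suc (punchIn j k)) * ω (λ q → punchIn (suc j) (punchIn (suc k) q))))) ≈ 0#

      pairs-cancel n x ω ext = begin
        ∑ (λ j → sign j * (x j * ∑ (λ k → sign k * (x (punchIn j k) * ω (λ q → punchIn j (punchIn k q))))))
          ≡⟨ ∑-suc _ ⟩
        1# * (x zero * ∑ A) + ∑ (λ j → sign (suc j) * (x (suc j) * ∑ (λ k → sign k * (x (punchIn (suc j) k) * ω (λ q → punchIn (suc j) (punchIn k q))))))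
          ≈⟨ +-cong (trans (*-identityˡ _) (∑-*ˡ (x zero) A)) (begin
            _ ≈⟨ ∑-cong (λ j → *-congˡ (*-congˡ (reflexive (∑-suc _)))) ⟩
            ∑ (λ j → sign (suc j) * (x (suc j) * (1# * (x zero * W j) + ∑ (C j))))
              ≈⟨ ∑-cong (λ j → trans (*-congˡ (distribˡ (x (suc j)) _ _)) (distribˡ (sign (suc j)) _ _)) ⟩
            ∑ (λ j → sign (suc j) * (x (suc j) * (1# * (x zero * W j))) + sign (suc j) * (x (suc j) * ∑ (C j)))
              ≈⟨ ∑-+ _ _ ⟩
            ∑ B + ∑ (λ j → sign (suc j) * (x (suc j) * ∑ (C j))) ∎) ⟩
        ∑ (λ k → x zero * A k) + (∑ B + ∑ (λ j → sign (suc j) * (x (suc j) * ∑ (C j))))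
          ≈⟨ +-assoc _ _ _ ⟨
        (∑ (λ k → x zero * A k) + ∑ B) + ∑ (λ j → sign (suc j) * (x (suc j) * ∑ (C j)))
          ≈⟨ +-cong (trans (sym (∑-+ _ _)) (∑-zero opposite)) (pairs-cancel-suc n x ω ext) ⟩
        0# + 0#  ≈⟨ +-identityʳ 0# ⟩
        0#       ∎
        where
        W : Fin (suc n) → Carrier
        W j = ω (λ q → punchIn (suc j) (suc q))
        A : Fin (suc n) → Carrier
        A k = sign k * (x (suc k) * ω (λ q → suc (punchIn k q)))
        B : Fin (suc n) → Carrier
        B j = sign (suc j) * (x (suc j) * (1# * (x zero * W j)))
        C : Fin (suc n) → Fin n → Carrier
        C j k = sign (suc k) * (x (suc (punchIn j k)) * ω (λ q → punchIn (suc j) (punchIn (suc k) q)))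
        -- `A` has column 0 in the first row and column k + 1 in the second, `B` the other way
        -- round; the signs differ by one factor -1.
        opposite : ∀ k → x zero * A k + B k ≈ 0#
        opposite k = begin
          x zero * A k + sign (suc k) * (x (suc k) * (1# * (x zero * W k)))
            ≈⟨ +-congˡ (*-cong (-1*x≈-x (sign k)) (*-congˡ (*-identityˡ _))) ⟩
          x zero * A k + (- sign k) * (x (suc k) * (x zero * W k))
            ≈⟨ cancel (x zero) (sign k) (x (suc k)) (W k) ⟩
          0# ∎
          where
          open Solver
          cancel : ∀ x s y w → x * (s * (y * w)) + (- s) * (y * (x * w)) ≈ 0#
          cancel = solve 4 (λ x s y w → x :* (s :* (y :* w)) :+ (:- s) :* (y :* (x :* w)) := con (+ 0)) refl

      pairs-cancel-suc zero x ω ext = ∑-zero λ j → term-zeroʳ (suc j) (reflexive (∑-empty _))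
      pairs-cancel-suc (suc n) x ω ext = trans
        (∑-cong λ j → begin
          sign (suc j) * (x (suc j) * ∑ (λ k → sign (suc k) * (x (suc (punchIn j k)) * ω (λ q → punchIn (suc j) (punchIn (suc k) q)))))
            ≈⟨ *-cong (-1*x≈-x (sign j)) (*-congˡ (∑-cong λ k → trans
                 (*-cong (-1*x≈-x (sign k)) (*-congˡ (ext {g = zero ∷ᶠ (λ q → suc (punchIn j (punchIn k q)))} λ { zero → ≡.refl ; (suc q) → ≡.refl })))
                 (sym (-‿distribˡ-* (sign k) _)))) ⟩
          (- sign j) * (x (suc j) * ∑ (λ k → - (sign k * (x (suc (punchIn j k)) * ω′ (λ q → punchIn j (punchIn k q))))))
            ≈⟨ *-congˡ (*-congˡ (∑-neg _)) ⟨
          (- sign j) * (x (suc j) * (- ∑ (λ k → sign k * (x (suc (punchIn j k)) * ω′ (λ q → punchIn j (punchIn k q))))))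
            ≈⟨ signs (sign j) (x (suc j)) _ ⟩
          sign j * (x (suc j) * ∑ (λ k → sign k * (x (suc (punchIn j k)) * ω′ (λ q → punchIn j (punchIn k q))))) ∎)
        (pairs-cancel n (x ∘ suc) ω′ (λ p → ext λ { zero → ≡.refl ; (suc q) → ≡.cong suc (p q) }))
        where
        ω′ : (Fin n → Fin (suc (suc n))) → Carrier
        ω′ f = ω (zero ∷ᶠ (λ q → suc (f q)))
        open Solver
        signs : ∀ s x u → (- s) * (x * (- u)) ≈ s * (x * u)
        signs = solve 3 (λ s x u → (:- s) :* (x :* (:- u)) := s :* (x :* u)) refl

    Alternating-cong : ∀ n {Φ Ψ : Vec Row n → Carrier} → (∀ v → Φ v ≈ Ψ v) → AlternatingForm n Φ → AlternatingForm n Ψ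
    Alternating-cong zero    p alt = tt
    Alternating-cong (suc n) {Φ} {Ψ} p (linear , rest , degenerate) =
      (λ v → record
        { cong     = λ q → trans (sym (p _)) (trans (LinearForm.cong (linear v) q) (p _))
        ; additive = λ x y → trans (sym (p _)) (trans (LinearForm.additive (linear v) x y) (+-cong (p _) (p _)))
        ; scales   = λ r x → trans (sym (p _)) (trans (LinearForm.scales (linear v) r x) (*-congˡ (p _))) }) ,
      (λ x → Alternating-cong n (λ v → p (x ∷ v)) (rest x)) ,
      degenerate′ n p degenerate
      where
      degenerate′ : ∀ n {Φ Ψ : Vec Row (suc n) → Carrier} → (∀ v → Φ v ≈ Ψ v) → Degenerate n Φ → Degenerate n Ψ
      degenerate′ zero    p d = tt
      degenerate′ (suc n) p d x v = trans (sym (p _)) (d x v)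

    -- The columns are read off through L, so that deleting a column only changes L and the minors
    -- are again of this form.
    Det-alternating : ∀ n (L : Fin n → I) → AlternatingForm n (λ v → Det (λ i j → lookup v i (L j)))
    Det-alternating zero    L = tt
    Det-alternating (suc n) L = Alternating-cong (suc n) (λ v → reflexive (≡.sym (Det-expand _)))
      ( (λ v → record
          { cong = λ p → ∑-cong λ j → term-cong j (p (L j)) refl
          ; additive = λ x y → trans
              (∑-cong λ j → trans (*-congˡ (distribʳ _ _ _)) (distribˡ _ _ _))
              (∑-+ _ _)
          ; scales = λ r x → trans
              (∑-cong λ j → regroup (sign j) r (x (L j)) _)
              (sym (∑-*ˡ r _)) })
      , (λ x → sum-alternating n sign (λ j → x (L j)) (λ j → Det-alternating n (λ q → L (punchIn j q))))
      , degenerate n L)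
      where
      open Solver
      regroup : ∀ s r x d → s * ((r * x) * d) ≈ r * (s * (x * d))
      regroup = solve 4 (λ s r x d → s :* ((r :* x) :* d) := r :* (s :* (x :* d))) refl
      degenerate : ∀ n (L : Fin (suc n) → I) →
                   Degenerate n (λ v → ∑ λ j → sign j * (lookup v zero (L j) * Det (minor (λ i j → lookup v i (L j)) zero j)))
      degenerate zero    L = tt
      degenerate (suc n) L x v = trans
        (∑-cong λ j → *-congˡ (*-congˡ (reflexive (Det-expand _))))
        (pairs-cancel n (λ j → x (L j)) (λ f → Det (λ p q → lookup v p (L (f q))))
          (λ p → Det-cong λ r s → reflexive (≡.cong (λ l → lookup v r (L l)) (p s))))

    module _ {n} (Φ : Vec Row (suc (suc n)) → Carrier) (alt : AlternatingForm (suc (suc n)) Φ) where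

      -- Polarisation of Φ(x + y, x + y, v) = 0.
      alternating-swap : ∀ x y v → Φ (x ∷ y ∷ v) ≈ - Φ (y ∷ x ∷ v)
      alternating-swap x y v = +-inverseˡ-unique _ _ (begin
        Φ (x ∷ y ∷ v) + Φ (y ∷ x ∷ v)
          ≈⟨ +-cong (+-identityˡ _) (+-identityʳ _) ⟨
        (0# + Φ (x ∷ y ∷ v)) + (Φ (y ∷ x ∷ v) + 0#)
          ≈⟨ +-cong (+-congʳ (degenerate x v)) (+-congˡ (degenerate y v)) ⟨
        (Φ (x ∷ x ∷ v) + Φ (x ∷ y ∷ v)) + (Φ (y ∷ x ∷ v) + Φ (y ∷ y ∷ v))
          ≈⟨ +-cong (LinearForm.additive (second x) x y) (LinearForm.additive (second y) x y) ⟨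
        Φ (x ∷ x+y ∷ v) + Φ (y ∷ x+y ∷ v)
          ≈⟨ LinearForm.additive (proj₁ alt (x+y ∷ v)) x y ⟨
        Φ (x+y ∷ x+y ∷ v)
          ≈⟨ degenerate x+y v ⟩
        0# ∎)
        where
        degenerate = proj₂ (proj₂ alt)
        second : ∀ z → LinearForm (λ x → Φ (z ∷ x ∷ v))
        second z = proj₁ (proj₁ (proj₂ alt) z) v
        x+y : Row
        x+y i = x i + y i

    alternating-repeat : ∀ {n} (Φ : Vec Row (suc n) → Carrier) → AlternatingForm (suc n) Φ →
                         ∀ v i → Φ (lookup v i ∷ v) ≈ 0#
    alternating-repeat Φ alt (x ∷ v) zero = proj₂ (proj₂ alt) x v
    alternating-repeat Φ alt (x ∷ v) (suc i) = begin
      Φ (lookup v i ∷ x ∷ v)    ≈⟨ alternating-swap Φ alt (lookup v i) x v ⟩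
      - Φ (x ∷ lookup v i ∷ v)  ≈⟨ -‿cong (alternating-repeat (λ w → Φ (x ∷ w)) (proj₁ (proj₂ alt) x) v i) ⟩
      - 0#                      ≈⟨ -0#≈0# ⟩
      0#                        ∎

    alternating-rotate : ∀ {n} (Φ : Vec Row (suc n) → Carrier) → AlternatingForm (suc n) Φ →
                         ∀ x v → Φ (x ∷ v) ≈ (- 1#) ^ n * Φ (v Vec.∷ʳ x)
    alternating-rotate Φ alt x []      = sym (*-identityˡ _)
    alternating-rotate {suc n} Φ alt x (y ∷ v) = begin
      Φ (x ∷ y ∷ v)                                ≈⟨ alternating-swap Φ alt x y v ⟩
      - Φ (y ∷ x ∷ v)                              ≈⟨ -‿cong (alternating-rotate (λ w → Φ (y ∷ w)) (proj₁ (proj₂ alt) y) x v) ⟩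
      - ((- 1#) ^ n * Φ (y ∷ (v Vec.∷ʳ x)))        ≈⟨ -1*x≈-x _ ⟨
      - 1# * ((- 1#) ^ n * Φ (y ∷ (v Vec.∷ʳ x)))   ≈⟨ *-assoc _ _ _ ⟨
      (- 1#) ^ suc n * Φ (y ∷ (v Vec.∷ʳ x))        ∎

-- Determinants equal to a Kronecker delta.

module Pattern {a b} (R : CommutativeRing a b) where
  open CommutativeRing R hiding (zero)
  open Determinant R

  -- A zero pattern that forces the determinant to be 1 for p = q and 0 otherwise: the first column
  -- vanishes below the diagonal if p₀ ≤ q₀, and the first row vanishes if p₀ > q₀.
  record DeltaPattern {n} (p q : Fin n → ℕ) (M : Fin n → Fin n → Carrier) : Set b where
    field
      p-decreasing : ∀ i j → i Fin.≤ j → p j ≤ p i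
      q-decreasing : ∀ i j → i Fin.≤ j → q j ≤ q i
      above        : ∀ i j → i Fin.< j → q j < p i → M i j ≈ 0#
      below        : ∀ i j → j Fin.< i → p i ≤ q j → M i j ≈ 0#
      diagonal     : ∀ i → p i ≡ q i → M i i ≈ 1#
      off          : ∀ i → p i ≢ q i → M i i ≈ 0#

  private
    tail : ∀ {n} {p q : Fin (suc n) → ℕ} {M} → DeltaPattern p q M → DeltaPattern (p ∘ suc) (q ∘ suc) (minor M zero zero)
    tail d = record
      { p-decreasing = λ i j i≤j → p-decreasing (suc i) (suc j) (s≤s i≤j)
      ; q-decreasing = λ i j i≤j → q-decreasing (suc i) (suc j) (s≤s i≤j)
      ; above        = λ i j i<j → above (suc i) (suc j) (s<s i<j)
      ; below        = λ i j j<i → below (suc i) (suc j) (s<s j<i)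
      ; diagonal     = λ i → diagonal (suc i)
      ; off          = λ i → off (suc i)
      }
      where open DeltaPattern d

    peel : ∀ {n} {p q : Fin (suc n) → ℕ} {M} → DeltaPattern p q M → p zero ≤ q zero →
           Det M ≈ M zero zero * Det (minor M zero zero)
    peel {M = M} d p₀≤q₀ = trans (Det-first-column M) (trans
      (∑-head λ i → term-zeroˡ (suc i) (below (suc i) zero z<s (ℕ.≤-trans (p-decreasing zero (suc i) z≤n) p₀≤q₀)))
      (*-identityˡ _))
      where open DeltaPattern d

  Det-delta-one : ∀ {n} {p q : Fin n → ℕ} {M} → DeltaPattern p q M → (∀ i → p i ≡ q i) → Det M ≈ 1#
  Det-delta-one {zero}  {M = M} d p≡q = reflexive (Det-empty M)
  Det-delta-one {suc n} {M = M} d p≡q = trans (peel d (ℕ.≤-reflexive (p≡q zero)))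
    (trans (*-cong (DeltaPattern.diagonal d zero (p≡q zero)) (Det-delta-one (tail d) (λ i → p≡q (suc i)))) (*-identityˡ 1#))

  Det-delta-zero : ∀ {n} {p q : Fin n → ℕ} {M} → DeltaPattern p q M → ∀ i → p i ≢ q i → Det M ≈ 0#
  Det-delta-zero {suc n} {p} {q} {M} d i p≢q with p zero ℕ.≤? q zero
  ... | no p₀≰q₀ = Det-zero-row M λ
    { zero    → DeltaPattern.off d zero (λ e → p₀≰q₀ (ℕ.≤-reflexive e))
    ; (suc j) → DeltaPattern.above d zero (suc j) z<s
        (ℕ.≤-<-trans (DeltaPattern.q-decreasing d zero (suc j) z≤n) (ℕ.≰⇒> p₀≰q₀)) }
  Det-delta-zero d zero    p≢q | yes p₀≤q₀ = trans (peel d p₀≤q₀) (trans (*-congʳ (DeltaPattern.off d zero p≢q)) (zeroˡ _))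
  Det-delta-zero d (suc i) p≢q | yes p₀≤q₀ = trans (peel d p₀≤q₀) (trans (*-congˡ (Det-delta-zero (tail d) i p≢q)) (zeroʳ _))

-- The Jacobi-Trudi identity for alternating forms in power series.

module JacobiTrudi {a b} (R : CommutativeRing a b) where
  open CommutativeRing R hiding (zero)
  open Determinant R
  open Alternating ℕ
  open RawSemiringDefs (RawRing.rawSemiring rawRing) using (_^_)
  open RawMonoidDefs (RawRing.*-rawMonoid rawRing) using () renaming (sum to prod)
  private module Π = CommutativeMonoidSum *-commutativeMonoid
  open IntegerImage R
  open SetoidReasoning setoid

  -- Rows are power series in t, given by their coefficients; this is multiplication by t.
  shift : Row → Row
  shift c zero    = 0#
  shift c (suc k) = c k

  -- The coefficients of c(t)/(1 - yt).
  geometric : Carrier → Row → Row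
  geometric y c zero    = c zero
  geometric y c (suc k) = c (suc k) + y * geometric y c k

  -- The coefficients of c(t)/∏(1 - yᵢt).
  complete : ∀ {n} → (Fin n → Carrier) → Row → Row
  complete {zero}  y c = c
  complete {suc n} y c = complete (y ∘ suc) (geometric (y zero) c)

  shifts : ℕ → Row → Row
  shifts zero    c = c
  shifts (suc k) c = shift (shifts k c)

  powers : ∀ n → Row → Vec Row n
  powers zero    c = []
  powers (suc n) c = shifts n c ∷ powers n c

  Vandermonde : ∀ {n} → (Fin n → Carrier) → Carrier
  Vandermonde {n} y = prod {n} λ i → prod {n} λ j → if does (i Fin.<? j) then y i + (- y j) else 1#

  shift-cong : ∀ {c d} → c ≋ d → shift c ≋ shift d
  shift-cong p zero    = refl
  shift-cong p (suc k) = p k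

  shifts-cong : ∀ n {c d} → c ≋ d → shifts n c ≋ shifts n d
  shifts-cong zero    p = p
  shifts-cong (suc n) p = shift-cong (shifts-cong n p)

  geometric-cong : ∀ {y y′ c d} → y ≈ y′ → c ≋ d → geometric y c ≋ geometric y′ d
  geometric-cong q p zero    = p zero
  geometric-cong q p (suc k) = +-cong (p (suc k)) (*-cong q (geometric-cong q p k))

  complete-cong : ∀ {n} {y y′ : Fin n → Carrier} {c d} → (∀ i → y i ≈ y′ i) → c ≋ d → complete y c ≋ complete y′ d
  complete-cong {zero}  q p = p
  complete-cong {suc n} q p = complete-cong (λ i → q (suc i)) (geometric-cong (q zero) p)

  geometric-shift : ∀ y c → geometric y (shift c) ≋ shift (geometric y c)
  geometric-shift y c zero          = refl
  geometric-shift y c (suc zero)    = trans (+-congˡ (zeroʳ y)) (+-identityʳ _)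
  geometric-shift y c (suc (suc k)) = +-congˡ (*-congˡ (geometric-shift y c (suc k)))

  complete-shift : ∀ {n} (y : Fin n → Carrier) c → complete y (shift c) ≋ shift (complete y c)
  complete-shift {zero}  y c k = refl
  complete-shift {suc n} y c k = trans
    (complete-cong {y = y ∘ suc} (λ _ → refl) (geometric-shift (y zero) c) k)
    (complete-shift (y ∘ suc) (geometric (y zero) c) k)

  geometric-unfold : ∀ y c k → geometric y c k ≈ c k + y * shift (geometric y c) k
  geometric-unfold y c zero    = sym (trans (+-congˡ (zeroʳ y)) (+-identityʳ _))
  geometric-unfold y c (suc k) = refl

  geometric-comm : ∀ x y c → geometric x (geometric y c) ≋ geometric y (geometric x c)
  geometric-comm x y c zero    = refl
  geometric-comm x y c (suc k) = begin
    (c (suc k) + y * u k) + x * w k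
      ≈⟨ +-congˡ (*-congˡ (trans (geometric-comm x y c k) (geometric-unfold y v k))) ⟩
    (c (suc k) + y * u k) + x * (v k + y * shift (geometric y v) k)
      ≈⟨ regroup (c (suc k)) x y (u k) (v k) _ ⟩
    (c (suc k) + x * v k) + y * (u k + x * shift (geometric y v) k)
      ≈⟨ +-congˡ (*-congˡ (+-congˡ (*-congˡ (sym (shifted k))))) ⟩
    (c (suc k) + x * v k) + y * (u k + x * shift w k)
      ≈⟨ +-congˡ (*-congˡ (trans (sym (geometric-unfold x u k)) (geometric-comm x y c k))) ⟩
    (c (suc k) + x * v k) + y * geometric y v k ∎
    where
    u v w : Row
    u = geometric y c
    v = geometric x c
    w = geometric x u
    shifted : ∀ k → shift w k ≈ shift (geometric y v) k
    shifted zero    = refl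
    shifted (suc k) = geometric-comm x y c k
    open Solver
    regroup : ∀ c x y u v s → (c + y * u) + x * (v + y * s) ≈ (c + x * v) + y * (u + x * s)
    regroup = solve 6 (λ c x y u v s → (c :+ y :* u) :+ x :* (v :+ y :* s) := (c :+ x :* v) :+ y :* (u :+ x :* s)) refl

  complete-geometric : ∀ {n} (y : Fin n → Carrier) z c → complete y (geometric z c) ≋ geometric z (complete y c)
  complete-geometric {zero}  y z c k = refl
  complete-geometric {suc n} y z c k = trans
    (complete-cong {y = y ∘ suc} (λ _ → refl) (geometric-comm (y zero) z c) k)
    (complete-geometric (y ∘ suc) z (geometric (y zero) c) k)

  -- 1/(1 - yt) - 1/(1 - xt) = (y - x)t/((1 - xt)(1 - yt))
  geometric-difference : ∀ x y c k →
    geometric y c k ≈ geometric x c k + (y - x) * geometric y (shift (geometric x c)) k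
  geometric-difference x y c zero    = sym (trans (+-congˡ (zeroʳ _)) (+-identityʳ _))
  geometric-difference x y c (suc k) = begin
    c (suc k) + y * geometric y c k
      ≈⟨ +-congˡ (*-congˡ (trans (geometric-difference x y c k) (+-congˡ (*-congˡ (geometric-shift y u k))))) ⟩
    c (suc k) + y * (u k + (y - x) * shift (geometric y u) k)
      ≈⟨ regroup (c (suc k)) x y (u k) (shift (geometric y u) k) ⟩
    (c (suc k) + x * u k) + (y - x) * (u k + y * shift (geometric y u) k)
      ≈⟨ +-congˡ (*-congˡ (geometric-unfold y u k)) ⟨
    (c (suc k) + x * u k) + (y - x) * geometric y u k
      ≈⟨ +-congˡ (*-congˡ (geometric-shift y u (suc k))) ⟨
    (c (suc k) + x * u k) + (y - x) * geometric y (shift u) (suc k) ∎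
    where
    u = geometric x c
    open Solver
    regroup : ∀ c x y u s → c + y * (u + (y - x) * s) ≈ (c + x * u) + (y - x) * (u + y * s)
    regroup = solve 5 (λ c x y u s → c :+ y :* (u :+ (y :- x) :* s) := (c :+ x :* u) :+ (y :- x) :* (u :+ y :* s)) refl

  shift-linear : ∀ {θ} → LinearForm θ → LinearForm (θ ∘ shift)
  shift-linear lin = record
    { cong     = λ p → LinearForm.cong lin (shift-cong p)
    ; additive = λ x y → trans (LinearForm.cong lin λ { zero → sym (+-identityʳ 0#) ; (suc k) → refl })
                               (LinearForm.additive lin (shift x) (shift y))
    ; scales   = λ r x → trans (LinearForm.cong lin λ { zero → sym (zeroʳ r) ; (suc k) → refl })
                               (LinearForm.scales lin r (shift x))
    }

  -- ∏(1 - yᵢt) is 1 plus multiples of t, …, tⁿ.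
  complete-modulo-shifts : ∀ {n} (y : Fin n → Carrier) {θ} → LinearForm θ → ∀ c →
    (∀ k → k < n → θ (shifts (suc k) (complete y c)) ≈ 0#) → θ c ≈ θ (complete y c)
  complete-modulo-shifts {zero}  y lin c p = refl
  complete-modulo-shifts {suc n} y {θ} lin c p = begin
    θ c                                          ≈⟨ +-identityʳ _ ⟨
    θ c + 0#                                     ≈⟨ +-congˡ (trans (*-congˡ shifted) (zeroʳ (y zero))) ⟨
    θ c + y zero * θ (shift d)                   ≈⟨ +-congˡ (LinearForm.scales lin (y zero) (shift d)) ⟨
    θ c + θ (λ k → y zero * shift d k)           ≈⟨ LinearForm.additive lin c _ ⟨
    θ (λ k → c k + y zero * shift d k)           ≈⟨ LinearForm.cong lin (geometric-unfold (y zero) c) ⟨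
    θ d                                          ≈⟨ complete-modulo-shifts (y ∘ suc) lin d (λ k k<n → p k (ℕ.m<n⇒m<1+n k<n)) ⟩
    θ (complete (y ∘ suc) d)                     ∎
    where
    d = geometric (y zero) c
    -- The induction hypothesis for the linear form `θ ∘ shift`, whose assumptions are those of θ
    -- with k one larger; the assumption at k = 0 remains and finishes.
    shifted : θ (shift d) ≈ 0#
    shifted = trans
      (complete-modulo-shifts (y ∘ suc) (shift-linear lin) d (λ k k<n → p (suc k) (s<s k<n)))
      (p zero z<s)

  -- The summand x repeats the first row and contributes nothing. As only adjacent repetitions are
  -- known to vanish, x is swapped past `e zero` to stand next to the following row, and swapped
  -- back afterwards.
  reduce : ∀ {n} (Φ : Vec Row (suc n) → Carrier) → AlternatingForm (suc n) Φ →
           ∀ x (r : Fin n → Carrier) (d e : Fin n → Row) → (∀ j k → d j k ≈ x k + r j * e j k) →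
           Φ (x ∷ tabulate d) ≈ prod r * Φ (x ∷ tabulate e)
  reduce {zero}  Φ alt x r d e p = sym (*-identityˡ _)
  reduce {suc n} Φ alt x r d e p = begin
    Φ (x ∷ d zero ∷ ds)
      ≈⟨ LinearForm.cong second (p zero) ⟩
    Φ (x ∷ (λ k → x k + r zero * e zero k) ∷ ds)
      ≈⟨ LinearForm.additive second x _ ⟩
    Φ (x ∷ x ∷ ds) + Φ (x ∷ (λ k → r zero * e zero k) ∷ ds)
      ≈⟨ +-cong (proj₂ (proj₂ alt) x ds) (LinearForm.scales second (r zero) (e zero)) ⟩
    0# + r zero * Φ (x ∷ e zero ∷ ds)
      ≈⟨ +-identityˡ _ ⟩
    r zero * Φ (x ∷ e zero ∷ ds)
      ≈⟨ *-congˡ (alternating-swap Φ alt x (e zero) ds) ⟩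
    r zero * - Φ (e zero ∷ x ∷ ds)
      ≈⟨ *-congˡ (-‿cong (reduce (λ v → Φ (e zero ∷ v)) (proj₁ (proj₂ alt) (e zero)) x (r ∘ suc) (d ∘ suc) (e ∘ suc) (λ j → p (suc j)))) ⟩
    r zero * - (prod (r ∘ suc) * Φ (e zero ∷ x ∷ es))
      ≈⟨ regroup (r zero) (prod (r ∘ suc)) _ ⟩
    (r zero * prod (r ∘ suc)) * - Φ (e zero ∷ x ∷ es)
      ≈⟨ *-congˡ (alternating-swap Φ alt x (e zero) es) ⟨
    (r zero * prod (r ∘ suc)) * Φ (x ∷ e zero ∷ es) ∎
    where
    ds = tabulate (d ∘ suc)
    es = tabulate (e ∘ suc)
    second : LinearForm (λ z → Φ (x ∷ z ∷ ds))
    second = proj₁ (proj₁ (proj₂ alt) x) ds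
    open Solver
    regroup : ∀ r s t → r * - (s * t) ≈ (r * s) * - t
    regroup = solve 3 (λ r s t → r :* :- (s :* t) := (r :* s) :* :- t) refl

  alternating-powers-cong : ∀ n (Φ : Vec Row n → Carrier) → AlternatingForm n Φ → ∀ {c d} → c ≋ d →
                            Φ (powers n c) ≈ Φ (powers n d)
  alternating-powers-cong zero    Φ alt p = refl
  alternating-powers-cong (suc n) Φ alt p = trans
    (LinearForm.cong (proj₁ alt _) (shifts-cong n p))
    (alternating-powers-cong n (λ v → Φ (_ ∷ v)) (proj₁ (proj₂ alt) _) p)

  private
    shifts-shift : ∀ n c → shifts n (shift c) ≡ shift (shifts n c)
    shifts-shift zero    c = ≡.refl
    shifts-shift (suc n) c = ≡.cong shift (shifts-shift n c)

    powers-∷ʳ : ∀ n c → powers n (shift c) Vec.∷ʳ c ≡ powers (suc n) c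
    powers-∷ʳ zero    c = ≡.refl
    powers-∷ʳ (suc n) c = ≡.cong₂ _∷_ (shifts-shift n c) (powers-∷ʳ n c)

    powers-member : ∀ n c k → k < n → ∃[ i ] lookup (powers n (shift c)) i ≡ shifts (suc k) c
    powers-member (suc n) c k k<1+n with k ℕ.≟ n
    ... | yes ≡.refl = zero , shifts-shift n c
    ... | no  k≢n    with powers-member n c k (ℕ.≤∧≢⇒< (ℕ.s≤s⁻¹ k<1+n) k≢n)
    ...   | i , e = suc i , e

    prod-neg : ∀ n (f : Fin n → Carrier) → prod (λ j → - f j) * (- 1#) ^ n ≈ prod f
    prod-neg zero    f = *-identityˡ 1#
    prod-neg (suc n) f = begin
      (- f zero * prod (λ j → - f (suc j))) * (- 1# * (- 1#) ^ n)  ≈⟨ regroup (f zero) _ 1# _ ⟩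
      (f zero * 1#) * (prod (λ j → - f (suc j)) * (- 1#) ^ n)      ≈⟨ *-cong (*-identityʳ _) (prod-neg n (f ∘ suc)) ⟩
      f zero * prod (f ∘ suc)                                      ∎
      where
      open Solver
      regroup : ∀ x p u s → (- x * p) * (- u * s) ≈ (x * u) * (p * s)
      regroup = solve 4 (λ x p u s → (:- x :* p) :* (:- u :* s) := (x :* u) :* (p :* s)) refl

  Vandermonde-suc : ∀ {n} (y : Fin (suc n) → Carrier) →
                    Vandermonde y ≈ prod (λ j → y zero + (- y (suc j))) * Vandermonde (y ∘ suc)
  Vandermonde-suc {n} y = *-cong (*-identityˡ _)
    (Π.sum-cong-≋ {n} {λ i → 1# * prod (λ j → if does (i Fin.<? j) then y (suc i) + (- y (suc j)) else 1#)} (λ i → *-identityˡ _))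

  -- Subtracting the first row c/(1 - y₀t) from the others and dividing these by y₀ - yᵢ
  -- reduces the number of elements by one.
  alternating-geometric : ∀ {n} (y : Fin n → Carrier) (Φ : Vec Row n → Carrier) → AlternatingForm n Φ → ∀ c →
    Φ (tabulate (λ i → geometric (y i) c)) ≈ Vandermonde y * Φ (powers n (complete y c))
  alternating-geometric {zero}  y Φ alt c = sym (*-identityˡ _)
  alternating-geometric {suc n} y Φ alt c = begin
    Φ (d ∷ tabulate (λ i → geometric (y (suc i)) c))
      ≈⟨ reduce Φ alt d (λ i → y (suc i) - y zero) _ _ (λ i → geometric-difference (y zero) (y (suc i)) c) ⟩
    prod (λ i → y (suc i) - y zero) * Φ (d ∷ tabulate (λ i → geometric (y (suc i)) (shift d)))
      ≈⟨ *-congˡ (alternating-geometric (y ∘ suc) (λ v → Φ (d ∷ v)) (proj₁ (proj₂ alt) d) (shift d)) ⟩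
    prod (λ i → y (suc i) - y zero) * (V * Φ (d ∷ powers n (complete (y ∘ suc) (shift d))))
      ≈⟨ *-congˡ (*-congˡ (alternating-powers-cong n (λ v → Φ (d ∷ v)) (proj₁ (proj₂ alt) d) (complete-shift (y ∘ suc) d))) ⟩
    prod (λ i → y (suc i) - y zero) * (V * Φ (d ∷ powers n (shift f)))
      -- `d` is `f` times ∏(1 - yᵢt) over the remaining yᵢ, so it differs from `f` by multiples of
      -- tf, ..., tⁿf, which are the other rows.
      ≈⟨ *-congˡ (*-congˡ (complete-modulo-shifts (y ∘ suc) (proj₁ alt _) d vanish)) ⟩
    prod (λ i → y (suc i) - y zero) * (V * Φ (f ∷ powers n (shift f)))
      -- Moving `f` to the end, behind its multiples by powers of t, costs (-1)ⁿ. This sign turns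
      -- the factors yᵢ - y₀ into y₀ - yᵢ.
      ≈⟨ *-congˡ (*-congˡ (alternating-rotate Φ alt f (powers n (shift f)))) ⟩
    prod (λ i → y (suc i) - y zero) * (V * ((- 1#) ^ n * Φ (powers n (shift f) Vec.∷ʳ f)))
      ≈⟨ regroup _ V _ _ ⟩
    ((prod (λ i → y (suc i) - y zero) * (- 1#) ^ n) * V) * Φ (powers n (shift f) Vec.∷ʳ f)
      ≈⟨ *-cong (*-congʳ (trans (*-congʳ (Π.sum-cong-≋ {n} {λ i → y (suc i) - y zero} {λ i → - (y zero - y (suc i))} λ i → flip (y zero) (y (suc i)))) (prod-neg n (λ i → y zero - y (suc i)))))
           (reflexive (≡.cong Φ (powers-∷ʳ n f))) ⟩
    (prod (λ i → y zero - y (suc i)) * V) * Φ (powers (suc n) f)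
      ≈⟨ *-congʳ (Vandermonde-suc y) ⟨
    Vandermonde y * Φ (powers (suc n) f) ∎
    where
    d f : Row
    d = geometric (y zero) c
    f = complete (y ∘ suc) d
    V = Vandermonde (y ∘ suc)
    vanish : ∀ k → k < n → Φ (shifts (suc k) f ∷ powers n (shift f)) ≈ 0#
    vanish k k<n with powers-member n f k k<n
    ... | i , e = trans (reflexive (≡.cong (λ z → Φ (z ∷ powers n (shift f))) (≡.sym e)))
                        (alternating-repeat Φ alt (powers n (shift f)) i)
    open Solver
    regroup : ∀ p v s t → p * (v * (s * t)) ≈ ((p * s) * v) * t
    regroup = solve 4 (λ p v s t → p :* (v :* (s :* t)) := ((p :* s) :* v) :* t) refl
    flip : ∀ x y → y - x ≈ - (x - y)
    flip = solve 2 (λ x y → y :- x := :- (x :- y)) refl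

  unit : Row
  unit zero    = 1#
  unit (suc k) = 0#

  -- y^L is the coefficient of t^L in 1/(1 - yt), so the left side is an alternating form evaluated
  -- at geometric series with c = 1. When y consists of the variables, the right side has complete
  -- functions as entries: the Jacobi-Trudi identity with the Vandermonde product multiplied out.
  Det-complete : ∀ {n} (y : Fin n → Carrier) (L : Fin n → ℕ) →
    Det (λ i j → y i ^ L j) ≈
    Vandermonde y * Det (λ i j → shifts (n ∸ suc (toℕ i)) (complete y unit) (L j))
  Det-complete {n} y L = begin
    Det (λ i j → y i ^ L j)
      ≈⟨ Det-cong (λ i j → trans (sym (power (y i) (L j))) (reflexive (≡.cong (λ (z : Row) → z (L j)) (≡.sym (Vec.lookup∘tabulate (λ i → geometric (y i) unit) i))))) ⟩
    Det (λ i j → lookup (tabulate (λ i → geometric (y i) unit)) i (L j))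
      ≈⟨ alternating-geometric y _ (Det-alternating n L) unit ⟩
    Vandermonde y * Det (λ i j → lookup (powers n (complete y unit)) i (L j))
      ≈⟨ *-congˡ (Det-cong λ i j → reflexive (≡.cong (λ z → z (L j)) (lookup-powers n _ i))) ⟩
    Vandermonde y * Det (λ i j → shifts (n ∸ suc (toℕ i)) (complete y unit) (L j)) ∎
    where
    power : ∀ y k → geometric y unit k ≈ y ^ k
    power y zero    = refl
    power y (suc k) = trans (+-identityˡ _) (*-congˡ (power y k))
    lookup-powers : ∀ n c i → lookup (powers n c) i ≡ shifts (n ∸ suc (toℕ i)) c
    lookup-powers (suc n) c zero    = ≡.refl
    lookup-powers (suc n) c (suc i) = lookup-powers n c i

  shifts-≤ : ∀ m c {k} → m ≤ k → shifts m c k ≡ c (k ∸ m)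
  shifts-≤ zero    c m≤k       = ≡.refl
  shifts-≤ (suc m) c (s≤s m≤k) = shifts-≤ m c m≤k

  shifts-> : ∀ m c {k} → k < m → shifts m c k ≡ 0#
  shifts-> (suc m) c {zero}  k<m       = ≡.refl
  shifts-> (suc m) c {suc k} (s<s k<m) = shifts-> m c k<m

-- Sums over i + j = n.

module Antidiagonal {a b} (R : CommutativeRing a b) where
  open CommutativeRing R hiding (zero)
  open Summation R
  open SetoidReasoning setoid
  open IntegerImage R using (module Solver)

  -- Unlike the sum that defines `_*ˢ_`, this one hands both indices to F and needs no truncated
  -- subtraction, which keeps the inductions structural.
  convolve : ℕ → (ℕ → ℕ → Carrier) → Carrier
  convolve zero    F = F 0 0
  convolve (suc n) F = F 0 (suc n) + convolve n (λ i j → F (suc i) j)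

  convolve-sum : ∀ n (F : ℕ → ℕ → Carrier) → ∑ {suc n} (λ i → F (toℕ i) (n ∸ toℕ i)) ≈ convolve n F
  convolve-sum zero    F = ∑-head λ ()
  convolve-sum (suc n) F = trans (reflexive (∑-suc _)) (+-congˡ (convolve-sum n (λ i j → F (suc i) j)))

  convolve-cong′ : ∀ n {F G} → (∀ i j → i ℕ.+ j ≡ n → F i j ≈ G i j) → convolve n F ≈ convolve n G
  convolve-cong′ zero    p = p 0 0 ≡.refl
  convolve-cong′ (suc n) p = +-cong (p 0 (suc n) ≡.refl) (convolve-cong′ n (λ i j e → p (suc i) j (≡.cong suc e)))

  convolve-cong : ∀ n {F G} → (∀ i j → F i j ≈ G i j) → convolve n F ≈ convolve n G
  convolve-cong n p = convolve-cong′ n (λ i j _ → p i j)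

  convolve-zero′ : ∀ n {F} → (∀ i j → i ℕ.+ j ≡ n → F i j ≈ 0#) → convolve n F ≈ 0#
  convolve-zero′ zero    p = p 0 0 ≡.refl
  convolve-zero′ (suc n) p = trans
    (+-cong (p 0 (suc n) ≡.refl) (convolve-zero′ n (λ i j e → p (suc i) j (≡.cong suc e)))) (+-identityʳ 0#)

  convolve-zero : ∀ n {F} → (∀ i j → F i j ≈ 0#) → convolve n F ≈ 0#
  convolve-zero n p = convolve-zero′ n (λ i j _ → p i j)

  convolve-first : ∀ n {F} → (∀ i j → F (suc i) j ≈ 0#) → convolve n F ≈ F 0 n
  convolve-first zero    p = refl
  convolve-first (suc n) p = trans (+-congˡ (convolve-zero n (λ i j → p i j))) (+-identityʳ _)

  convolve-last : ∀ n {F} → (∀ i j → F i (suc j) ≈ 0#) → convolve n F ≈ F n 0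
  convolve-last zero    p = refl
  convolve-last (suc n) p = trans (+-cong (p 0 n) (convolve-last n (λ i j → p (suc i) j))) (+-identityˡ _)

  convolve-+ : ∀ n F G → convolve n (λ i j → F i j + G i j) ≈ convolve n F + convolve n G
  convolve-+ zero    F G = refl
  convolve-+ (suc n) F G = trans (+-congˡ (convolve-+ n _ _)) (regroup _ _ _ _)
    where
    open Solver
    regroup : ∀ x y z w → (x + y) + (z + w) ≈ (x + z) + (y + w)
    regroup = solve 4 (λ x y z w → (x :+ y) :+ (z :+ w) := (x :+ z) :+ (y :+ w)) refl

  convolve-*ˡ : ∀ n c F → c * convolve n F ≈ convolve n (λ i j → c * F i j)
  convolve-*ˡ zero    c F = refl
  convolve-*ˡ (suc n) c F = trans (distribˡ c _ _) (+-congˡ (convolve-*ˡ n c _))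

  convolve-∑ : ∀ n {m} (F : Fin m → ℕ → ℕ → Carrier) → convolve n (λ i j → ∑ λ l → F l i j) ≈ ∑ λ l → convolve n (F l)
  convolve-∑ zero    F = refl
  convolve-∑ (suc n) F = trans (+-congˡ (convolve-∑ n (λ l i j → F l (suc i) j))) (sym (∑-+ _ _))

  convolve-suc : ∀ n F → convolve (suc n) F ≈ convolve n (λ i j → F i (suc j)) + F (suc n) 0
  convolve-suc zero    F = refl
  convolve-suc (suc n) F = trans (+-congˡ (convolve-suc n (λ i j → F (suc i) j))) (sym (+-assoc _ _ _))

  convolve-swap : ∀ n F → convolve n F ≈ convolve n (λ i j → F j i)
  convolve-swap zero    F = refl
  convolve-swap (suc n) F = trans (convolve-suc n F) (trans (+-comm _ _) (+-congˡ (convolve-swap n (λ i j → F i (suc j)))))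

  convolve-comm : ∀ m n (F : ℕ → ℕ → ℕ → ℕ → Carrier) →
                  convolve m (λ i j → convolve n (F i j)) ≈ convolve n (λ p q → convolve m (λ i j → F i j p q))
  convolve-comm zero    n F = refl
  convolve-comm (suc m) n F = trans (+-congˡ (convolve-comm m n (λ i j → F (suc i) j))) (sym (convolve-+ n _ _))

  -- Both sides run over i + j + l = n.
  convolve-assoc : ∀ n (F : ℕ → ℕ → ℕ → Carrier) →
    convolve n (λ i m → convolve m (λ j l → F i j l)) ≈ convolve n (λ m l → convolve m (λ i j → F i j l))
  convolve-assoc zero    F = refl
  convolve-assoc (suc n) F = begin
    convolve (suc n) (F 0) + convolve n (λ i m → convolve m (F (suc i)))
      ≈⟨ +-congˡ (convolve-assoc n (λ i j l → F (suc i) j l)) ⟩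
    (F 0 0 (suc n) + convolve n (λ m l → F 0 (suc m) l)) + convolve n (λ m l → convolve m (λ i j → F (suc i) j l))
      ≈⟨ +-assoc _ _ _ ⟩
    F 0 0 (suc n) + (convolve n (λ m l → F 0 (suc m) l) + convolve n (λ m l → convolve m (λ i j → F (suc i) j l)))
      ≈⟨ +-congˡ (convolve-+ n _ _) ⟨
    F 0 0 (suc n) + convolve n (λ m l → F 0 (suc m) l + convolve m (λ i j → F (suc i) j l)) ∎

-- Ring homomorphisms and determinants.

module DeterminantMorphism {a b c d} (R : CommutativeRing a b) (S : CommutativeRing c d)
  {φ : CommutativeRing.Carrier R → CommutativeRing.Carrier S}
  (homomorphism : RingMorphisms.IsRingHomomorphism (CommutativeRing.rawRing R) (CommutativeRing.rawRing S) φ) where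
  private
    module R where
      open CommutativeRing R public
      open Determinant R public
    module S where
      open CommutativeRing S public
      open Determinant S public
  open SetoidReasoning S.setoid
  open RingMorphisms.IsRingHomomorphism homomorphism

  φ-∑ : ∀ {n} (f : Fin n → R.Carrier) → φ (R.∑ f) S.≈ S.∑ (λ i → φ (f i))
  φ-∑ {zero}  f = begin
    φ (R.∑ f)           ≡⟨ ≡.cong φ (R.∑-empty f) ⟩
    φ R.0#              ≈⟨ 0#-homo ⟩
    S.0#                ≡⟨ S.∑-empty _ ⟨
    S.∑ (λ i → φ (f i)) ∎
  φ-∑ {suc n} f = begin
    φ (R.∑ f)                                       ≡⟨ ≡.cong φ (R.∑-suc f) ⟩
    φ (f zero R.+ R.∑ (λ i → f (suc i)))            ≈⟨ +-homo _ _ ⟩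
    φ (f zero) S.+ φ (R.∑ (λ i → f (suc i)))        ≈⟨ S.+-congˡ (φ-∑ (λ i → f (suc i))) ⟩
    φ (f zero) S.+ S.∑ (λ i → φ (f (suc i)))        ≡⟨ S.∑-suc _ ⟨
    S.∑ (λ i → φ (f i))                             ∎

  φ-sign : ∀ {n} (j : Fin n) → φ (R.sign j) S.≈ S.sign j
  φ-sign zero    = 1#-homo
  φ-sign (suc j) = S.trans (*-homo _ _) (S.*-cong (S.trans (-‿homo R.1#) (S.-‿cong 1#-homo)) (φ-sign j))

  φ-Det : ∀ {n} (M : Fin n → Fin n → R.Carrier) → φ (R.Det M) S.≈ S.Det (λ i j → φ (M i j))
  φ-Det {zero}  M = begin
    φ (R.Det M)             ≡⟨ ≡.cong φ (R.Det-empty M) ⟩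
    φ R.1#                  ≈⟨ 1#-homo ⟩
    S.1#                    ≡⟨ S.Det-empty _ ⟨
    S.Det (λ i j → φ (M i j)) ∎
  φ-Det {suc n} M = begin
    φ (R.Det M)             ≡⟨ ≡.cong φ (R.Det-expand M) ⟩
    φ (R.∑ (λ j → R.sign j R.* (M zero j R.* R.Det (R.minor M zero j)))) ≈⟨ φ-∑ _ ⟩
    S.∑ (λ j → φ (R.sign j R.* (M zero j R.* R.Det (R.minor M zero j))))
      ≈⟨ S.∑-cong (λ j → S.trans (*-homo _ _) (S.*-cong (φ-sign j) (S.trans (*-homo _ _) (S.*-congˡ (φ-Det (R.minor M zero j)))))) ⟩
    S.∑ (λ j → S.sign j S.* (φ (M zero j) S.* S.Det (λ p q → φ (R.minor M zero j p q)))) ≡⟨ S.Det-expand _ ⟨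
    S.Det (λ i j → φ (M i j)) ∎

-- The commutative ring of series.

module SeriesRing {a b} (k : CommutativeRing a b) where
  open CommutativeRing k hiding (zero)
  open SymmetricFunctions k hiding (_+_; _*_; -_; _-_)
  open Antidiagonal k
  open Summation k
  open SetoidReasoning setoid

  infixl 9 _at_
  _at_ : Series → ℕ → Series
  (f at i) α = f (i ∷ α)

  *ˢ-∷ : ∀ f g n α → (f *ˢ g) (n ∷ α) ≈ convolve n (λ i j → (f at i *ˢ g at j) α)
  *ˢ-∷ f g n α = trans (reflexive (∑-def _)) (convolve-sum n (λ i j → (f at i *ˢ g at j) α))

  -- A product at α involves only lists of the same length, that is, the same number of variables.
  -- This makes identities that hold for n variables only, those with `_≈[_]_`, usable inside
  -- products.
  *ˢ-cong-at : ∀ {f f′ g g′} α → (∀ γ → length γ ≡ length α → f γ ≈ f′ γ) →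
               (∀ γ → length γ ≡ length α → g γ ≈ g′ γ) → (f *ˢ g) α ≈ (f′ *ˢ g′) α
  *ˢ-cong-at []      p q = *-cong (p [] ≡.refl) (q [] ≡.refl)
  *ˢ-cong-at {f} {f′} {g} {g′} (n ∷ α) p q = trans (*ˢ-∷ f g n α) (trans
    (convolve-cong n λ i j → *ˢ-cong-at α (λ γ e → p (i ∷ γ) (≡.cong suc e)) (λ γ e → q (j ∷ γ) (≡.cong suc e)))
    (sym (*ˢ-∷ f′ g′ n α)))

  *ˢ-cong : ∀ {f f′ g g′} → f ≈ˢ f′ → g ≈ˢ g′ → f *ˢ g ≈ˢ f′ *ˢ g′
  *ˢ-cong p q α = *ˢ-cong-at α (λ γ _ → p γ) (λ γ _ → q γ)

  -- The form in which arguments by degree are made: only pairs of exponents whose degrees add up to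
  -- that of α matter.
  *ˢ-vanish : ∀ {f g} α → (∀ γ γ′ → length γ ≡ length α → length γ′ ≡ length α →
              total γ ℕ.+ total γ′ ≡ total α → f γ * g γ′ ≈ 0#) → (f *ˢ g) α ≈ 0#
  *ˢ-vanish []      p = p [] [] ≡.refl ≡.refl ≡.refl
  *ˢ-vanish {f} {g} (n ∷ α) p = trans (*ˢ-∷ f g n α) (convolve-zero′ n λ i j i+j≡n →
    *ˢ-vanish α λ γ γ′ e e′ t → p (i ∷ γ) (j ∷ γ′) (≡.cong suc e) (≡.cong suc e′)
      (≡.trans (regroup i j (total γ) (total γ′)) (≡.cong₂ ℕ._+_ i+j≡n t)))
    where
    open +-*-Solver
    regroup : ∀ i j s t → (i ℕ.+ s) ℕ.+ (j ℕ.+ t) ≡ (i ℕ.+ j) ℕ.+ (s ℕ.+ t)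
    regroup = solve 4 (λ i j s t → (i :+ s) :+ (j :+ t) := (i :+ j) :+ (s :+ t)) ≡.refl

  0ˢ-*ˢ : ∀ f → 0ˢ *ˢ f ≈ˢ 0ˢ
  0ˢ-*ˢ f α = *ˢ-vanish {0ˢ} {f} α (λ γ γ′ _ _ _ → zeroˡ _)

  *ˢ-comm : ∀ f g → f *ˢ g ≈ˢ g *ˢ f
  *ˢ-comm f g []      = *-comm _ _
  *ˢ-comm f g (n ∷ α) = begin
    (f *ˢ g) (n ∷ α)                             ≈⟨ *ˢ-∷ f g n α ⟩
    convolve n (λ i j → (f at i *ˢ g at j) α)    ≈⟨ convolve-cong n (λ i j → *ˢ-comm (f at i) (g at j) α) ⟩
    convolve n (λ i j → (g at j *ˢ f at i) α)    ≈⟨ convolve-swap n (λ i j → (g at j *ˢ f at i) α) ⟩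
    convolve n (λ i j → (g at i *ˢ f at j) α)    ≈⟨ *ˢ-∷ g f n α ⟨
    (g *ˢ f) (n ∷ α)                             ∎

  *ˢ-distribʳ : ∀ f g h → (g +ˢ h) *ˢ f ≈ˢ g *ˢ f +ˢ h *ˢ f
  *ˢ-distribʳ f g h []      = distribʳ _ _ _
  *ˢ-distribʳ f g h (n ∷ α) = begin
    ((g +ˢ h) *ˢ f) (n ∷ α)                      ≈⟨ *ˢ-∷ (g +ˢ h) f n α ⟩
    convolve n (λ i j → ((g at i +ˢ h at i) *ˢ f at j) α)
      ≈⟨ convolve-cong n (λ i j → *ˢ-distribʳ (f at j) (g at i) (h at i) α) ⟩
    convolve n (λ i j → (g at i *ˢ f at j) α + (h at i *ˢ f at j) α)
      ≈⟨ convolve-+ n _ _ ⟩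
    convolve n (λ i j → (g at i *ˢ f at j) α) + convolve n (λ i j → (h at i *ˢ f at j) α)
      ≈⟨ +-cong (*ˢ-∷ g f n α) (*ˢ-∷ h f n α) ⟨
    (g *ˢ f +ˢ h *ˢ f) (n ∷ α)                   ∎

  *ˢ-distribˡ : ∀ f g h → f *ˢ (g +ˢ h) ≈ˢ f *ˢ g +ˢ f *ˢ h
  *ˢ-distribˡ f g h α = trans (*ˢ-comm f (g +ˢ h) α)
    (trans (*ˢ-distribʳ f g h α) (+-cong (*ˢ-comm g f α) (*ˢ-comm h f α)))

  •ˢ-*ˢ : ∀ c f g → (c •ˢ f) *ˢ g ≈ˢ c •ˢ (f *ˢ g)
  •ˢ-*ˢ c f g []      = *-assoc _ _ _
  •ˢ-*ˢ c f g (n ∷ α) = begin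
    ((c •ˢ f) *ˢ g) (n ∷ α)                                ≈⟨ *ˢ-∷ (c •ˢ f) g n α ⟩
    convolve n (λ i j → ((c •ˢ (f at i)) *ˢ g at j) α)     ≈⟨ convolve-cong n (λ i j → •ˢ-*ˢ c (f at i) (g at j) α) ⟩
    convolve n (λ i j → c * (f at i *ˢ g at j) α)          ≈⟨ convolve-*ˡ n c _ ⟨
    c * convolve n (λ i j → (f at i *ˢ g at j) α)          ≈⟨ *-congˡ (*ˢ-∷ f g n α) ⟨
    (c •ˢ (f *ˢ g)) (n ∷ α)                                ∎

  *ˢ-convolve : ∀ f m (P : ℕ → ℕ → Series) →
                f *ˢ (λ γ → convolve m (λ i j → P i j γ)) ≈ˢ (λ γ → convolve m (λ i j → (f *ˢ P i j) γ))
  *ˢ-convolve f zero    P α = refl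
  *ˢ-convolve f (suc m) P α = trans (*ˢ-distribˡ f (P 0 (suc m)) _ α) (+-congˡ (*ˢ-convolve f m (λ i j → P (suc i) j) α))

  *ˢ-assoc : ∀ f g h → (f *ˢ g) *ˢ h ≈ˢ f *ˢ (g *ˢ h)
  *ˢ-assoc f g h []      = *-assoc _ _ _
  *ˢ-assoc f g h (n ∷ α) = begin
    ((f *ˢ g) *ˢ h) (n ∷ α)
      ≈⟨ *ˢ-∷ (f *ˢ g) h n α ⟩
    convolve n (λ m l → ((f *ˢ g) at m *ˢ h at l) α)
      -- `*ˢ-convolve` distributes over a sum in the right factor, so h is moved to the left while
      -- the inner sum is opened.
      ≈⟨ convolve-cong n (λ m l → trans (*ˢ-comm ((f *ˢ g) at m) (h at l) α) (trans
           (*ˢ-cong {h at l} (λ _ → refl) (*ˢ-∷ f g m) α)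
           (*ˢ-convolve (h at l) m (λ i j → f at i *ˢ g at j) α))) ⟩
    convolve n (λ m l → convolve m (λ i j → (h at l *ˢ (f at i *ˢ g at j)) α))
      ≈⟨ convolve-cong n (λ m l → convolve-cong m (λ i j → trans (*ˢ-comm (h at l) (f at i *ˢ g at j) α) (*ˢ-assoc (f at i) (g at j) (h at l) α))) ⟩
    convolve n (λ m l → convolve m (λ i j → (f at i *ˢ (g at j *ˢ h at l)) α))
      ≈⟨ convolve-assoc n (λ i j l → (f at i *ˢ (g at j *ˢ h at l)) α) ⟨
    convolve n (λ i m → convolve m (λ j l → (f at i *ˢ (g at j *ˢ h at l)) α))
      ≈⟨ convolve-cong n (λ i m → *ˢ-convolve (f at i) m (λ j l → g at j *ˢ h at l) α) ⟨
    convolve n (λ i m → (f at i *ˢ (λ γ → convolve m (λ j l → (g at j *ˢ h at l) γ))) α)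
      ≈⟨ convolve-cong n (λ i m → *ˢ-cong {f at i} (λ _ → refl) (*ˢ-∷ g h m) α) ⟨
    convolve n (λ i m → (f at i *ˢ (g *ˢ h) at m) α)
      ≈⟨ *ˢ-∷ f (g *ˢ h) n α ⟨
    (f *ˢ (g *ˢ h)) (n ∷ α) ∎

  *ˢ-identityˡ : ∀ f → 1ˢ *ˢ f ≈ˢ f
  *ˢ-identityˡ f []      = *-identityˡ _
  *ˢ-identityˡ f (n ∷ α) = begin
    (1ˢ *ˢ f) (n ∷ α)                               ≈⟨ *ˢ-∷ 1ˢ f n α ⟩
    convolve n (λ i j → (1ˢ at i *ˢ f at j) α)      ≈⟨ convolve-first n (λ i j → 0ˢ-*ˢ (f at j) α) ⟩
    (1ˢ *ˢ f at n) α                                ≈⟨ *ˢ-identityˡ (f at n) α ⟩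
    f (n ∷ α)                                       ∎

  seriesCommutativeRing : CommutativeRing a b
  seriesCommutativeRing = record
    { Carrier = Series ; _≈_ = _≈ˢ_ ; _+_ = _+ˢ_ ; _*_ = _*ˢ_ ; -_ = -ˢ_ ; 0# = 0ˢ ; 1# = 1ˢ
    ; isCommutativeRing = record
      { isRing = record
        { +-isAbelianGroup = record
          { isGroup = record
            { isMonoid = record
              { isSemigroup = record
                { isMagma = record
                  { isEquivalence = record
                    { refl = λ _ → refl ; sym = λ p α → sym (p α) ; trans = λ p q α → trans (p α) (q α) }
                  ; ∙-cong = λ p q α → +-cong (p α) (q α) }
                ; assoc = λ _ _ _ _ → +-assoc _ _ _ }
              ; identity = (λ _ _ → +-identityˡ _) , (λ _ _ → +-identityʳ _) }
            ; inverse = (λ _ _ → -‿inverseˡ _) , (λ _ _ → -‿inverseʳ _)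
            ; ⁻¹-cong = λ p α → -‿cong (p α) }
          ; comm = λ _ _ _ → +-comm _ _ }
        ; *-cong = *ˢ-cong
        ; *-assoc = *ˢ-assoc
        ; *-identity = *ˢ-identityˡ , (λ f α → trans (*ˢ-comm f 1ˢ α) (*ˢ-identityˡ f α))
        ; distrib = *ˢ-distribˡ , *ˢ-distribʳ }
      ; *-comm = *ˢ-comm } }

  module S where
    open CommutativeRing seriesCommutativeRing public
    open Determinant seriesCommutativeRing public
    open JacobiTrudi seriesCommutativeRing public

module _ {a b c d} (R : CommutativeRing a b) (S : CommutativeRing c d) where
  private
    module R = CommutativeRing R
    module S = CommutativeRing S

  ringHomomorphism : (φ : R.Carrier → S.Carrier) → (∀ {x y} → x R.≈ y → φ x S.≈ φ y) →
    (∀ x y → φ (x R.+ y) S.≈ φ x S.+ φ y) → (∀ x y → φ (x R.* y) S.≈ φ x S.* φ y) →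
    (∀ x → φ (R.- x) S.≈ S.- φ x) → φ R.0# S.≈ S.0# → φ R.1# S.≈ S.1# →
    RingMorphisms.IsRingHomomorphism R.rawRing S.rawRing φ
  ringHomomorphism φ cong +-homo *-homo -‿homo 0#-homo 1#-homo = record
    { isSemiringHomomorphism = record
      { isNearSemiringHomomorphism = record
        { +-isMonoidHomomorphism = record
          { isMagmaHomomorphism = record { isRelHomomorphism = record { cong = cong } ; homo = +-homo }
          ; ε-homo = 0#-homo }
        ; *-homo = *-homo }
      ; 1#-homo = 1#-homo }
    ; -‿homo = -‿homo }

-- Exponent lists.

bump : ℕ → List ℕ → List ℕ
bump i       []      = []
bump zero    (x ∷ α) = suc x ∷ α
bump (suc i) (x ∷ α) = x ∷ bump i α

length-bump : ∀ i α → length (bump i α) ≡ length α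
length-bump i       []      = ≡.refl
length-bump zero    (x ∷ α) = ≡.refl
length-bump (suc i) (x ∷ α) = ≡.cong suc (length-bump i α)

total-bump : ∀ i α → i < length α → total (bump i α) ≡ suc (total α)
total-bump zero    (x ∷ α) _         = ≡.refl
total-bump (suc i) (x ∷ α) (s<s i<l) = ≡.trans (≡.cong (x ℕ.+_) (total-bump i α i<l)) (ℕ.+-suc x (total α))

nth-bump-≢ : ∀ i j α → i ≢ j → nth (bump i α) j ≡ nth α j
nth-bump-≢ i       j       []      i≢j = ≡.refl
nth-bump-≢ zero    zero    (x ∷ α) i≢j = contradiction ≡.refl i≢j
nth-bump-≢ zero    (suc j) (x ∷ α) i≢j = ≡.refl
nth-bump-≢ (suc i) zero    (x ∷ α) i≢j = ≡.refl
nth-bump-≢ (suc i) (suc j) (x ∷ α) i≢j = nth-bump-≢ i j α (λ e → i≢j (≡.cong suc e))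

bump-comm : ∀ i j α → bump i (bump j α) ≡ bump j (bump i α)
bump-comm i       j       []      = ≡.refl
bump-comm zero    zero    (x ∷ α) = ≡.refl
bump-comm zero    (suc j) (x ∷ α) = ≡.refl
bump-comm (suc i) zero    (x ∷ α) = ≡.refl
bump-comm (suc i) (suc j) (x ∷ α) = ≡.cong (x ∷_) (bump-comm i j α)

unbump : ∀ j α m → nth α j ≡ suc m → ∃[ γ ] α ≡ bump j γ × nth γ j ≡ m
unbump zero    (.(suc m) ∷ α) m ≡.refl = m ∷ α , ≡.refl , ≡.refl
unbump (suc j) (x ∷ α)        m e with unbump j α m e
... | γ , α≡ , γⱼ≡m = x ∷ γ , ≡.cong (x ∷_) α≡ , γⱼ≡m

staircase : ∀ n → Fin n → ℕ
staircase n j = n ∸ suc (toℕ j)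

-- Series in single variables, and the regularity of the Vandermonde product.

module Variables {a b} (k : CommutativeRing a b) where
  open CommutativeRing k hiding (zero)
  open RingProperties ring
  open SymmetricFunctions k hiding (_+_; _*_; -_; _-_)
  open SeriesRing k
  open Antidiagonal k
  open SetoidReasoning setoid
  open JacobiTrudi k using (shift)

  Row : Set a
  Row = ℕ → Carrier

  -- The ring homomorphism that sends each variable to the next one.
  lift : Series → Series
  lift f []          = f []
  lift f (zero ∷ α)  = f α
  lift f (suc _ ∷ α) = 0#

  lift-*ˢ-∷ : ∀ u f g γ → (lift u *ˢ f) (g ∷ γ) ≈ (u *ˢ f at g) γ
  lift-*ˢ-∷ u f g γ = trans (*ˢ-∷ (lift u) f g γ) (convolve-first g (λ i j → 0ˢ-*ˢ (f at j) γ))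

  lift-homomorphism : RingMorphisms.IsRingHomomorphism S.rawRing S.rawRing lift
  lift-homomorphism = ringHomomorphism seriesCommutativeRing seriesCommutativeRing lift
    (λ { p [] → p [] ; p (zero ∷ α) → p α ; p (suc _ ∷ α) → refl })
    (λ { f g [] → refl ; f g (zero ∷ α) → refl ; f g (suc _ ∷ α) → sym (+-identityʳ 0#) })
    (λ { f g [] → refl
       ; f g (zero ∷ α) → sym (lift-*ˢ-∷ f (lift g) 0 α)
       ; f g (suc n ∷ α) → sym (trans (lift-*ˢ-∷ f (lift g) (suc n) α) (trans (*ˢ-comm f 0ˢ α) (0ˢ-*ˢ f α))) })
    (λ { f [] → refl ; f (zero ∷ α) → refl ; f (suc _ ∷ α) → sym -0#≈0# })
    (λ { [] → refl ; (zero ∷ α) → refl ; (suc _ ∷ α) → refl })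
    (λ { [] → refl ; (zero ∷ α) → refl ; (suc _ ∷ α) → refl })

  module Lift where
    open RingMorphisms.IsRingHomomorphism lift-homomorphism public
    open DeterminantMorphism seriesCommutativeRing seriesCommutativeRing lift-homomorphism public

  constant-homomorphism : RingMorphisms.IsRingHomomorphism S.rawRing rawRing (λ f → f [])
  constant-homomorphism = ringHomomorphism seriesCommutativeRing k (λ f → f []) (λ p → p []) (λ _ _ → refl) (λ _ _ → refl) (λ _ → refl) refl refl

  module Constant = DeterminantMorphism seriesCommutativeRing k constant-homomorphism

  var-suc : ∀ i → var (suc i) ≈ˢ lift (var i)
  var-suc zero    []          = refl
  var-suc (suc i) []          = refl
  var-suc i       (zero ∷ α)  = refl
  var-suc i       (suc _ ∷ α) = refl

  var-suc-* : ∀ i f g γ → (var (suc i) *ˢ f) (g ∷ γ) ≈ (var i *ˢ f at g) γ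
  var-suc-* i f g γ = trans (*ˢ-cong {g = f} (var-suc i) (λ _ → refl) (g ∷ γ)) (lift-*ˢ-∷ (var i) f g γ)

  var-zero-*-zero : ∀ f γ → (var 0 *ˢ f) (0 ∷ γ) ≈ 0#
  var-zero-*-zero f γ = trans (*ˢ-∷ (var 0) f 0 γ) (0ˢ-*ˢ (f at 0) γ)

  var-zero-*-suc : ∀ f g γ → (var 0 *ˢ f) (suc g ∷ γ) ≈ f (g ∷ γ)
  var-zero-*-suc f g γ = begin
    (var 0 *ˢ f) (suc g ∷ γ)
      ≈⟨ *ˢ-∷ (var 0) f (suc g) γ ⟩
    (0ˢ *ˢ f at suc g) γ + convolve g (λ i j → (var 0 at suc i *ˢ f at j) γ)
      ≈⟨ +-cong (0ˢ-*ˢ (f at suc g) γ) (convolve-first g (λ i j → 0ˢ-*ˢ (f at j) γ)) ⟩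
    0# + (1ˢ *ˢ f at g) γ
      ≈⟨ trans (+-identityˡ _) (*ˢ-identityˡ (f at g) γ) ⟩
    f (g ∷ γ) ∎

  var-*-bump : ∀ i f α → i < length α → (var i *ˢ f) (bump i α) ≈ f α
  var-*-bump zero    f (x ∷ α) _         = var-zero-*-suc f x α
  var-*-bump (suc i) f (x ∷ α) (s<s i<l) = trans (var-suc-* i f x (bump i α)) (var-*-bump i (f at x) α i<l)

  var-*-zero : ∀ i f α → nth α i ≡ 0 → (var i *ˢ f) α ≈ 0#
  var-*-zero i       f []          e = trans (*-congʳ (var-[] i)) (zeroˡ _)
    where
    var-[] : ∀ i → var i [] ≈ 0#
    var-[] zero    = refl
    var-[] (suc i) = refl
  var-*-zero zero    f (zero ∷ α)  e = var-zero-*-zero f α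
  var-*-zero (suc i) f (x ∷ α)     e = trans (var-suc-* i f x α) (var-*-zero i (f at x) α e)

  -- The power series p(t) at t = x_{i+1}.
  inVar : ℕ → Row → Series
  inVar zero    p []      = p 0
  inVar zero    p (g ∷ γ) = p g * 1ˢ γ
  inVar (suc i) p         = lift (inVar i p)

  inVar-cong : ∀ i {p q} → (∀ g → p g ≈ q g) → inVar i p ≈ˢ inVar i q
  inVar-cong zero    e []      = e 0
  inVar-cong zero    e (g ∷ γ) = *-congʳ (e g)
  inVar-cong (suc i) e         = Lift.⟦⟧-cong (inVar-cong i e)

  inVar-+ : ∀ i p q → inVar i (λ g → p g + q g) ≈ˢ inVar i p +ˢ inVar i q
  inVar-+ zero    p q []      = refl
  inVar-+ zero    p q (g ∷ γ) = distribʳ _ _ _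
  inVar-+ (suc i) p q         = S.trans (Lift.⟦⟧-cong (inVar-+ i p q)) (Lift.+-homo (inVar i p) (inVar i q))

  inVar-• : ∀ i r p → inVar i (λ g → r * p g) ≈ˢ r •ˢ inVar i p
  inVar-• zero    r p []          = refl
  inVar-• zero    r p (g ∷ γ)     = *-assoc _ _ _
  inVar-• (suc i) r p []          = inVar-• i r p []
  inVar-• (suc i) r p (zero ∷ γ)  = inVar-• i r p γ
  inVar-• (suc i) r p (suc _ ∷ γ) = sym (zeroʳ r)

  var-*-inVar : ∀ i p → var i *ˢ inVar i p ≈ˢ inVar i (shift p)
  var-*-inVar zero    p []          = zeroˡ _
  var-*-inVar zero    p (zero ∷ γ)  = trans (var-zero-*-zero (inVar 0 p) γ) (sym (zeroˡ _))
  var-*-inVar zero    p (suc g ∷ γ) = var-zero-*-suc (inVar 0 p) g γ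
  var-*-inVar (suc i) p             = begin′
    where
    begin′ : var (suc i) *ˢ lift (inVar i p) ≈ˢ lift (inVar i (shift p))
    begin′ = S.trans (*ˢ-cong {g = lift (inVar i p)} (var-suc i) (λ _ → refl))
      (S.trans (S.sym (Lift.*-homo (var i) (inVar i p))) (Lift.⟦⟧-cong (var-*-inVar i p)))

  inVar-unit : ∀ i → inVar i (JacobiTrudi.unit k) ≈ˢ 1ˢ
  inVar-unit zero    []          = refl
  inVar-unit zero    (zero ∷ γ)  = *-identityˡ _
  inVar-unit zero    (suc g ∷ γ) = zeroˡ _
  inVar-unit (suc i)             = S.trans (Lift.⟦⟧-cong (inVar-unit i)) Lift.1#-homo

  inVar-zero-*-lift : ∀ p f g γ → (inVar 0 p *ˢ lift f) (g ∷ γ) ≈ p g * f γ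
  inVar-zero-*-lift p f g γ = begin
    (inVar 0 p *ˢ lift f) (g ∷ γ)
      ≈⟨ *ˢ-∷ (inVar 0 p) (lift f) g γ ⟩
    convolve g (λ i j → ((p i •ˢ 1ˢ) *ˢ lift f at j) γ)
      ≈⟨ convolve-last g (λ i j → trans (*ˢ-comm (p i •ˢ 1ˢ) 0ˢ γ) (0ˢ-*ˢ (p i •ˢ 1ˢ) γ)) ⟩
    ((p g •ˢ 1ˢ) *ˢ f) γ
      ≈⟨ •ˢ-*ˢ (p g) 1ˢ f γ ⟩
    p g * (1ˢ *ˢ f) γ
      ≈⟨ *-congˡ (*ˢ-identityˡ f γ) ⟩
    p g * f γ ∎

  private module K = Determinant k

  ∑ˢ-at : ∀ {n} (f : Fin n → Series) α → S.∑ f α ≈ K.∑ (λ i → f i α)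
  ∑ˢ-at {zero}  f α = trans (reflexive (≡.cong (λ h → h α) (S.∑-empty f))) (reflexive (≡.sym (K.∑-empty _)))
  ∑ˢ-at {suc n} f α = trans (reflexive (≡.cong (λ h → h α) (S.∑-suc f)))
    (trans (+-congˡ (∑ˢ-at (λ i → f (suc i)) α)) (reflexive (≡.sym (K.∑-suc _))))

  signˢ-* : ∀ {n} (j : Fin n) f α → (S.sign j *ˢ f) α ≈ K.sign j * f α
  signˢ-* zero    f α = trans (*ˢ-identityˡ f α) (sym (*-identityˡ _))
  signˢ-* (suc j) f α = begin
    (((-ˢ 1ˢ) *ˢ S.sign j) *ˢ f) α   ≈⟨ *ˢ-assoc (-ˢ 1ˢ) (S.sign j) f α ⟩
    ((-ˢ 1ˢ) *ˢ (S.sign j *ˢ f)) α   ≈⟨ RingProperties.-1*x≈-x S.ring (S.sign j *ˢ f) α ⟩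
    - (S.sign j *ˢ f) α              ≈⟨ -‿cong (signˢ-* j f α) ⟩
    - (K.sign j * f α)               ≈⟨ -1*x≈-x _ ⟨
    - 1# * (K.sign j * f α)          ≈⟨ *-assoc _ _ _ ⟨
    K.sign (suc j) * f α             ∎

  Detˢ-empty-at : ∀ (M : Fin 0 → Fin 0 → Series) α → S.Det M α ≈ 1ˢ α
  Detˢ-empty-at M α = reflexive (≡.cong (λ h → h α) (S.Det-empty M))

  Detˢ-expand-at : ∀ {n} (M : Fin (suc n) → Fin (suc n) → Series) α →
    S.Det M α ≈ K.∑ λ j → K.sign j * (M zero j *ˢ S.Det (S.minor M zero j)) α
  Detˢ-expand-at M α = begin
    S.Det M α  ≡⟨ ≡.cong (λ h → h α) (S.Det-expand M) ⟩
    S.∑ (λ j → S.sign j *ˢ (M zero j *ˢ S.Det (S.minor M zero j))) α  ≈⟨ ∑ˢ-at _ α ⟩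
    K.∑ (λ j → (S.sign j *ˢ (M zero j *ˢ S.Det (S.minor M zero j))) α)
      ≈⟨ K.∑-cong (λ j → signˢ-* j (M zero j *ˢ S.Det (S.minor M zero j)) α) ⟩
    K.∑ (λ j → K.sign j * (M zero j *ˢ S.Det (S.minor M zero j)) α) ∎

  Detˢ-cong-at : ∀ {n} {M N : Fin n → Fin n → Series} α → (∀ i j γ → length γ ≡ length α → M i j γ ≈ N i j γ) →
                 S.Det M α ≈ S.Det N α
  Detˢ-cong-at {zero}  {M} {N} α p = trans (Detˢ-empty-at M α) (sym (Detˢ-empty-at N α))
  Detˢ-cong-at {suc n} {M} {N} α p = begin
    S.Det M α  ≈⟨ Detˢ-expand-at M α ⟩
    K.∑ (λ j → K.sign j * (M zero j *ˢ S.Det (S.minor M zero j)) α)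
      ≈⟨ K.∑-cong (λ j → *-congˡ (*ˢ-cong-at α (p zero j)
           (λ γ e → Detˢ-cong-at γ (λ r s ε e′ → p (suc r) (punchIn j s) ε (≡.trans e′ e))))) ⟩
    K.∑ (λ j → K.sign j * (N zero j *ˢ S.Det (S.minor N zero j)) α)
      ≈⟨ Detˢ-expand-at N α ⟨
    S.Det N α ∎

  -- Row i involves the single variable x_{i+1}, so coefficients are taken row by row. In the
  -- expansion along the first row all minors are lifted and do not involve x₁, which leaves one
  -- product per column.
  Det-inVar : ∀ {n} (p : Fin n → Fin n → Row) γ → length γ ≡ n →
    S.Det (λ i j → inVar (toℕ i) (p i j)) γ ≈ K.Det (λ i j → p i j (nth γ (toℕ i)))
  Det-inVar {zero} p [] e = trans (Detˢ-empty-at _ []) (reflexive (≡.sym (K.Det-empty _)))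
  Det-inVar {suc n} p (g ∷ γ) e = begin
    S.Det M (g ∷ γ)  ≈⟨ Detˢ-expand-at M (g ∷ γ) ⟩
    K.∑ (λ j → K.sign j * (inVar 0 (p zero j) *ˢ S.Det (λ r s → lift (inVar (toℕ r) (p (suc r) (punchIn j s))))) (g ∷ γ))
      ≈⟨ K.∑-cong (λ j → *-congˡ (begin
           (inVar 0 (p zero j) *ˢ S.Det (λ r s → lift (inVar (toℕ r) (p (suc r) (punchIn j s))))) (g ∷ γ)
             ≈⟨ *ˢ-cong {inVar 0 (p zero j)} (λ _ → refl) (Lift.φ-Det (λ r s → inVar (toℕ r) (p (suc r) (punchIn j s)))) (g ∷ γ) ⟨
           (inVar 0 (p zero j) *ˢ lift (S.Det (λ r s → inVar (toℕ r) (p (suc r) (punchIn j s))))) (g ∷ γ)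
             ≈⟨ inVar-zero-*-lift (p zero j) _ g γ ⟩
           p zero j g * S.Det (λ r s → inVar (toℕ r) (p (suc r) (punchIn j s))) γ
             ≈⟨ *-congˡ (Det-inVar (λ r s → p (suc r) (punchIn j s)) γ (ℕ.suc-injective e)) ⟩
           p zero j g * K.Det (λ r s → p (suc r) (punchIn j s) (nth γ (toℕ r))) ∎)) ⟩
    K.∑ (λ j → K.sign j * (p zero j g * K.Det (λ r s → p (suc r) (punchIn j s) (nth γ (toℕ r)))))
      ≡⟨ K.Det-expand _ ⟨
    K.Det (λ i j → p i j (nth (g ∷ γ) (toℕ i))) ∎
    where
    M : Fin (suc n) → Fin (suc n) → Series
    M i j = inVar (toℕ i) (p i j)

  -- f behaves like a homogeneous polynomial of degree e that is not a zero divisor.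
  GradedRegular : ℕ → ℕ → Series → Set (a ⊔ b)
  GradedRegular n e f = ∀ u d → (∀ γ → length γ ≡ n → total γ ≡ d ℕ.+ e → (u *ˢ f) γ ≈ 0#) →
                        ∀ α → length α ≡ n → total α ≡ d → u α ≈ 0#

  regular-1ˢ : ∀ n → GradedRegular n 0 1ˢ
  regular-1ˢ n u d p α l t = trans (sym (trans (*ˢ-comm u 1ˢ α) (*ˢ-identityˡ u α))) (p α l (≡.trans t (≡.sym (ℕ.+-identityʳ d))))

  regular-*ˢ : ∀ {n e e′ f g} → GradedRegular n e f → GradedRegular n e′ g → GradedRegular n (e ℕ.+ e′) (f *ˢ g)
  regular-*ˢ {n} {e} {e′} {f} {g} F G u d p = F u d (G (u *ˢ f) (d ℕ.+ e)
    (λ γ l t → trans (*ˢ-assoc u f g γ) (p γ l (≡.trans t (ℕ.+-assoc d e e′)))))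

  -- If u is annihilated, its coefficient at α equals the one with a unit of exponent moved from
  -- place j to place i. Repeating this empties place j, and a coefficient of xⱼu at an exponent
  -- with nothing in place j is zero.
  regular-difference : ∀ {n} i j → i < n → j < n → i ≢ j → GradedRegular n 1 (var i +ˢ -ˢ var j)
  regular-difference {n} i j i<n j<n i≢j u d p α l t = go (nth α j) α l t ≡.refl
    where
    coefficient : ∀ γ → length γ ≡ n → total γ ≡ suc d → (var i *ˢ u) γ ≈ (var j *ˢ u) γ
    coefficient γ l t = begin
      x                     ≈⟨ +-identityʳ x ⟨
      x + 0#                ≈⟨ +-congˡ (-‿inverseˡ y) ⟨
      x + (- y + y)         ≈⟨ +-assoc x (- y) y ⟨
      (x + - y) + y         ≈⟨ +-congʳ (+-congˡ (RingProperties.-‿distribˡ-* S.ring (var j) u γ)) ⟩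
      (x + ((-ˢ var j) *ˢ u) γ) + y
                            ≈⟨ +-congʳ (*ˢ-distribʳ u (var i) (-ˢ var j) γ) ⟨
      ((var i +ˢ -ˢ var j) *ˢ u) γ + y
                            ≈⟨ +-congʳ (trans (*ˢ-comm (var i +ˢ -ˢ var j) u γ) (p γ l (≡.trans t (ℕ.+-comm 1 d)))) ⟩
      0# + y                ≈⟨ +-identityˡ y ⟩
      y                     ∎
      where
      x = (var i *ˢ u) γ
      y = (var j *ˢ u) γ
    bumped : ∀ α → length α ≡ n → total α ≡ d → u α ≈ (var j *ˢ u) (bump i α)
    bumped α l t = trans (sym (var-*-bump i u α i<l))
      (coefficient (bump i α) (≡.trans (length-bump i α) l) (≡.trans (total-bump i α i<l) (≡.cong suc t)))
      where i<l = ≡.subst (i <_) (≡.sym l) i<n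
    go : ∀ m α → length α ≡ n → total α ≡ d → nth α j ≡ m → u α ≈ 0#
    go zero    α l t e = trans (bumped α l t) (var-*-zero j u (bump i α) (≡.trans (nth-bump-≢ i j α i≢j) e))
    go (suc m) α l t e with unbump j α m e
    ... | γ , ≡.refl , e′ = trans (bumped (bump j γ) l t) (trans
      (trans (reflexive (≡.cong (var j *ˢ u) (bump-comm i j γ)))
        (var-*-bump j u (bump i γ) (≡.subst (j <_) (≡.sym li) j<n)))
      (go m (bump i γ) li
        (≡.trans (total-bump i γ (≡.subst (i <_) (≡.sym lγ) i<n)) (≡.trans (≡.sym (total-bump j γ (≡.subst (j <_) (≡.sym lγ) j<n))) t))
        (≡.trans (nth-bump-≢ i j γ i≢j) e′)))
      where
      lγ = ≡.trans (≡.sym (length-bump j γ)) l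
      li = ≡.trans (length-bump i γ) lγ

  regular-prod : ∀ {n m} (e : Fin m → ℕ) (f : Fin m → Series) → (∀ i → GradedRegular n (e i) (f i)) →
                 GradedRegular n (total (List.tabulate e)) (prodˢ f)
  regular-prod {m = zero}  e f p = regular-1ˢ _
  regular-prod {m = suc m} e f p = regular-*ˢ {f = f zero} {g = prodˢ (f ∘ suc)} (p zero) (regular-prod (e ∘ suc) (f ∘ suc) (p ∘ suc))

  regular-vandermonde : ∀ n → GradedRegular n (total (List.tabulate (staircase n))) (vandermonde n)
  regular-vandermonde n = ≡.subst (λ e → GradedRegular n e (vandermonde n)) (pairs n)
    (regular-prod _ _ λ i → regular-prod _ _ λ j → decided i j (i Fin.<? j))
    where
    degree : ∀ {n} → Fin n → Fin n → ℕ
    degree i j = if does (i Fin.<? j) then 1 else 0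
    decided : ∀ i j (i<?j : Dec (i Fin.< j)) →
              GradedRegular n (if does i<?j then 1 else 0) (if does i<?j then var (toℕ i) +ˢ (-ˢ var (toℕ j)) else 1ˢ)
    decided i j (yes i<j) = regular-difference (toℕ i) (toℕ j) (Fin.toℕ<n i) (Fin.toℕ<n j) (ℕ.<⇒≢ i<j)
    decided i j (no _)    = regular-1ˢ n
    ones : ∀ n → total (List.tabulate {n = n} (λ _ → 1)) ≡ n
    ones zero    = ≡.refl
    ones (suc n) = ≡.cong suc (ones n)
    pairs : ∀ n → total (List.tabulate {n = n} λ i → total (List.tabulate {n = n} λ j → degree i j)) ≡ total (List.tabulate (staircase n))
    pairs zero    = ≡.refl
    pairs (suc n) = ≡.cong₂ ℕ._+_ (ones n) (pairs n)

  -- The generating function ∏ 1/(1 - xᵢt) = ∑ h_m tᵐ. The factor of x₁ is moved outermost, so that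
  -- its recursion h_m = h_m(x₂, ...) + x₁h_{m-1} follows the first exponent.
  complete-variables : ∀ n m → S.complete {n} (λ i → var (toℕ i)) S.unit m ≈[ n ] hˢ (+ m)
  complete-variables zero zero    [] _ = refl
  complete-variables zero (suc m) [] _ = refl
  complete-variables (suc n) m α l = begin
    complete {n} (λ i → var (suc (toℕ i))) (geometric (var 0) unit) m α
      ≈⟨ complete-geometric {n} (λ i → var (suc (toℕ i))) (var 0) unit m α ⟩
    geometric (var 0) (complete {n} (λ i → var (suc (toℕ i))) unit) m α
      ≈⟨ geometric-cong {var 0} S.refl (complete-cong {n} {λ i → var (suc (toℕ i))} (λ i → var-suc (toℕ i)) unit-lift) m α ⟩
    geometric (var 0) (complete {n} (λ i → lift (var (toℕ i))) (λ m → lift (unit m))) m α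
      ≈⟨ geometric-cong {var 0} S.refl (λ m → S.sym (complete-lift {n} (λ i → var (toℕ i)) unit m)) m α ⟩
    geometric (var 0) (λ m → lift (complete {n} (λ i → var (toℕ i)) unit m)) m α
      ≈⟨ first m α l ⟩
    hˢ (+ m) α ∎
    where
    open S using (complete; complete-cong; complete-geometric; geometric; geometric-cong; unit)
    unit-lift : ∀ m → unit m ≈ˢ lift (unit m)
    unit-lift zero    = S.sym Lift.1#-homo
    unit-lift (suc m) = S.sym Lift.0#-homo
    geometric-lift : ∀ y c m → lift (geometric y c m) ≈ˢ geometric (lift y) (λ m → lift (c m)) m
    geometric-lift y c zero    = S.refl
    geometric-lift y c (suc m) = S.trans (Lift.+-homo (c (suc m)) (y *ˢ geometric y c m))
      (S.+-cong {lift (c (suc m))} S.refl (S.trans (Lift.*-homo y (geometric y c m)) (*ˢ-cong {lift y} S.refl (geometric-lift y c m))))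
    complete-lift : ∀ {n} (y : Fin n → Series) c m → lift (complete y c m) ≈ˢ complete (λ i → lift (y i)) (λ m → lift (c m)) m
    complete-lift {zero}  y c m = S.refl
    complete-lift {suc n} y c m = S.trans (complete-lift (y ∘ suc) (geometric (y zero) c) m)
      (complete-cong {y = λ i → lift (y (suc i))} (λ _ → S.refl) (geometric-lift (y zero) c) m)
    G : ℕ → Series
    G = geometric (var 0) (λ m → lift (complete {n} (λ i → var (toℕ i)) unit m))
    first : ∀ m α → length α ≡ suc n → G m α ≈ hˢ (+ m) α
    first zero    (zero ∷ α)  l = complete-variables n 0 α (ℕ.suc-injective l)
    first zero    (suc x ∷ α) l = refl
    first (suc m) (zero ∷ α)  l = trans (+-cong (complete-variables n (suc m) α (ℕ.suc-injective l)) (var-zero-*-zero (G m) α)) (+-identityʳ _)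
    first (suc m) (suc x ∷ α) l = trans (+-identityˡ _) (trans (var-zero-*-suc (G m) x α) (first m (x ∷ α) l))

-- Determinants with one variable per row.

module Separated {a b} (k : CommutativeRing a b) where
  open CommutativeRing k hiding (zero)
  open SymmetricFunctions k hiding (_+_; _*_; -_; _-_)
  open SeriesRing k
  open Variables k
  open Antidiagonal k
  open Determinant k
  open SetoidReasoning setoid

  -- The coefficients of the determinant with entries u i j (x_{i+1}).
  separated : ∀ {n} → (Fin n → Fin n → Row) → Series
  separated u γ = Det (λ i j → u i j (nth γ (toℕ i)))

  without : ∀ {n} → (Fin (suc n) → Fin (suc n) → Row) → Fin (suc n) → Fin n → Fin n → Row
  without u j r s = u (suc r) (punchIn j s)

  separated-∷ : ∀ {n} (u : Fin (suc n) → Fin (suc n) → Row) g γ →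
                separated u (g ∷ γ) ≈ ∑ λ j → sign j * (u zero j g * separated (without u j) γ)
  separated-∷ u g γ = reflexive (Det-expand _)

  *ˢ-∑ʳ : ∀ {m} (f : Fin m → Series) g α → ((λ γ → ∑ λ j → f j γ) *ˢ g) α ≈ ∑ λ j → (f j *ˢ g) α
  *ˢ-∑ʳ {zero}  f g α = begin
    ((λ γ → ∑ λ j → f j γ) *ˢ g) α  ≈⟨ *ˢ-cong {g = g} (λ γ → reflexive (∑-empty _)) (λ _ → refl) α ⟩
    (0ˢ *ˢ g) α                     ≈⟨ 0ˢ-*ˢ g α ⟩
    0#                              ≡⟨ ∑-empty _ ⟨
    (∑ λ j → (f j *ˢ g) α)          ∎
  *ˢ-∑ʳ {suc m} f g α = begin
    ((λ γ → ∑ λ j → f j γ) *ˢ g) α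
      ≈⟨ *ˢ-cong {g = g} (λ γ → reflexive (∑-suc _)) (λ _ → refl) α ⟩
    ((f zero +ˢ (λ γ → ∑ λ j → f (suc j) γ)) *ˢ g) α
      ≈⟨ *ˢ-distribʳ g (f zero) (λ γ → ∑ λ j → f (suc j) γ) α ⟩
    (f zero *ˢ g) α + ((λ γ → ∑ λ j → f (suc j) γ) *ˢ g) α
      ≈⟨ +-congˡ (*ˢ-∑ʳ (λ j → f (suc j)) g α) ⟩
    (f zero *ˢ g) α + (∑ λ j → (f (suc j) *ˢ g) α)
      ≡⟨ ∑-suc _ ⟨
    (∑ λ j → (f j *ˢ g) α) ∎

  *ˢ-•ˢ : ∀ c f g → f *ˢ (c •ˢ g) ≈ˢ c •ˢ (f *ˢ g)
  *ˢ-•ˢ c f g α = trans (*ˢ-comm f (c •ˢ g) α) (trans (•ˢ-*ˢ c g f α) (*-congˡ (*ˢ-comm g f α)))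

  -- The coefficients of the product of the w i (x_{i+1}); the lists of length n are the ones that
  -- count.
  weights : ∀ {n} → (Fin n → Row) → Series
  weights {zero}  w τ       = 1#
  weights {suc n} w []      = 0#
  weights {suc n} w (t ∷ τ) = w zero t * weights (λ i → w (suc i)) τ

  _⋆_ : Row → Row → Row
  (p ⋆ q) g = convolve g (λ a b → p a * q b)

  -- The determinant is linear in each row, and row i alone involves x_{i+1}, so it absorbs the
  -- factor w i.
  separated-*-weights : ∀ {n} (u : Fin n → Fin n → Row) (w : Fin n → Row) γ → length γ ≡ n →
    (separated u *ˢ weights w) γ ≈ separated (λ i j → u i j ⋆ w i) γ
  separated-*-weights {zero}  u w [] l = trans (*-identityʳ _) (Det-cong λ ())
  separated-*-weights {suc n} u w (g ∷ γ) l = begin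
    (separated u *ˢ weights w) (g ∷ γ)
      ≈⟨ *ˢ-∷ (separated u) (weights w) g γ ⟩
    convolve g (λ p q → (separated u at p *ˢ weights w at q) γ)
      ≈⟨ convolve-cong g term ⟩
    convolve g (λ p q → ∑ λ j → (sign j * D j) * (u zero j p * w zero q))
      ≈⟨ convolve-∑ g _ ⟩
    (∑ λ j → convolve g (λ p q → (sign j * D j) * (u zero j p * w zero q)))
      ≈⟨ ∑-cong (λ j → convolve-*ˡ g (sign j * D j) _) ⟨
    (∑ λ j → (sign j * D j) * (u zero j ⋆ w zero) g)
      ≈⟨ ∑-cong (λ j → regroup′ (sign j) (D j) _) ⟩
    (∑ λ j → sign j * ((u zero j ⋆ w zero) g * D j))
      ≈⟨ separated-∷ (λ i j → u i j ⋆ w i) g γ ⟨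
    separated (λ i j → u i j ⋆ w i) (g ∷ γ) ∎
    where
    w′ : Fin n → Row
    w′ i = w (suc i)
    D : Fin (suc n) → Carrier
    D j = separated (λ r s → without u j r s ⋆ w′ r) γ
    open IntegerImage.Solver k
    regroup : ∀ s u v d → v * (s * (u * d)) ≈ (s * d) * (u * v)
    regroup = solve 4 (λ s u v d → v :* (s :* (u :* d)) := (s :* d) :* (u :* v)) refl
    regroup′ : ∀ s d x → (s * d) * x ≈ s * (x * d)
    regroup′ = solve 3 (λ s d x → (s :* d) :* x := s :* (x :* d)) refl
    term : ∀ p q → (separated u at p *ˢ weights w at q) γ ≈ ∑ λ j → (sign j * D j) * (u zero j p * w zero q)
    term p q = begin
      (separated u at p *ˢ (w zero q •ˢ weights w′)) γ
        ≈⟨ *ˢ-•ˢ (w zero q) (separated u at p) (weights w′) γ ⟩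
      w zero q * (separated u at p *ˢ weights w′) γ
        ≈⟨ *-congˡ (*ˢ-cong {g = weights w′} (separated-∷ u p) (λ _ → refl) γ) ⟩
      w zero q * ((λ γ → ∑ λ j → sign j * (u zero j p * separated (without u j) γ)) *ˢ weights w′) γ
        ≈⟨ *-congˡ (*ˢ-∑ʳ _ (weights w′) γ) ⟩
      w zero q * (∑ λ j → ((sign j •ˢ (u zero j p •ˢ separated (without u j))) *ˢ weights w′) γ)
        ≈⟨ ∑-*ˡ (w zero q) _ ⟩
      (∑ λ j → w zero q * ((sign j •ˢ (u zero j p •ˢ separated (without u j))) *ˢ weights w′) γ)
        ≈⟨ ∑-cong (λ j → trans
             (*-congˡ (trans (•ˢ-*ˢ (sign j) (u zero j p •ˢ separated (without u j)) (weights w′) γ)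
               (*-congˡ (trans (•ˢ-*ˢ (u zero j p) (separated (without u j)) (weights w′) γ)
                 (*-congˡ (separated-*-weights (without u j) w′ γ (ℕ.suc-injective l)))))))
             (regroup (sign j) (u zero j p) (w zero q) (D j))) ⟩
      (∑ λ j → (sign j * D j) * (u zero j p * w zero q)) ∎

  -- Two sums over the same index i, one up to m and one up to n. The terms beyond the smaller bound
  -- vanish; the common terms are described by Z through the complements l = n - i and j = m - i.
  convolve-truncate : ∀ m n {P Q : ℕ → ℕ → Carrier} (Z : ℕ → ℕ → Carrier) →
    (∀ i j l → i ℕ.+ j ≡ m → i ℕ.+ l ≡ n → P i j ≈ Z l j) → (∀ i j → n < i → P i j ≈ 0#) →
    (∀ i j l → i ℕ.+ j ≡ m → i ℕ.+ l ≡ n → Q i l ≈ Z l j) → (∀ i l → m < i → Q i l ≈ 0#) →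
    convolve m P ≈ convolve n Q
  convolve-truncate zero    n       Z p p₀ q q₀ = trans (p 0 0 n ≡.refl ≡.refl)
    (sym (trans (convolve-first n (λ i l → q₀ (suc i) l z<s)) (q 0 0 n ≡.refl ≡.refl)))
  convolve-truncate (suc m) zero {P} Z p p₀ q q₀ = trans (convolve-first (suc m) {P} (λ i j → p₀ (suc i) j z<s))
    (trans (p 0 (suc m) 0 ≡.refl ≡.refl) (sym (q 0 (suc m) 0 ≡.refl ≡.refl)))
  convolve-truncate (suc m) (suc n) Z p p₀ q q₀ = +-cong
    (trans (p 0 (suc m) (suc n) ≡.refl ≡.refl) (sym (q 0 (suc m) (suc n) ≡.refl ≡.refl)))
    (convolve-truncate m n Z
      (λ i j l e e′ → p (suc i) j l (≡.cong suc e) (≡.cong suc e′)) (λ i j n<i → p₀ (suc i) j (s<s n<i))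
      (λ i j l e e′ → q (suc i) j l (≡.cong suc e) (≡.cong suc e′)) (λ i l m<i → q₀ (suc i) l (s<s m<i)))

  -- D is a series in two sets of variables with exponents γ and α; f multiplies in the first set
  -- and v in the second, so the order is immaterial.
  *ˢ-exchange : ∀ f v (D : List ℕ → Series) α γ →
    (f *ˢ (λ γ′ → (v *ˢ D γ′) α)) γ ≈ (v *ˢ (λ α′ → (f *ˢ (λ γ′ → D γ′ α′)) γ)) α
  *ˢ-exchange f v D α []      = sym (*ˢ-•ˢ (f []) v (D []) α)
  *ˢ-exchange f v D α (n ∷ γ) = begin
    (f *ˢ (λ γ′ → (v *ˢ D γ′) α)) (n ∷ γ)
      ≈⟨ *ˢ-∷ f (λ γ′ → (v *ˢ D γ′) α) n γ ⟩
    convolve n (λ i j → (f at i *ˢ (λ γ′ → (v *ˢ D (j ∷ γ′)) α)) γ)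
      ≈⟨ convolve-cong n (λ i j → *ˢ-exchange (f at i) v (λ γ′ → D (j ∷ γ′)) α γ) ⟩
    convolve n (λ i j → (v *ˢ (λ α′ → (f at i *ˢ (λ γ′ → D (j ∷ γ′) α′)) γ)) α)
      ≈⟨ *ˢ-convolve v n (λ i j α′ → (f at i *ˢ (λ γ′ → D (j ∷ γ′) α′)) γ) α ⟨
    (v *ˢ (λ α′ → convolve n (λ i j → (f at i *ˢ (λ γ′ → D (j ∷ γ′) α′)) γ))) α
      ≈⟨ *ˢ-cong {v} (λ _ → refl) (λ α′ → *ˢ-∷ f (λ γ′ → D γ′ α′) n γ) α ⟨
    (v *ˢ (λ α′ → (f *ˢ (λ γ′ → D γ′ α′)) (n ∷ γ))) α ∎

  -- V g is a family of series with V g = ∑_b y₁ᵇ V(g - b)(y₂, y₃, …), such as the complete functions.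
  record ShiftFamily (V : ℕ → Series) : Set b where
    field
      shifted : ∀ g b α → V (b ℕ.+ g) (b ∷ α) ≈ V g α
      beyond  : ∀ g b α → g < b → V g (b ∷ α) ≈ 0#

  hˢ-+ : ∀ a b α → hˢ (+ (b ℕ.+ a)) (b ∷ α) ≈ hˢ (+ a) α
  hˢ-+ a zero    α = refl
  hˢ-+ a (suc b) α = hˢ-+ a b α

  hˢ-beyond : ∀ a b α → a < b → hˢ (+ a) (b ∷ α) ≈ 0#
  hˢ-beyond zero    (suc b) α a<b       = refl
  hˢ-beyond (suc a) (suc b) α (s<s a<b) = hˢ-beyond a b α a<b

  -- Taking the coefficient of y₁ᵃ in the rows is multiplication by h_a in the row indices.
  Det-shift : ∀ {n} (V : Fin n → Fin n → ℕ → Series) → (∀ i j → ShiftFamily (V i j)) → ∀ a α γ → length γ ≡ n →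
    S.Det (λ i j → V i j (nth γ (toℕ i))) (a ∷ α) ≈
    (hˢ (+ a) *ˢ (λ γ′ → S.Det (λ i j → V i j (nth γ′ (toℕ i))) α)) γ
  Det-shift {zero} V shifts a α [] l = trans (Detˢ-empty-at _ (a ∷ α)) (trans (split a) (*-congˡ (sym (Detˢ-empty-at _ α))))
    where
    split : ∀ a → 1ˢ (a ∷ α) ≈ hˢ (+ a) [] * 1ˢ α
    split zero    = sym (*-identityˡ _)
    split (suc a) = sym (zeroˡ _)
  Det-shift {suc n} V shifts a α (g ∷ γ) l = begin
    S.Det (λ i j → V i j (nth (g ∷ γ) (toℕ i))) (a ∷ α)
      ≈⟨ Detˢ-expand-at _ (a ∷ α) ⟩
    (∑ λ j → sign j * (V zero j g *ˢ D j γ) (a ∷ α))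
      ≈⟨ ∑-cong (λ j → *-congˡ (*ˢ-∷ (V zero j g) (D j γ) a α)) ⟩
    (∑ λ j → sign j * convolve a (λ b c → (V zero j g at b *ˢ D j γ at c) α))
      -- On the left b is the power of y₁ taken from the first row, on the right it is the exponent
      -- of x₁ taken from h_a. The other rows receive c = a - b, and the first row is left with
      -- index c′ = g - b. Induction turns the coefficient of y₁ᶜ in the minor into multiplication
      -- by h_c.
      ≈⟨ ∑-cong (λ j → *-congˡ (convolve-truncate a g (λ c′ c → (V zero j c′ *ˢ D j γ at c) α)
           (λ { b c c′ e ≡.refl → *ˢ-cong {g = D j γ at c} (ShiftFamily.shifted (shifts zero j) c′ b) (λ _ → refl) α })
           (λ b c g<b → trans (*ˢ-cong {g = D j γ at c} (λ α → ShiftFamily.beyond (shifts zero j) g b α g<b) (λ _ → refl) α) (0ˢ-*ˢ (D j γ at c) α))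
           (λ { b c c′ ≡.refl e → trans
               (*ˢ-cong {g = F j c′} (hˢ-+ c b) (λ _ → refl) γ)
               (trans (*ˢ-exchange (hˢ (+ c)) (V zero j c′) (D j) α γ)
               (*ˢ-cong {V zero j c′} (λ _ → refl) (λ α′ → sym (Det-shift (λ r s → V (suc r) (punchIn j s)) (λ r s → shifts (suc r) (punchIn j s)) c α′ γ (ℕ.suc-injective l))) α)) })
           (λ b c′ a<b → trans (*ˢ-cong {g = F j c′} (λ γ′ → hˢ-beyond a b γ′ a<b) (λ _ → refl) γ) (0ˢ-*ˢ (F j c′) γ)))) ⟩
    (∑ λ j → sign j * convolve g (λ b c′ → (hˢ (+ a) at b *ˢ F j c′) γ))
      ≈⟨ ∑-cong (λ j → convolve-*ˡ g (sign j) _) ⟩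
    (∑ λ j → convolve g (λ b c′ → sign j * (hˢ (+ a) at b *ˢ F j c′) γ))
      ≈⟨ convolve-∑ g _ ⟨
    convolve g (λ b c′ → ∑ λ j → sign j * (hˢ (+ a) at b *ˢ F j c′) γ)
      ≈⟨ convolve-cong g (λ b c′ → term b c′) ⟨
    convolve g (λ b c′ → (hˢ (+ a) at b *ˢ (λ γ′ → S.Det (λ i j → V i j (nth (c′ ∷ γ′) (toℕ i))) α)) γ)
      ≈⟨ *ˢ-∷ (hˢ (+ a)) (λ γ′ → S.Det (λ i j → V i j (nth γ′ (toℕ i))) α) g γ ⟨
    (hˢ (+ a) *ˢ (λ γ′ → S.Det (λ i j → V i j (nth γ′ (toℕ i))) α)) (g ∷ γ) ∎
    where
    D : Fin (suc n) → List ℕ → Series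
    D j γ = S.Det (λ r s → V (suc r) (punchIn j s) (nth γ (toℕ r)))
    F : Fin (suc n) → ℕ → Series
    F j c γ = (V zero j c *ˢ D j γ) α
    term : ∀ b c′ → (hˢ (+ a) at b *ˢ (λ γ′ → S.Det (λ i j → V i j (nth (c′ ∷ γ′) (toℕ i))) α)) γ ≈
                    ∑ λ j → sign j * (hˢ (+ a) at b *ˢ F j c′) γ
    term b c′ = begin
      (f *ˢ (λ γ′ → S.Det (λ i j → V i j (nth (c′ ∷ γ′) (toℕ i))) α)) γ
        ≈⟨ *ˢ-comm f _ γ ⟩
      ((λ γ′ → S.Det (λ i j → V i j (nth (c′ ∷ γ′) (toℕ i))) α) *ˢ f) γ
        ≈⟨ *ˢ-cong {g = f} (λ γ′ → Detˢ-expand-at _ α) (λ _ → refl) γ ⟩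
      ((λ γ′ → ∑ λ j → sign j * F j c′ γ′) *ˢ f) γ
        ≈⟨ *ˢ-∑ʳ (λ j → sign j •ˢ F j c′) f γ ⟩
      (∑ λ j → ((sign j •ˢ F j c′) *ˢ f) γ)
        ≈⟨ ∑-cong (λ j → trans (•ˢ-*ˢ (sign j) (F j c′) f γ) (*-congˡ (*ˢ-comm (F j c′) f γ))) ⟩
      (∑ λ j → sign j * (f *ˢ F j c′) γ) ∎
      where
      f = hˢ (+ a) at b

  completes : List ℕ → Λ
  completes []      = 1ᴸ
  completes (a ∷ α) = SymmetricFunctions._*_ k (h (+ a)) (completes α)

  -- One application of `Det-shift` for each y, until only the constant terms of the families
  -- remain.
  Det-shifts : ∀ {n} (V : Fin n → Fin n → ℕ → Series) → (∀ i j → ShiftFamily (V i j)) → ∀ α γ → length γ ≡ n →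
    S.Det (λ i j → V i j (nth γ (toℕ i))) α ≈ (series (completes α) *ˢ separated (λ i j g → V i j g [])) γ
  Det-shifts V shifts [] γ l = trans (Constant.φ-Det _) (sym (*ˢ-identityˡ (separated (λ i j g → V i j g [])) γ))
  Det-shifts {n} V shifts (a ∷ α) γ l = begin
    S.Det (λ i j → V i j (nth γ (toℕ i))) (a ∷ α)
      ≈⟨ Det-shift V shifts a α γ l ⟩
    (hˢ (+ a) *ˢ (λ γ′ → S.Det (λ i j → V i j (nth γ′ (toℕ i))) α)) γ
      ≈⟨ *ˢ-cong-at {hˢ (+ a)} γ (λ _ _ → refl) (λ γ′ e → Det-shifts V shifts α γ′ (≡.trans e l)) ⟩
    (hˢ (+ a) *ˢ (series (completes α) *ˢ separated (λ i j g → V i j g []))) γ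
      ≈⟨ *ˢ-assoc (hˢ (+ a)) (series (completes α)) _ γ ⟨
    ((hˢ (+ a) *ˢ series (completes α)) *ˢ separated (λ i j g → V i j g [])) γ ∎

  total-punchIn : ∀ {n} (e : Fin (suc n) → ℕ) j →
                  total (List.tabulate e) ≡ e j ℕ.+ total (List.tabulate (λ i → e (punchIn j i)))
  total-punchIn         e zero    = ≡.refl
  total-punchIn {suc n} e (suc j) = ≡.trans (≡.cong (e zero ℕ.+_) (total-punchIn (λ i → e (suc i)) j))
    (exchange (e zero) (e (suc j)) _)
    where
    open +-*-Solver
    exchange : ∀ x y z → x ℕ.+ (y ℕ.+ z) ≡ y ℕ.+ (x ℕ.+ z)
    exchange = solve 3 (λ x y z → x :+ (y :+ z) := y :+ (x :+ z)) ≡.refl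

  -- Each term of the determinant uses every column once, so the orders e j of the columns add up to
  -- the same total for every permutation. The next two lemmas rest on the same count.
  separated-order : ∀ {n} (e : Fin n → ℕ) (u : Fin n → Fin n → Row) → (∀ i j g → g < e j → u i j g ≈ 0#) →
                    ∀ γ → length γ ≡ n → total γ < total (List.tabulate e) → separated u γ ≈ 0#
  separated-order {suc n} e u below (g ∷ γ) l t = trans (separated-∷ u g γ) (∑-zero λ j → term j)
    where
    term : ∀ j → sign j * (u zero j g * separated (without u j) γ) ≈ 0#
    term j with g ℕ.<? e j
    ... | yes g<e = term-zeroˡ j (below zero j g g<e)
    ... | no  g≮e = term-zeroʳ j (separated-order (λ i → e (punchIn j i)) (without u j) (λ r s → below (suc r) (punchIn j s)) γ (ℕ.suc-injective l)
      (ℕ.+-cancelˡ-< g _ _ (ℕ.<-≤-trans t (ℕ.≤-trans (ℕ.≤-reflexive (total-punchIn e j)) (ℕ.+-monoˡ-≤ _ (ℕ.≮⇒≥ g≮e))))))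

  separated-homogeneous : ∀ {n} (e : Fin n → ℕ) (u : Fin n → Fin n → Row) → (∀ i j g → g ≢ e j → u i j g ≈ 0#) →
                          ∀ γ → length γ ≡ n → total γ ≢ total (List.tabulate e) → separated u γ ≈ 0#
  separated-homogeneous {zero}  e u only []      l t = contradiction ≡.refl t
  separated-homogeneous {suc n} e u only (g ∷ γ) l t = trans (separated-∷ u g γ) (∑-zero λ j → term j)
    where
    term : ∀ j → sign j * (u zero j g * separated (without u j) γ) ≈ 0#
    term j with g ℕ.≟ e j
    ... | no  g≢e = term-zeroˡ j (only zero j g g≢e)
    ... | yes ≡.refl = term-zeroʳ j (separated-homogeneous (λ i → e (punchIn j i)) (without u j) (λ r s → only (suc r) (punchIn j s)) γ (ℕ.suc-injective l)
      (λ t′ → t (≡.trans (≡.cong (g ℕ.+_) t′) (≡.sym (total-punchIn e j)))))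

  -- The columns of u have order at least e j, and those of v consist of the term of degree e j
  -- alone. Up to the total of e a higher term in one column would force a term below its order in
  -- another.
  separated-lowest : ∀ {n} (e : Fin n → ℕ) (u v : Fin n → Fin n → Row) →
    (∀ i j g → g < e j → u i j g ≈ 0#) → (∀ i j g → g ≢ e j → v i j g ≈ 0#) → (∀ i j → u i j (e j) ≈ v i j (e j)) →
    ∀ γ → length γ ≡ n → total γ ≤ total (List.tabulate e) → separated u γ ≈ separated v γ
  separated-lowest {zero}  e u v below only equal []      l t = Det-cong λ ()
  separated-lowest {suc n} e u v below only equal (g ∷ γ) l t = trans (separated-∷ u g γ)
    (trans (∑-cong λ j → term j) (sym (separated-∷ v g γ)))
    where
    term : ∀ j → sign j * (u zero j g * separated (without u j) γ) ≈ sign j * (v zero j g * separated (without v j) γ)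
    term j with ℕ.<-cmp g (e j)
    ... | tri< g<e g≢e _ = trans (term-zeroˡ j (below zero j g g<e)) (sym (term-zeroˡ j (only zero j g g≢e)))
    ... | tri≈ _ ≡.refl _ = term-cong j (equal zero j)
      (separated-lowest (λ i → e (punchIn j i)) (without u j) (without v j) (λ r s → below (suc r) (punchIn j s)) (λ r s → only (suc r) (punchIn j s))
        (λ r s → equal (suc r) (punchIn j s)) γ (ℕ.suc-injective l)
        (ℕ.+-cancelˡ-≤ g _ _ (ℕ.≤-trans t (ℕ.≤-reflexive (total-punchIn e j)))))
    ... | tri> _ g≢e e<g = trans
      (term-zeroʳ j (separated-order (λ i → e (punchIn j i)) (without u j) (λ r s → below (suc r) (punchIn j s)) γ (ℕ.suc-injective l)
        (ℕ.+-cancelˡ-< g _ _ (ℕ.≤-<-trans t (ℕ.≤-<-trans (ℕ.≤-reflexive (total-punchIn e j)) (ℕ.+-monoˡ-< _ e<g))))))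
      (sym (term-zeroˡ j (only zero j g g≢e)))

-- Partitions and their shifts by the staircase.

nth-tabulate : ∀ {n} (f : Fin n → ℕ) i → nth (List.tabulate f) (toℕ i) ≡ f i
nth-tabulate f zero    = ≡.refl
nth-tabulate f (suc i) = nth-tabulate (f ∘ suc) i

total-tabulate-+ : ∀ {n} (f g : Fin n → ℕ) →
                   total (List.tabulate (λ i → f i ℕ.+ g i)) ≡ total (List.tabulate f) ℕ.+ total (List.tabulate g)
total-tabulate-+ {zero}  f g = ≡.refl
total-tabulate-+ {suc n} f g = ≡.trans (≡.cong ((f zero ℕ.+ g zero) ℕ.+_) (total-tabulate-+ (f ∘ suc) (g ∘ suc)))
  (interchange (f zero) (g zero) _ _)
  where
  open +-*-Solver
  interchange : ∀ x y z w → (x ℕ.+ y) ℕ.+ (z ℕ.+ w) ≡ (x ℕ.+ z) ℕ.+ (y ℕ.+ w)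
  interchange = solve 4 (λ x y z w → (x :+ y) :+ (z :+ w) := (x :+ z) :+ (y :+ w)) ≡.refl

total-tabulate-nth : ∀ n α → length α ≤ n → total (List.tabulate {n = n} (λ i → nth α (toℕ i))) ≡ total α
total-tabulate-nth zero    []      _         = ≡.refl
total-tabulate-nth (suc n) []      _         = total-tabulate-nth n [] z≤n
total-tabulate-nth (suc n) (x ∷ α) (s≤s l≤n) = ≡.cong (x ℕ.+_) (total-tabulate-nth n α l≤n)

nth-beyond : ∀ α i → length α ≤ i → nth α i ≡ 0
nth-beyond []      i       l≤i       = ≡.refl
nth-beyond (x ∷ α) (suc i) (s≤s l≤i) = nth-beyond α i l≤i

nth-decreasing : ∀ {α} → Linked _≥_ α → ∀ i j → i ≤ j → nth α j ≤ nth α i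
nth-decreasing {[]}        _   i       j       _ = z≤n
nth-decreasing {x ∷ α}     dec zero    zero    _ = ℕ.≤-refl
nth-decreasing {x ∷ []}    dec zero    (suc j) _ = z≤n
nth-decreasing {x ∷ y ∷ α} (x≥y ∷ dec) zero (suc j) _ = ℕ.≤-trans (nth-decreasing dec zero j z≤n) x≥y
nth-decreasing {x ∷ []}    dec (suc i) (suc j) _ = z≤n
nth-decreasing {x ∷ y ∷ α} (x≥y ∷ dec) (suc i) (suc j) (s≤s i≤j) = nth-decreasing dec i j i≤j

size : Partition → ℕ
size ν = total (parts ν)

ℓ≤size : ∀ ν → ℓ ν ≤ size ν
ℓ≤size ν = go (positive ν)
  where
  go : ∀ {α} → All (0 <_) α → length α ≤ total α
  go []            = z≤n
  go (0<x ∷ 0<α)   = ℕ.+-mono-≤ 0<x (go 0<α)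

-- Everything from the first zero on is dropped; in a decreasing list these are just the trailing
-- zeros.
trim : List ℕ → List ℕ
trim []          = []
trim (zero ∷ _)  = []
trim (suc x ∷ α) = suc x ∷ trim α

private
  trim-sorted : ∀ {α} → Linked _≥_ α → Linked _≥_ (trim α)
  trim-sorted {[]}                 dec         = []
  trim-sorted {zero ∷ α}           dec         = []
  trim-sorted {suc x ∷ []}         dec         = [-]
  trim-sorted {suc x ∷ zero ∷ α}   dec         = [-]
  trim-sorted {suc x ∷ suc y ∷ α}  (x≥y ∷ dec) = x≥y ∷ trim-sorted dec

  trim-positive : ∀ α → All (0 <_) (trim α)
  trim-positive []          = []
  trim-positive (zero ∷ α)  = []
  trim-positive (suc x ∷ α) = z<s ∷ trim-positive α

toPartition : ∀ α → Linked _≥_ α → Partition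
toPartition α dec = record { parts = trim α ; sorted = trim-sorted dec ; positive = trim-positive α }

nth-trim : ∀ {α} → Linked _≥_ α → ∀ i → nth (trim α) i ≡ nth α i
nth-trim {[]}        dec i       = ≡.refl
nth-trim {zero ∷ α}  dec i       = ≡.sym (ℕ.n≤0⇒n≡0 (nth-decreasing dec 0 i z≤n))
nth-trim {suc x ∷ α} dec zero    = ≡.refl
nth-trim {suc x ∷ α} dec (suc i) = nth-trim {α} (Linked.tail dec) i

length-trim : ∀ α → length (trim α) ≤ length α
length-trim []          = z≤n
length-trim (zero ∷ α)  = z≤n
length-trim (suc x ∷ α) = s≤s (length-trim α)

parts-equal : ∀ {α γ} → All (0 <_) α → All (0 <_) γ → (∀ i → nth α i ≡ nth γ i) → α ≡ γ
parts-equal []         []         e = ≡.refl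
parts-equal []         (0<y ∷ _)  e = contradiction (e 0) (ℕ.<⇒≢ 0<y)
parts-equal (0<x ∷ _)  []         e = contradiction (≡.sym (e 0)) (ℕ.<⇒≢ 0<x)
parts-equal (_ ∷ 0<α)  (_ ∷ 0<γ)  e = ≡.cong₂ _∷_ (e 0) (parts-equal 0<α 0<γ (λ i → e (suc i)))

shiftedParts : Partition → ∀ n → Fin n → ℕ
shiftedParts ν n j = part ν (toℕ j) ℕ.+ staircase n j

-- ν + δ
strict : Partition → ℕ → List ℕ
strict ν n = List.tabulate (shiftedParts ν n)

total-strict : ∀ ν n → ℓ ν ≤ n → total (strict ν n) ≡ size ν ℕ.+ total (List.tabulate (staircase n))
total-strict ν n l = ≡.trans (total-tabulate-+ (λ j → part ν (toℕ j)) (staircase n))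
  (≡.cong (ℕ._+ total (List.tabulate (staircase n))) (total-tabulate-nth n (parts ν) l))

private
  -- Makes the truncated subtraction in `unstair` exact.
  strict-length : ∀ {x γ} → Linked _>_ (x ∷ γ) → length γ ≤ x
  strict-length {x} {[]}    _           = z≤n
  strict-length {x} {y ∷ γ} (x>y ∷ dec) = ℕ.≤-trans (s≤s (strict-length dec)) x>y

  unstair : List ℕ → List ℕ
  unstair []      = []
  unstair (x ∷ γ) = x ∸ length γ ∷ unstair γ

  unstair-sorted : ∀ {γ} → Linked _>_ γ → Linked _≥_ (unstair γ)
  unstair-sorted {[]}        []          = []
  unstair-sorted {x ∷ []}    [-]         = [-]
  unstair-sorted {x ∷ y ∷ γ} (x>y ∷ dec) = ℕ.∸-monoˡ-≤ (suc (length γ)) x>y ∷ unstair-sorted dec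

  length-unstair : ∀ γ → length (unstair γ) ≡ length γ
  length-unstair []      = ≡.refl
  length-unstair (x ∷ γ) = ≡.cong suc (length-unstair γ)

  unstair-strict : ∀ n {γ} → Linked _>_ γ → length γ ≡ n →
                   γ ≡ List.tabulate {n = n} (λ j → nth (unstair γ) (toℕ j) ℕ.+ staircase n j)
  unstair-strict zero    {[]}    dec l = ≡.refl
  unstair-strict (suc n) {x ∷ γ} dec ≡.refl = ≡.cong₂ _∷_
    (≡.sym (ℕ.m∸n+n≡m (strict-length dec))) (unstair-strict n (Linked.tail dec) ≡.refl)

unstrict : ∀ n γ → Linked _>_ γ → length γ ≡ n →
           ∃[ α ] Σ[ dec ∈ Linked _≥_ α ] length α ≡ n × γ ≡ strict (toPartition α dec) n
unstrict n γ dec l = unstair γ , unstair-sorted dec , ≡.trans (length-unstair γ) l ,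
  ≡.trans (unstair-strict n dec l) (List.tabulate-cong λ j →
    ≡.cong (ℕ._+ staircase n j) (≡.sym (nth-trim (unstair-sorted dec) (toℕ j))))

-- A finite search range for the elimination of Schur functions. It contains unsorted lists and
-- lists of large total as well, which are skipped there.
boundedLists : ℕ → ℕ → List (List ℕ)
boundedLists b zero    = [] ∷ []
boundedLists b (suc n) = List.cartesianProductWith _∷_ (List.upTo (suc b)) (boundedLists b n)

∈-boundedLists : ∀ b α → total α ≤ b → α ∈ boundedLists b (length α)
∈-boundedLists b []      t = here ≡.refl
∈-boundedLists b (x ∷ α) t = ∈-cartesianProductWith⁺ _∷_
  (∈-upTo⁺ (s≤s (ℕ.≤-trans (ℕ.m≤m+n x (total α)) t))) (∈-boundedLists b α (ℕ.≤-trans (ℕ.m≤n+m (total α) x) t))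

-- Series that alternate in their exponents.

module AlternatingSeries {a b} (k : CommutativeRing a b) where
  open CommutativeRing k hiding (zero)
  open RingProperties ring
  open SymmetricFunctions k hiding (_+_; _*_; -_; _-_)
  open SeriesRing k
  open Antidiagonal k
  open Determinant k
  open Separated k using (separated)
  open SetoidReasoning setoid

  -- The sign rule alone would give only 2f = 0 at equal exponents, and 2 need not be cancellable in
  -- k.
  AntisymmetricAtHead : ℕ → Series → Set b
  AntisymmetricAtHead zero    f = ⊤
  AntisymmetricAtHead (suc n) f =
    (∀ x y γ → length γ ≡ n → f (x ∷ y ∷ γ) ≈ - f (y ∷ x ∷ γ)) × (∀ x γ → length γ ≡ n → f (x ∷ x ∷ γ) ≈ 0#)

  AlternatingIn : ℕ → Series → Set b
  AlternatingIn zero    f = ⊤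
  AlternatingIn (suc n) f = (∀ x → AlternatingIn n (f at x)) × AntisymmetricAtHead n f

  alternatingIn-cong : ∀ n {f g} → f ≈[ n ] g → AlternatingIn n f → AlternatingIn n g
  alternatingIn-cong zero    p alt = tt
  alternatingIn-cong (suc n) {f} {g} p (rest , head) =
    (λ x → alternatingIn-cong n (λ γ l → p (x ∷ γ) (≡.cong suc l)) (rest x)) , head′ n p head
    where
    head′ : ∀ n {f g} → f ≈[ suc n ] g → AntisymmetricAtHead n f → AntisymmetricAtHead n g
    head′ zero    p h = tt
    head′ (suc n) p (anti , equal) =
      (λ x y γ l → trans (sym (p _ (≡.cong (λ l → suc (suc l)) l))) (trans (anti x y γ l) (-‿cong (p _ (≡.cong (λ l → suc (suc l)) l))))) ,
      (λ x γ l → trans (sym (p _ (≡.cong (λ l → suc (suc l)) l))) (equal x γ l))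

  alternatingIn-+ : ∀ n {f g} → AlternatingIn n f → AlternatingIn n g → AlternatingIn n (f +ˢ g)
  alternatingIn-+ zero    F G = tt
  alternatingIn-+ (suc n) (F , F₀) (G , G₀) = (λ x → alternatingIn-+ n (F x) (G x)) , head n F₀ G₀
    where
    head : ∀ n {f g} → AntisymmetricAtHead n f → AntisymmetricAtHead n g → AntisymmetricAtHead n (f +ˢ g)
    head zero    _       _         = tt
    head (suc n) (p , z) (p′ , z′) =
      (λ x y γ l → trans (+-cong (p x y γ l) (p′ x y γ l)) (-‿+-comm _ _)) ,
      (λ x γ l → trans (+-cong (z x γ l) (z′ x γ l)) (+-identityʳ 0#))

  alternatingIn-convolve : ∀ n m {P : ℕ → ℕ → Series} → (∀ i j → AlternatingIn n (P i j)) →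
                           AlternatingIn n (λ γ → convolve m (λ i j → P i j γ))
  alternatingIn-convolve n zero    p = p 0 0
  alternatingIn-convolve n (suc m) p = alternatingIn-+ n (p 0 (suc m)) (alternatingIn-convolve n m (λ i j → p (suc i) j))

  convolve-neg : ∀ n F → convolve n (λ i j → - F i j) ≈ - convolve n F
  convolve-neg zero    F = refl
  convolve-neg (suc n) F = trans (+-congˡ (convolve-neg n _)) (-‿+-comm _ _)

  -- The terms for ((i, j), (p, q)) and ((p, q), (i, j)) cancel. The diagonal ones have no partner
  -- and need their own hypothesis.
  convolve-antisymmetric : ∀ n (G : ℕ → ℕ → ℕ → ℕ → Carrier) → (∀ i j → G i j i j ≈ 0#) →
    (∀ i j p q → G i j p q ≈ - G p q i j) → convolve n (λ i j → convolve n (G i j)) ≈ 0#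
  convolve-antisymmetric zero    G diagonal anti = diagonal 0 0
  convolve-antisymmetric (suc n) G diagonal anti = begin
    (G 0 N 0 N + A) + convolve n (λ i j → G (suc i) j 0 N + convolve n (λ p q → G (suc i) j (suc p) q))
      ≈⟨ +-cong (trans (+-congʳ (diagonal 0 N)) (+-identityˡ A)) (convolve-+ n _ _) ⟩
    A + (convolve n (λ i j → G (suc i) j 0 N) + convolve n (λ i j → convolve n (λ p q → G (suc i) j (suc p) q)))
      ≈⟨ +-congˡ (+-cong (trans (convolve-cong n (λ i j → anti (suc i) j 0 N)) (convolve-neg n _))
           (convolve-antisymmetric n (λ i j p q → G (suc i) j (suc p) q) (λ i j → diagonal (suc i) j) (λ i j p q → anti (suc i) j (suc p) q))) ⟩
    A + (- A + 0#)
      ≈⟨ +-congˡ (+-identityʳ (- A)) ⟩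
    A + - A
      ≈⟨ -‿inverseʳ A ⟩
    0# ∎
    where
    N = suc n
    A = convolve n (λ p q → G 0 N (suc p) q)

  *ˢ-neg : ∀ f g → f *ˢ (-ˢ g) ≈ˢ -ˢ (f *ˢ g)
  *ˢ-neg f g α = sym (RingProperties.-‿distribʳ-* (CommutativeRing.ring seriesCommutativeRing) f g α)

  private
    *ˢ-∷∷ : ∀ f g x y γ → (f *ˢ g) (x ∷ y ∷ γ) ≈
            convolve x (λ i j → convolve y (λ p q → (f at i at p *ˢ g at j at q) γ))
    *ˢ-∷∷ f g x y γ = trans (*ˢ-∷ f g x (y ∷ γ)) (convolve-cong x (λ i j → *ˢ-∷ (f at i) (g at j) y γ))

  -- Exchanging two exponents of the product exchanges two exponents of f and of g in every term: f
  -- keeps its value and g changes sign. At equal exponents the terms cancel in pairs, or vanish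
  -- because g does.
  symmetric-*-alternating : ∀ n {f g} → (∀ {α γ} → α ↭ γ → f α ≈ f γ) → AlternatingIn n g → AlternatingIn n (f *ˢ g)
  symmetric-*-alternating zero    sym-f alt = tt
  symmetric-*-alternating (suc n) {f} {g} sym-f (rest , head) =
    (λ x → alternatingIn-cong n (λ γ _ → sym (*ˢ-∷ f g x γ))
      (alternatingIn-convolve n x (λ i j → symmetric-*-alternating n (λ r → sym-f (prep i r)) (rest j)))) ,
    head′ n head
    where
    head′ : ∀ n → AntisymmetricAtHead n g → AntisymmetricAtHead n (f *ˢ g)
    head′ zero    _             = tt
    head′ (suc n) (anti , equal) = antisymmetric , vanishing
      where
      exchange : ∀ i j p q γ → length γ ≡ n →
                 (f at i at p *ˢ g at j at q) γ ≈ - (f at p at i *ˢ g at q at j) γ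
      exchange i j p q γ l = trans
        (*ˢ-cong-at {f at i at p} {f at p at i} {g at j at q} {g′ = -ˢ (g at q at j)} γ (λ ε _ → sym-f (swap i p Perm.refl)) (λ ε e → anti j q ε (≡.trans e l)))
        (*ˢ-neg (f at p at i) (g at q at j) γ)
      antisymmetric : ∀ x y γ → length γ ≡ n → (f *ˢ g) (x ∷ y ∷ γ) ≈ - (f *ˢ g) (y ∷ x ∷ γ)
      antisymmetric x y γ l = begin
        (f *ˢ g) (x ∷ y ∷ γ)
          ≈⟨ *ˢ-∷∷ f g x y γ ⟩
        convolve x (λ i j → convolve y (λ p q → (f at i at p *ˢ g at j at q) γ))
          ≈⟨ convolve-comm x y _ ⟩
        convolve y (λ p q → convolve x (λ i j → (f at i at p *ˢ g at j at q) γ))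
          ≈⟨ convolve-cong y (λ p q → trans (convolve-cong x (λ i j → exchange i j p q γ l)) (convolve-neg x _)) ⟩
        convolve y (λ p q → - convolve x (λ i j → (f at p at i *ˢ g at q at j) γ))
          ≈⟨ convolve-neg y _ ⟩
        - convolve y (λ p q → convolve x (λ i j → (f at p at i *ˢ g at q at j) γ))
          ≈⟨ -‿cong (*ˢ-∷∷ f g y x γ) ⟨
        - (f *ˢ g) (y ∷ x ∷ γ) ∎
      vanishing : ∀ x γ → length γ ≡ n → (f *ˢ g) (x ∷ x ∷ γ) ≈ 0#
      vanishing x γ l = trans (*ˢ-∷∷ f g x x γ) (convolve-antisymmetric x _
        (λ i j → *ˢ-vanish {f at i at i} {g at j at j} γ (λ ε ε′ _ e _ → trans (*-congˡ (equal j ε′ (≡.trans e l))) (zeroʳ _)))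
        (λ i j p q → exchange i j p q γ l))

  module _ {I : Set} (row : ℕ → I → Carrier) where
    open Alternating I

    rows : ∀ n → List ℕ → Vec Row n
    rows zero    γ       = []
    rows (suc n) []      = row 0 ∷ rows n []
    rows (suc n) (x ∷ γ) = row x ∷ rows n γ

    lookup-rows : ∀ n γ i → lookup (rows n γ) i ≡ row (nth γ (toℕ i))
    lookup-rows (suc n) []      zero    = ≡.refl
    lookup-rows (suc n) []      (suc i) = lookup-rows n [] i
    lookup-rows (suc n) (x ∷ γ) zero    = ≡.refl
    lookup-rows (suc n) (x ∷ γ) (suc i) = lookup-rows n γ i

    alternatingForm-rows : ∀ n (Φ : Vec Row n → Carrier) → AlternatingForm n Φ → AlternatingIn n (λ γ → Φ (rows n γ))
    alternatingForm-rows zero    Φ alt = tt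
    alternatingForm-rows (suc n) Φ alt = (λ x → alternatingForm-rows n (λ v → Φ (row x ∷ v)) (proj₁ (proj₂ alt) (row x))) , head n Φ alt
      where
      head : ∀ n (Φ : Vec Row (suc n) → Carrier) → AlternatingForm (suc n) Φ → AntisymmetricAtHead n (λ γ → Φ (rows (suc n) γ))
      head zero    Φ alt = tt
      head (suc n) Φ alt = (λ x y γ _ → alternating-swap Φ alt (row x) (row y) (rows n γ)) ,
                           (λ x γ _ → proj₂ (proj₂ alt) (row x) (rows n γ))

  -- All rows are evaluations of the same columns, so exchanging exponents exchanges rows of the
  -- determinant.
  separated-alternating : ∀ {n} (v : Fin n → ℕ → Carrier) → AlternatingIn n (separated (λ i j → v j))
  separated-alternating {n} v = alternatingIn-cong n
    (λ γ _ → Det-cong λ i j → reflexive (≡.cong (λ (r : Fin n → Carrier) → r j) (lookup-rows row n γ i)))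
    (alternatingForm-rows row n _ (Alternating.Det-alternating (Fin n) n (λ j → j)))
    where
    row : ℕ → Fin n → Carrier
    row x j = v j x

  -- Only vanishing is transported along the permutation, so its sign need not be tracked.
  alternating-↭ : ∀ {n f} → AlternatingIn n f → ∀ {α γ} → α ↭ γ → length α ≡ n → f α ≈ 0# → f γ ≈ 0#
  alternating-↭ alt Perm.refl l z = z
  alternating-↭ {suc n} (rest , _) (prep x r) l z = alternating-↭ (rest x) r (ℕ.suc-injective l) z
  alternating-↭ {suc (suc n)} {f} (rest , (anti , _)) (swap {xs} {ys} x y r) l z = trans (anti y x ys l′)
    (trans (-‿cong (alternating-↭ (proj₁ (rest x) y) r (ℕ.suc-injective (ℕ.suc-injective l)) z)) -0#≈0#)
    where
    l′ : length ys ≡ n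
    l′ = ≡.trans (≡.sym (↭-length r)) (ℕ.suc-injective (ℕ.suc-injective l))
  alternating-↭ alt (Perm.trans r r′) l z = alternating-↭ alt r′ (≡.trans (≡.sym (↭-length r)) l) (alternating-↭ alt r l z)

  alternating-sorted : ∀ {n f} → AlternatingIn n f → (∀ γ → Linked _>_ γ → length γ ≡ n → f γ ≈ 0#) →
                       ∀ γ → Linked _≥_ γ → length γ ≡ n → f γ ≈ 0#
  alternating-sorted {zero}              alt strictly [] [] l = strictly [] [] l
  alternating-sorted {suc n} {f} alt strictly γ dec l = split γ dec l
    where
    tails : ∀ γ → Linked _≥_ γ → Linked _>_ γ ⊎ (∀ n f → AlternatingIn n f → length γ ≡ n → f γ ≈ 0#)
    tails []          []    = inj₁ []
    tails (x ∷ [])    [-]   = inj₁ [-]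
    tails (x ∷ y ∷ γ) (x≥y ∷ dec) with tails (y ∷ γ) dec | x ℕ.≟ y
    ... | inj₂ z | _ = inj₂ λ { (suc n) f (rest , _) l → z n (f at x) (rest x) (ℕ.suc-injective l) }
    ... | inj₁ s | no  x≢y    = inj₁ (ℕ.≤∧≢⇒< x≥y (λ e → x≢y (≡.sym e)) ∷ s)
    ... | inj₁ s | yes ≡.refl = inj₂ λ { (suc (suc n)) f (_ , (_ , equal)) l → equal x γ (ℕ.suc-injective (ℕ.suc-injective l)) }
    split : ∀ γ → Linked _≥_ γ → length γ ≡ suc n → f γ ≈ 0#
    split γ dec l with tails γ dec
    ... | inj₁ s = strictly γ s l
    ... | inj₂ z = z (suc n) f alt l

  -- Sorting the exponents changes the coefficient by a sign at most; a sorted list is strictly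
  -- decreasing or has two equal neighbours, and then the coefficient is zero.
  alternating-zero : ∀ {n f} → AlternatingIn n f → (∀ γ → Linked _>_ γ → length γ ≡ n → f γ ≈ 0#) → f ≈[ n ] 0ˢ
  alternating-zero alt strictly γ l = alternating-↭ alt (sort-↭ γ) l′
    (alternating-sorted alt strictly (sort γ) (sort-↗ γ) l′)
    where l′ = ≡.trans (↭-length (sort-↭ γ)) l

-- Binomial coefficients with integer upper argument.

module Binomial where
  open ≡.≡-Reasoning
  open ℤSolver.+-*-Solver

  falling-suc : ∀ a n → falling (ℤ.suc a) (suc n) ≡ ℤ.suc a ℤ.* falling a n
  falling-suc a zero    = solve 1 (λ a → con (+ 1) :* (a :- con (+ 0)) := a :* con (+ 1)) ≡.refl (ℤ.suc a)
  falling-suc a (suc n) = begin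
    falling (ℤ.suc a) (suc n) ℤ.* (ℤ.suc a ℤ.- + suc n)
      ≡⟨ ≡.cong (ℤ._* (ℤ.suc a ℤ.- + suc n)) (falling-suc a n) ⟩
    ℤ.suc a ℤ.* falling a n ℤ.* (ℤ.suc a ℤ.- ℤ.suc (+ n))
      ≡⟨ solve 3 (λ a f n → (con (+ 1) :+ a) :* f :* ((con (+ 1) :+ a) :- (con (+ 1) :+ n)) := (con (+ 1) :+ a) :* (f :* (a :- n))) ≡.refl a (falling a n) (+ n) ⟩
    ℤ.suc a ℤ.* falling a (suc n) ∎

  falling-pascal : ∀ a n → falling (ℤ.suc a) (suc n) ≡ falling a (suc n) ℤ.+ + suc n ℤ.* falling a n
  falling-pascal a n = ≡.trans (falling-suc a n)
    (solve 3 (λ a f n → (con (+ 1) :+ a) :* f := f :* (a :- n) :+ (con (+ 1) :+ n) :* f) ≡.refl a (falling a n) (+ n))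

  falling-zero : ∀ a n → a < n → falling (+ a) n ≡ + 0
  falling-zero a (suc n) a<1+n with a ℕ.≟ n
  ... | yes ≡.refl = ≡.trans (≡.cong (falling (+ a) n ℤ.*_) (ℤ.+-inverseʳ (+ a))) (ℤ.*-zeroʳ (falling (+ a) n))
  ... | no  a≢n    = ≡.cong (ℤ._* (+ a ℤ.- + n)) (falling-zero a n (ℕ.≤∧≢⇒< (ℕ.s≤s⁻¹ a<1+n) a≢n))

  private
    -- The Pascal rule moves a up or down by one at the cost of (n + 1) · `falling a n`, which is
    -- divisible by (n + 1)! by induction on n. The start is a = 0, where the falling factorial
    -- vanishes.
    quotient : ∀ n a → ∃[ q ] falling a n ≡ q ℤ.* + (n !)
    quotient zero    a = + 1 , ≡.refl
    quotient (suc n) a = go a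
      where
      step : + suc n ℤ.* + (n !) ≡ + (suc n !)
      step = ≡.sym (ℤ.pos-* (suc n) (n !))
      up : ∀ a → ∃[ q ] falling a (suc n) ≡ q ℤ.* + (suc n !) → ∃[ q ] falling (ℤ.suc a) (suc n) ≡ q ℤ.* + (suc n !)
      up a (q , e) = q ℤ.+ p , (begin
        falling (ℤ.suc a) (suc n)
          ≡⟨ falling-pascal a n ⟩
        falling a (suc n) ℤ.+ + suc n ℤ.* falling a n
          ≡⟨ ≡.cong₂ (λ x y → x ℤ.+ + suc n ℤ.* y) e e′ ⟩
        q ℤ.* + (suc n !) ℤ.+ + suc n ℤ.* (p ℤ.* + (n !))
          ≡⟨ ≡.cong (λ x → q ℤ.* x ℤ.+ + suc n ℤ.* (p ℤ.* + (n !))) step ⟨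
        q ℤ.* (+ suc n ℤ.* + (n !)) ℤ.+ + suc n ℤ.* (p ℤ.* + (n !))
          ≡⟨ solve 4 (λ q p s f → q :* (s :* f) :+ s :* (p :* f) := (q :+ p) :* (s :* f)) ≡.refl q p (+ suc n) (+ (n !)) ⟩
        (q ℤ.+ p) ℤ.* (+ suc n ℤ.* + (n !))
          ≡⟨ ≡.cong ((q ℤ.+ p) ℤ.*_) step ⟩
        (q ℤ.+ p) ℤ.* + (suc n !) ∎)
        where
        p = proj₁ (quotient n a)
        e′ = proj₂ (quotient n a)
      down : ∀ a → ∃[ q ] falling (ℤ.suc a) (suc n) ≡ q ℤ.* + (suc n !) → ∃[ q ] falling a (suc n) ≡ q ℤ.* + (suc n !)
      down a (q , e) = q ℤ.- p , (begin
        falling a (suc n)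
          ≡⟨ solve 2 (λ x y → x := (x :+ y) :- y) ≡.refl (falling a (suc n)) (+ suc n ℤ.* falling a n) ⟩
        (falling a (suc n) ℤ.+ + suc n ℤ.* falling a n) ℤ.- + suc n ℤ.* falling a n
          ≡⟨ ≡.cong₂ (λ x y → x ℤ.- + suc n ℤ.* y) (≡.trans (≡.sym (falling-pascal a n)) e) e′ ⟩
        q ℤ.* + (suc n !) ℤ.- + suc n ℤ.* (p ℤ.* + (n !))
          ≡⟨ ≡.cong (λ x → q ℤ.* x ℤ.- + suc n ℤ.* (p ℤ.* + (n !))) step ⟨
        q ℤ.* (+ suc n ℤ.* + (n !)) ℤ.- + suc n ℤ.* (p ℤ.* + (n !))
          ≡⟨ solve 4 (λ q p s f → q :* (s :* f) :- s :* (p :* f) := (q :- p) :* (s :* f)) ≡.refl q p (+ suc n) (+ (n !)) ⟩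
        (q ℤ.- p) ℤ.* (+ suc n ℤ.* + (n !))
          ≡⟨ ≡.cong ((q ℤ.- p) ℤ.*_) step ⟩
        (q ℤ.- p) ℤ.* + (suc n !) ∎)
        where
        p = proj₁ (quotient n a)
        e′ = proj₂ (quotient n a)
      go : ∀ a → ∃[ q ] falling a (suc n) ≡ q ℤ.* + (suc n !)
      go (+ zero)     = + 0 , falling-zero 0 (suc n) z<s
      go (+ suc a)    = up (+ a) (go (+ a))
      go -[1+ zero ]  = down -[1+ 0 ] (go (+ 0))
      go -[1+ suc a ] = down -[1+ suc a ] (go -[1+ a ])

    exact : ∀ q d .{{_ : ℕ.NonZero d}} → (q ℤ.* + d) ℤ./ℕ d ≡ q
    exact q d@(suc _) = ℤ.≤-antisym
      (ℤ.*-cancelʳ-≤-pos (n ℤ./ℕ d) q (+ d) (ℤ.[n/ℕd]*d≤n n d))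
      (≡.subst (q ℤ.≤_) (ℤ.pred-suc (n ℤ./ℕ d)) (ℤ.i<j⇒i≤pred[j] (ℤ.*-cancelʳ-<-nonNeg {q} {ℤ.suc (n ℤ./ℕ d)} (+ d) (ℤ.n<s[n/ℕd]*d n d))))
      where n = q ℤ.* + d

  -- The division in `binom` is dealt with here once; the identities below follow by cancelling n!.
  binom-! : ∀ a n → binom a n ℤ.* + (n !) ≡ falling a n
  binom-! a n = ≡.trans (≡.cong (ℤ._* + (n !)) (≡.trans (≡.cong (λ x → x ℤ./ℕ (n !)) e) (exact q (n !)))) (≡.sym e)
    where
    instance _ = n ℕ.!≢0
    q = proj₁ (quotient n a)
    e = proj₂ (quotient n a)

  private
    cancel-! : ∀ n {x y} → x ℤ.* + (n !) ≡ y ℤ.* + (n !) → x ≡ y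
    cancel-! n {x} {y} = ℤ.*-cancelʳ-≡ x y (+ (n !)) {{ℤ-nonZero (n ℕ.!≢0)}}
      where
      ℤ-nonZero : ∀ {d} → ℕ.NonZero d → ℤ.NonZero (+ d)
      ℤ-nonZero {suc d} _ = _

  binom-zero : ∀ a → binom a 0 ≡ + 1
  binom-zero a = cancel-! 0 (binom-! a 0)

  binom-pascal : ∀ a n → binom (ℤ.suc a) (suc n) ≡ binom a (suc n) ℤ.+ binom a n
  binom-pascal a n = cancel-! (suc n) (begin
    binom (ℤ.suc a) (suc n) ℤ.* + (suc n !)
      ≡⟨ binom-! (ℤ.suc a) (suc n) ⟩
    falling (ℤ.suc a) (suc n)
      ≡⟨ falling-pascal a n ⟩
    falling a (suc n) ℤ.+ + suc n ℤ.* falling a n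
      ≡⟨ ≡.cong₂ (λ x y → x ℤ.+ + suc n ℤ.* y) (binom-! a (suc n)) (binom-! a n) ⟨
    binom a (suc n) ℤ.* + (suc n !) ℤ.+ + suc n ℤ.* (binom a n ℤ.* + (n !))
      ≡⟨ ≡.cong (λ x → binom a (suc n) ℤ.* x ℤ.+ + suc n ℤ.* (binom a n ℤ.* + (n !))) step ⟩
    binom a (suc n) ℤ.* (+ suc n ℤ.* + (n !)) ℤ.+ + suc n ℤ.* (binom a n ℤ.* + (n !))
      ≡⟨ solve 4 (λ q p s f → q :* (s :* f) :+ s :* (p :* f) := (q :+ p) :* (s :* f)) ≡.refl (binom a (suc n)) (binom a n) (+ suc n) (+ (n !)) ⟩
    (binom a (suc n) ℤ.+ binom a n) ℤ.* (+ suc n ℤ.* + (n !))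
      ≡⟨ ≡.cong ((binom a (suc n) ℤ.+ binom a n) ℤ.*_) step ⟨
    (binom a (suc n) ℤ.+ binom a n) ℤ.* + (suc n !) ∎)
    where
    step : + (suc n !) ≡ + suc n ℤ.* + (n !)
    step = ℤ.pos-* (suc n) (n !)

  binom-beyond : ∀ a n → a < n → binom (+ a) n ≡ + 0
  binom-beyond a n a<n = cancel-! n (≡.trans (binom-! (+ a) n) (falling-zero a n a<n))

-- The series (1 + βt)^d and the entries of the determinant.

module BinomialSeries {a b} (k : CommutativeRing a b) (β : CommutativeRing.Carrier k) where
  open CommutativeRing k hiding (zero)
  open SymmetricFunctions k hiding (_+_; _*_; -_; _-_)
  open SeriesRing k
  open Variables k
  open Antidiagonal k
  open Determinant k
  open JacobiTrudi k using (shift; shifts; unit; shifts-≤; shifts->)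
  open Separated k
  open RawSemiringDefs (RawRing.rawSemiring rawRing) using (_^_)
  open IntegerImage k using (ι-+)
  open SetoidReasoning setoid

  -- The coefficients of (1 + βt)^d.
  power : ℤ → Row
  power d n = ι (binom d n) * β ^ n

  power-constant : ∀ d → power d 0 ≈ 1#
  power-constant d = begin
    ι (binom d 0) * 1#  ≈⟨ *-identityʳ _ ⟩
    ι (binom d 0)       ≡⟨ ≡.cong ι (Binomial.binom-zero d) ⟩
    1# + 0#             ≈⟨ +-identityʳ 1# ⟩
    1#                  ∎

  power-suc : ∀ d n → power (ℤ.suc d) n ≈ power d n + β * shift (power d) n
  power-suc d zero    = trans (power-constant (ℤ.suc d)) (sym (trans (+-cong (power-constant d) (zeroʳ β)) (+-identityʳ 1#)))
  power-suc d (suc n) = begin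
    ι (binom (ℤ.suc d) (suc n)) * (β * β ^ n)
      ≈⟨ *-congʳ (trans (reflexive (≡.cong ι (Binomial.binom-pascal d n))) (ι-+ (binom d (suc n)) (binom d n))) ⟩
    (ι (binom d (suc n)) + ι (binom d n)) * (β * β ^ n)
      ≈⟨ regroup _ _ β (β ^ n) ⟩
    ι (binom d (suc n)) * (β * β ^ n) + β * (ι (binom d n) * β ^ n) ∎
    where
    open IntegerImage.Solver k
    regroup : ∀ x y b p → (x + y) * (b * p) ≈ x * (b * p) + b * (y * p)
    regroup = solve 4 (λ x y b p → (x :+ y) :* (b :* p) := x :* (b :* p) :+ b :* (y :* p)) refl

  power-beyond : ∀ d n → d < n → power (+ d) n ≈ 0#
  power-beyond d n d<n = trans (*-congʳ (reflexive (≡.cong ι (Binomial.binom-beyond d n d<n)))) (zeroˡ _)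

  power-zero : ∀ n → power (+ 0) n ≈ unit n
  power-zero zero    = power-constant (+ 0)
  power-zero (suc n) = power-beyond 0 (suc n) z<s

  -- Induction on d through multiplication by 1 + βt, while e may be negative. It is applied with d
  -- = j from the determinant for G_ν and e = -i from the twist.
  power-⋆ : ∀ d e g → (power (+ d) ⋆ power e) g ≈ power (+ d ℤ.+ e) g
  power-⋆ zero e g = begin
    convolve g (λ i j → power (+ 0) i * power e j)
      ≈⟨ convolve-first g (λ i j → trans (*-congʳ (power-zero (suc i))) (zeroˡ _)) ⟩
    power (+ 0) 0 * power e g
      ≈⟨ trans (*-congʳ (power-constant (+ 0))) (*-identityˡ _) ⟩
    power e g
      ≡⟨ ≡.cong (λ z → power z g) (ℤ.+-identityˡ e) ⟨
    power (+ 0 ℤ.+ e) g ∎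
  power-⋆ (suc d) e g = begin
    convolve g (λ i j → power (ℤ.suc (+ d)) i * power e j)
      ≈⟨ convolve-cong g (λ i j → trans (*-congʳ (power-suc (+ d) i)) (trans (distribʳ _ _ _) (+-congˡ (*-assoc β _ _)))) ⟩
    convolve g (λ i j → power (+ d) i * power e j + β * (shift (power (+ d)) i * power e j))
      ≈⟨ trans (convolve-+ g _ _) (+-congˡ (sym (convolve-*ˡ g β _))) ⟩
    (power (+ d) ⋆ power e) g + β * (shift (power (+ d)) ⋆ power e) g
      ≈⟨ +-cong (power-⋆ d e g) (*-congˡ (shift-⋆ g)) ⟩
    power (+ d ℤ.+ e) g + β * shift (power (+ d ℤ.+ e)) g
      ≈⟨ power-suc (+ d ℤ.+ e) g ⟨
    power (ℤ.suc (+ d ℤ.+ e)) g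
      ≡⟨ ≡.cong (λ z → power z g) (ℤ.+-assoc (+ 1) (+ d) e) ⟨
    power (+ suc d ℤ.+ e) g ∎
    where
    shift-⋆ : ∀ g → (shift (power (+ d)) ⋆ power e) g ≈ shift (power (+ d ℤ.+ e)) g
    shift-⋆ zero    = zeroˡ _
    shift-⋆ (suc g) = trans (+-congʳ (zeroˡ _)) (trans (+-identityˡ _) (power-⋆ d e g))

  shifts-⋆ : ∀ m p q g → (shifts m p ⋆ q) g ≈ shifts m (p ⋆ q) g
  shifts-⋆ zero    p q g       = refl
  shifts-⋆ (suc m) p q zero    = zeroˡ _
  shifts-⋆ (suc m) p q (suc g) = trans (+-congʳ (zeroˡ _)) (trans (+-identityˡ _) (shifts-⋆ m p q g))

  var-^-* : ∀ i e p → var i ^ˢ e *ˢ inVar i p ≈ˢ inVar i (shifts e p)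
  var-^-* i zero    p = *ˢ-identityˡ (inVar i p)
  var-^-* i (suc e) p = S.trans (*ˢ-assoc (var i) (var i ^ˢ e) (inVar i p))
    (S.trans (*ˢ-cong {var i} S.refl (var-^-* i e p)) (var-*-inVar i (shifts e p)))

  var-^ : ∀ i e → var i ^ˢ e ≈ˢ inVar i (shifts e unit)
  var-^ i e = S.trans (S.sym (S.trans (*ˢ-cong {var i ^ˢ e} S.refl (inVar-unit i)) (S.*-identityʳ (var i ^ˢ e)))) (var-^-* i e unit)

  inVar-power : ∀ i d → (1ˢ +ˢ β •ˢ var i) ^ˢ d ≈ˢ inVar i (power (+ d))
  inVar-power i zero    = S.trans (S.sym (inVar-unit i)) (inVar-cong i (λ g → sym (power-zero g)))
  inVar-power i (suc d) = S.trans
    (*ˢ-cong {1ˢ +ˢ β •ˢ var i} S.refl (inVar-power i d)) (S.trans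
    (*ˢ-distribʳ P 1ˢ (β •ˢ var i)) (S.trans
    (S.+-cong (*ˢ-identityˡ P) (S.trans (•ˢ-*ˢ β (var i) P) (λ α → *-congˡ (var-*-inVar i (power (+ d)) α)))) (S.trans
    (S.+-cong {P} S.refl (S.sym (inVar-• i β (shift (power (+ d)))))) (S.trans
    (S.sym (inVar-+ i (power (+ d)) (λ g → β * shift (power (+ d)) g)))
    (inVar-cong i (λ g → sym (power-suc (+ d) g)))))))
    where
    P = inVar i (power (+ d))

  powerℤ : ℤ → ℤ → Carrier
  powerℤ d (+ n)    = power d n
  powerℤ d -[1+ _ ] = 0#

  shifts-⊖ : ∀ m d g → shifts m (power d) g ≡ powerℤ d (g ℤ.⊖ m)
  shifts-⊖ zero    d g       = ≡.refl
  shifts-⊖ (suc m) d zero    = ≡.refl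
  shifts-⊖ (suc m) d (suc g) = ≡.trans (shifts-⊖ m d g) (≡.cong (powerℤ d) (≡.sym (ℤ.[1+m]⊖[1+n]≡m⊖n g m)))

  hˢ-one : ∀ {z α} → z ≡ + total α → hˢ z α ≈ 1#
  hˢ-one {α = α} ≡.refl = decided (total α ℕ.≟ total α)
    where
    decided : (d : Dec (total α ≡ total α)) → (if does d then 1# else 0#) ≈ 1#
    decided (yes _) = refl
    decided (no ≢)  = contradiction ≡.refl ≢

  hˢ-zero : ∀ z {α} → z ≢ + total α → hˢ z α ≈ 0#
  hˢ-zero -[1+ _ ]     z≢ = refl
  hˢ-zero (+ m) {α} z≢ = decided (total α ℕ.≟ m)
    where
    decided : (d : Dec (total α ≡ m)) → (if does d then 1# else 0#) ≈ 0#
    decided (yes e) = contradiction (≡.cong +_ (≡.sym e)) z≢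
    decided (no _)  = refl

  ∑-single : ∀ {n} {f : Fin n → Carrier} i → (∀ j → j ≢ i → f j ≈ 0#) → ∑ f ≈ f i
  ∑-single {suc n} {f} zero    p = ∑-head (λ j → p (suc j) λ ())
  ∑-single {suc n} {f} (suc i) p = trans (reflexive (∑-suc f)) (trans
    (+-cong (p zero λ ()) (∑-single {f = f ∘ suc} i (λ j j≢i → p (suc j) (λ e → j≢i (Fin.suc-injective e))))) (+-identityˡ _))

  sumᴸ-series : ∀ {n} (f : Fin n → Λ) α → series (sumᴸ f) α ≈ ∑ (λ i → series (f i) α)
  sumᴸ-series {zero}  f α = reflexive (≡.sym (∑-empty _))
  sumᴸ-series {suc n} f α = trans (+-congˡ (sumᴸ-series (λ i → f (suc i)) α)) (reflexive (≡.sym (∑-suc _)))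

  -- h_{m-n} lives in degree m - n, so the coefficient at α selects the single term n = m - |α|, or
  -- none if this is negative. Such an n is at most |m| and hence in the range of the sum.
  binomialSum-series : ∀ d m α → series (binomialSum β d m) α ≈ powerℤ d (m ℤ.- + total α)
  binomialSum-series d m α = trans (sumᴸ-series (λ (n : Fin (suc ℤ.∣ m ∣)) → power d (toℕ n) • h (m ℤ.- + toℕ n)) α) (by-sign (m ℤ.- + total α) ≡.refl)
    where
    t : Fin (suc ℤ.∣ m ∣) → Carrier
    t n = power d (toℕ n) * hˢ (m ℤ.- + toℕ n) α
    open ℤSolver.+-*-Solver
    move : ∀ x y → m ℤ.- x ≡ y → m ℤ.- y ≡ x
    move x y ≡.refl = solve 2 (λ m x → m :- (m :- x) := x) ≡.refl m x
    by-sign : ∀ z → m ℤ.- + total α ≡ z → ∑ t ≈ powerℤ d z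
    by-sign -[1+ z ] e = ∑-zero λ n → trans (*-congˡ (hˢ-zero _ λ e′ → contradiction (≡.trans (≡.sym (move (+ toℕ n) (+ total α) e′)) e) λ ())) (zeroʳ _)
    by-sign (+ z)    e = trans (∑-single i λ j j≢i → trans (*-congˡ (hˢ-zero _ λ e′ →
        j≢i (Fin.toℕ-injective (≡.trans (ℤ.+-injective (≡.trans (≡.sym (move (+ toℕ j) (+ total α) e′)) e)) (≡.sym toℕ-i))))) (zeroʳ _))
      (trans (*-cong (reflexive (≡.cong (power d) toℕ-i)) (hˢ-one {α = α} (≡.trans (≡.cong (λ x → m ℤ.- + x) toℕ-i) (move (+ total α) (+ z) e)))) (*-identityʳ _))
      where
      m≡ : m ≡ + (z ℕ.+ total α)
      m≡ = ≡.trans (solve 2 (λ m x → m := (m :- x) :+ x) ≡.refl m (+ total α)) (≡.cong (ℤ._+ + total α) e)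
      z<n : z < suc ℤ.∣ m ∣
      z<n = s≤s (≡.subst (z ≤_) (≡.cong ℤ.∣_∣ (≡.sym m≡)) (ℕ.m≤m+n z (total α)))
      i = Fin.fromℕ< z<n
      toℕ-i = Fin.toℕ-fromℕ< z<n

  -- The series of binomialSum β d (g - e) as a function of g.
  binomialFamily : ℤ → ℕ → ℕ → Series
  binomialFamily d e g α = shifts (e ℕ.+ total α) (power d) g

  -- The coefficient depends on g and |α| only through g - e - |α|, so a first exponent b cancels
  -- against b in the index.
  binomialFamily-shifts : ∀ d e → ShiftFamily (binomialFamily d e)
  binomialFamily-shifts d e = record
    { shifted = λ g b α → reflexive (≡.trans (≡.cong (λ m → shifts m (power d) (b ℕ.+ g)) (rearrange b (total α))) (cancel b (e ℕ.+ total α) g))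
    ; beyond  = λ g b α g<b → reflexive (shifts-> (e ℕ.+ (b ℕ.+ total α)) (power d)
        (ℕ.<-≤-trans g<b (ℕ.≤-trans (ℕ.m≤m+n b (e ℕ.+ total α)) (ℕ.≤-reflexive (≡.sym (rearrange b (total α)))))))
    }
    where
    cancel : ∀ b m g → shifts (b ℕ.+ m) (power d) (b ℕ.+ g) ≡ shifts m (power d) g
    cancel zero    m g = ≡.refl
    cancel (suc b) m g = cancel b m g
    rearrange : ∀ b t → e ℕ.+ (b ℕ.+ t) ≡ b ℕ.+ (e ℕ.+ t)
    rearrange b t = solve 3 (λ e b t → e :+ (b :+ t) := b :+ (e :+ t)) ≡.refl e b t
      where open +-*-Solver

  binomialFamily-binomialSum : ∀ d m e g → m ≡ + g ℤ.- + e → series (binomialSum β d m) ≈ˢ binomialFamily d e g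
  binomialFamily-binomialSum d m e g ≡.refl α = trans (binomialSum-series d m α)
    (reflexive (≡.trans (≡.cong (powerℤ d) index) (≡.sym (shifts-⊖ (e ℕ.+ total α) d g))))
    where
    open ℤSolver.+-*-Solver
    index : + g ℤ.- + e ℤ.- + total α ≡ g ℤ.⊖ (e ℕ.+ total α)
    index = ≡.trans (solve 3 (λ g e t → g :- e :- t := g :- (e :+ t)) ≡.refl (+ g) (+ e) (+ total α))
      (ℤ.m-n≡m⊖n g (e ℕ.+ total α))

-- Linear functionals on symmetric functions.

module Functionals {a b} (k : CommutativeRing a b) where
  open CommutativeRing k hiding (zero)
  open RingProperties ring
  private module Λᵏ = SymmetricFunctions k
  open Λᵏ hiding (_+_; _*_; -_; _-_)
  open SeriesRing k
  open SetoidReasoning setoid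

  record Linear (ψ : Λ → Carrier) : Set (a ⊔ b) where
    field
      cong     : ∀ {F G} → F ≈ᴸ G → ψ F ≈ ψ G
      additive : ∀ F G → ψ (F Λᵏ.+ G) ≈ ψ F + ψ G
      scales   : ∀ c F → ψ (c • F) ≈ c * ψ F

    at-0 : ψ 0ᴸ ≈ 0#
    at-0 = trans (cong λ _ → sym (zeroˡ _)) (trans (scales 0# 0ᴸ) (zeroˡ _))

    minus : ∀ F G → ψ (F Λᵏ.- G) ≈ ψ F - ψ G
    minus F G = begin
      ψ (F Λᵏ.- G)               ≈⟨ cong (λ α → +-congˡ (sym (-1*x≈-x (series G α)))) ⟩
      ψ (F Λᵏ.+ (- 1#) • G)      ≈⟨ additive F ((- 1#) • G) ⟩
      ψ F + ψ ((- 1#) • G)       ≈⟨ +-congˡ (trans (scales (- 1#) G) (-1*x≈-x (ψ G))) ⟩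
      ψ F - ψ G                  ∎

  linear-zero : Linear (λ _ → 0#)
  linear-zero = record { cong = λ _ → refl ; additive = λ _ _ → sym (+-identityʳ 0#) ; scales = λ c _ → sym (zeroʳ c) }

  linear-coefficient : ∀ g γ → Linear (λ F → (series F *ˢ g) γ)
  linear-coefficient g γ = record
    { cong     = λ p → *ˢ-cong {g = g} p (λ _ → refl) γ
    ; additive = λ F G → *ˢ-distribʳ g (series F) (series G) γ
    ; scales   = λ c F → •ˢ-*ˢ c (series F) g γ
    }

  linear-at : ∀ α → Linear (λ F → series F α)
  linear-at α = record { cong = λ p → p α ; additive = λ _ _ → refl ; scales = λ _ _ → refl }

  -- Passes from G_ν to its lowest term s_ν once the difference of the two is settled.
  agree-from-difference : ∀ {ψ χ} → Linear ψ → Linear χ → ∀ F G → ψ F ≈ χ F → ψ (F Λᵏ.- G) ≈ χ (F Λᵏ.- G) → ψ G ≈ χ G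
  agree-from-difference {ψ} {χ} Ψ X F G p q = -‿injective (+-cancelˡ (ψ F) (- ψ G) (- χ G) (begin
    ψ F - ψ G       ≈⟨ Linear.minus Ψ F G ⟨
    ψ (F Λᵏ.- G)    ≈⟨ q ⟩
    χ (F Λᵏ.- G)    ≈⟨ Linear.minus X F G ⟩
    χ F - χ G       ≈⟨ +-congʳ p ⟨
    ψ F - χ G       ∎))
  replicate-total : ∀ m α → total (α List.++ List.replicate m 0) ≡ total α
  replicate-total zero    []      = ≡.refl
  replicate-total (suc m) []      = replicate-total m []
  replicate-total m       (x ∷ α) = ≡.cong (x ℕ.+_) (replicate-total m α)

  replicate-length : ∀ m α → length (α List.++ List.replicate m 0) ≡ length α ℕ.+ m
  replicate-length m α = ≡.trans (List.length-++ α) (≡.cong (length α ℕ.+_) (List.length-replicate m))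

  pad : ∀ (F : Λ) m α → series F (α List.++ List.replicate m 0) ≈ series F α
  pad F zero    α = reflexive (≡.cong (series F) (List.++-identityʳ α))
  pad F (suc m) α = trans (reflexive (≡.cong (series F) (≡.sym (List.++-assoc α (0 ∷ []) (List.replicate m 0)))))
    (trans (pad F m (α List.∷ʳ 0)) (stable F α))

  private
    remove-zero : ∀ α → total α < length α → ∃[ γ ] α ↭ (γ List.∷ʳ 0)
    remove-zero (zero ∷ α)  _ = α , ∷↭∷ʳ 0 α
    remove-zero (suc x ∷ α) (s<s t) with remove-zero α (ℕ.≤-<-trans (ℕ.m≤n+m (total α) x) t)
    ... | γ , r = suc x ∷ γ , prep (suc x) r

  -- A list longer than n of total at most e ≤ n contains a zero, which symmetry moves to the end
  -- and stability removes; a shorter list is padded with zeros.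
  from-n-variables : ∀ (F : Λ) {e n} → e ≤ n → (∀ α → length α ≡ n → total α ≤ e → series F α ≈ 0#) →
                     ∀ α → total α ≤ e → series F α ≈ 0#
  from-n-variables F {e} {n} e≤n p α t = go (length α) α ≡.refl t
    where
    short : ∀ α → length α ≤ n → total α ≤ e → series F α ≈ 0#
    short α l t = trans (sym (pad F (n ∸ length α) α))
      (p _ (≡.trans (replicate-length (n ∸ length α) α) (ℕ.m+[n∸m]≡n l))
           (ℕ.≤-trans (ℕ.≤-reflexive (replicate-total (n ∸ length α) α)) t))
    go : ∀ l α → length α ≡ l → total α ≤ e → series F α ≈ 0#
    go zero    []  l t = short [] z≤n t
    go (suc l) α l≡ t with length α ℕ.≤? n
    ... | yes l≤n = short α l≤n t
    ... | no  l≰n with remove-zero α (ℕ.≤-<-trans t (ℕ.≤-<-trans e≤n (ℕ.≰⇒> l≰n)))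
    ...   | γ , r = trans (symmetric F r) (trans (stable F γ) (go l γ
      (ℕ.suc-injective (≡.trans (≡.sym (≡.trans (↭-length r) (≡.trans (List.length-++ γ) (ℕ.+-comm (length γ) 1)))) l≡))
      (≡.subst (_≤ e) (≡.trans (total-↭ r) (replicate-total 1 γ)) t)))

  order-*ˢ : ∀ {f} p g → (∀ α → total α < p → f α ≈ 0#) → ∀ α → total α < p → (f *ˢ g) α ≈ 0#
  order-*ˢ {f} p g q α t = *ˢ-vanish {f} {g} α λ γ γ′ _ _ e →
    trans (*-congʳ (q γ (ℕ.≤-<-trans (≡.subst (total γ ≤_) e (ℕ.m≤m+n (total γ) (total γ′))) t))) (zeroˡ _)

-- Schur functions: bialternants and spanning.

module Schur {a b} (k : CommutativeRing a b) (s : Partition → SymmetricFunctions.Λ k)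
  (isSchur : ∀ ν → SymmetricFunctions.IsSchur k ν (s ν)) where
  open CommutativeRing k hiding (zero)
  open RingProperties ring
  private module Λᵏ = SymmetricFunctions k
  open Λᵏ hiding (_+_; _*_; -_; _-_)
  open SeriesRing k
  open Variables k
  open Determinant k
  open Pattern k
  open Separated k
  open AlternatingSeries k
  open Functionals k
  open JacobiTrudi k using (shifts; unit; shifts-≤; shifts->)
  open SetoidReasoning setoid

  monomial-one : ∀ e → shifts e unit e ≈ 1#
  monomial-one e = reflexive (≡.trans (shifts-≤ e unit ℕ.≤-refl) (≡.cong unit (ℕ.n∸n≡0 e)))

  monomial-zero : ∀ e g → g ≢ e → shifts e unit g ≈ 0#
  monomial-zero zero    zero    g≢e = contradiction ≡.refl g≢e
  monomial-zero zero    (suc g) g≢e = refl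
  monomial-zero (suc e) zero    g≢e = refl
  monomial-zero (suc e) (suc g) g≢e = monomial-zero e g (λ p → g≢e (≡.cong suc p))

  alternant : Partition → ∀ n → Fin n → Fin n → Row
  alternant ν n i j = shifts (shiftedParts ν n j) unit

  staircaseTotal : ℕ → ℕ
  staircaseTotal n = total (List.tabulate (staircase n))

  schur-alternant : ∀ ν n → ℓ ν ≤ n → series (s ν) *ˢ vandermonde n ≈[ n ] separated (alternant ν n)
  schur-alternant ν n l γ e = begin
    (series (s ν) *ˢ vandermonde n) γ
      ≈⟨ isSchur ν n l γ e ⟩
    detˢ (λ i j → var (toℕ i) ^ˢ shiftedParts ν n j) γ
      ≡⟨ ≡.cong (λ f → f γ) (S.det-def _) ⟩
    S.Det (λ i j → var (toℕ i) ^ˢ shiftedParts ν n j) γ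
      ≈⟨ S.Det-cong (λ i j → BinomialSeries.var-^ k 0# (toℕ i) (shiftedParts ν n j)) γ ⟩
    S.Det (λ i j → inVar (toℕ i) (alternant ν n i j)) γ
      ≈⟨ Det-inVar (alternant ν n) γ e ⟩
    separated (alternant ν n) γ ∎

  alternant-homogeneous : ∀ ν n → ℓ ν ≤ n → ∀ γ → length γ ≡ n → total γ ≢ size ν ℕ.+ staircaseTotal n →
                          separated (alternant ν n) γ ≈ 0#
  alternant-homogeneous ν n l γ e t = separated-homogeneous (shiftedParts ν n) (alternant ν n)
    (λ i j g → monomial-zero (shiftedParts ν n j) g) γ e (λ t′ → t (≡.trans t′ (total-strict ν n l)))

  -- Only the product of s_ν with the Vandermonde product is given; it is a determinant of monomials
  -- and so homogeneous. `GradedRegular` works one degree at a time and carries this back to s_ν.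
  schur-homogeneous : ∀ ν α → total α ≢ size ν → series (s ν) α ≈ 0#
  schur-homogeneous ν α t = trans (sym (pad (s ν) (ℓ ν) α))
    (regular-vandermonde n (series (s ν)) (total α)
      (λ γ e t′ → trans (schur-alternant ν n l γ e) (alternant-homogeneous ν n l γ e
        (λ t″ → t (ℕ.+-cancelʳ-≡ (staircaseTotal n) (total α) (size ν) (≡.trans (≡.sym t′) t″)))))
      _ (replicate-length (ℓ ν) α) (replicate-total (ℓ ν) α))
    where
    -- Enough variables for the bialternant of ν, reached from α by padding with ℓ(ν) zeros.
    n = length α ℕ.+ ℓ ν
    l : ℓ ν ≤ n
    l = ℕ.m≤n+m (ℓ ν) (length α)

  ∅ : Partition
  ∅ = record { parts = [] ; sorted = [] ; positive = [] }

  -- s_∅ is homogeneous of degree 0, and in no variables both its bialternant and the Vandermonde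
  -- product are 1.
  schur-∅ : series (s ∅) ≈ˢ 1ˢ
  schur-∅ α with total α ℕ.≟ 0
  ... | no  t = trans (schur-homogeneous ∅ α t) (sym (BinomialSeries.hˢ-zero k 0# (+ 0) {α} (λ e → t (≡.sym (ℤ.+-injective e)))))
  ... | yes t = trans (reflexive (≡.cong (series (s ∅)) (zeros α t))) (trans (pad (s ∅) (length α) []) (trans constant
    (sym (BinomialSeries.hˢ-one k 0# {α = α} (≡.cong +_ (≡.sym t))))))
    where
    zeros : ∀ α → total α ≡ 0 → α ≡ List.replicate (length α) 0
    zeros []         t = ≡.refl
    zeros (zero ∷ α) t = ≡.cong (0 ∷_) (zeros α t)
    constant : series (s ∅) [] ≈ 1#
    constant = trans (sym (*-identityʳ _)) (isSchur ∅ 0 z≤n [] ≡.refl)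

  -- Vandermonde's determinant comes for free from the bialternant of s_∅ = 1.
  vandermonde-alternant : ∀ n → vandermonde n ≈[ n ] separated (alternant ∅ n)
  vandermonde-alternant n γ e = begin
    vandermonde n γ                       ≈⟨ *ˢ-identityˡ (vandermonde n) γ ⟨
    (1ˢ *ˢ vandermonde n) γ               ≈⟨ *ˢ-cong {g = vandermonde n} schur-∅ (λ _ → refl) γ ⟨
    (series (s ∅) *ˢ vandermonde n) γ     ≈⟨ schur-alternant ∅ n z≤n γ e ⟩
    separated (alternant ∅ n) γ           ∎

  vandermonde-homogeneous : ∀ n γ → length γ ≡ n → total γ ≢ staircaseTotal n → vandermonde n γ ≈ 0#
  vandermonde-homogeneous n γ e t = trans (vandermonde-alternant n γ e) (alternant-homogeneous ∅ n z≤n γ e t)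

  vandermonde-alternating : ∀ n → AlternatingIn n (vandermonde n)
  vandermonde-alternating n = alternatingIn-cong n (λ γ e → sym (vandermonde-alternant n γ e))
    (separated-alternating (λ j → shifts (shiftedParts ∅ n j) unit))

  δ-one : ∀ {μ ν} → parts μ ≡ parts ν → δ μ ν ≈ 1#
  δ-one {μ} {ν} p with List.≡-dec ℕ._≟_ (parts μ) (parts ν)
  ... | yes _  = refl
  ... | no  ≢  = contradiction p ≢

  δ-zero : ∀ {μ ν} → parts μ ≢ parts ν → δ μ ν ≈ 0#
  δ-zero {μ} {ν} p with List.≡-dec ℕ._≟_ (parts μ) (parts ν)
  ... | yes e = contradiction e p
  ... | no  _ = refl

  δ-sym : ∀ μ ν → δ μ ν ≈ δ ν μ
  δ-sym μ ν with List.≡-dec ℕ._≟_ (parts μ) (parts ν)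
  ... | yes e = sym (δ-one {ν} {μ} (≡.sym e))
  ... | no  ≢ = sym (δ-zero {ν} {μ} (λ e → ≢ (≡.sym e)))

  Det-delta : ∀ {n} ν κ → ℓ ν ≤ n → ℓ κ ≤ n → {M : Fin n → Fin n → Carrier} →
              DeltaPattern (λ i → part ν (toℕ i)) (λ i → part κ (toℕ i)) M → Det M ≈ δ ν κ
  Det-delta {n} ν κ l l′ d with Fin.all? (λ (i : Fin n) → part ν (toℕ i) ℕ.≟ part κ (toℕ i))
  ... | yes e = trans (Det-delta-one d e) (sym (δ-one {ν} {κ} (parts-equal (positive ν) (positive κ) equal)))
    where
    equal : ∀ i → part ν i ≡ part κ i
    equal i with i ℕ.<? n
    ... | yes i<n = ≡.subst (λ i → part ν i ≡ part κ i) (Fin.toℕ-fromℕ< i<n) (e (Fin.fromℕ< i<n))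
    ... | no  i≮n = ≡.trans (nth-beyond (parts ν) i (ℕ.≤-trans l (ℕ.≮⇒≥ i≮n))) (≡.sym (nth-beyond (parts κ) i (ℕ.≤-trans l′ (ℕ.≮⇒≥ i≮n))))
  ... | no ¬e with Fin.¬∀⟶∃¬ n (λ i → part ν (toℕ i) ≡ part κ (toℕ i)) (λ i → part ν (toℕ i) ℕ.≟ part κ (toℕ i)) ¬e
  ...   | i , ≢ = trans (Det-delta-zero d i ≢) (sym (δ-zero {ν} {κ} (λ p → ≢ (≡.cong (λ α → nth α (toℕ i)) p))))

  part-decreasing : ∀ ν {n} (i j : Fin n) → i Fin.≤ j → part ν (toℕ j) ≤ part ν (toℕ i)
  part-decreasing ν i j = nth-decreasing (sorted ν) (toℕ i) (toℕ j)

  staircase-decreasing : ∀ {n} (i j : Fin n) → i Fin.< j → staircase n j < staircase n i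
  staircase-decreasing i j i<j = ℕ.∸-monoʳ-< (s<s i<j) (Fin.toℕ<n j)

  separated-strict : ∀ {n} (u : Fin n → Fin n → Row) ν → separated u (strict ν n) ≈ Det (λ i j → u i j (shiftedParts ν n i))
  separated-strict {n} u ν = Det-cong λ i j → reflexive (≡.cong (u i j) (nth-tabulate (shiftedParts ν n) i))

  -- The matrix has a 1 where the i-th entry of ν + δ equals the j-th entry of κ + δ, and both
  -- sequences are strictly decreasing, which gives the zero pattern.
  schur-coefficient : ∀ {n} ν κ → ℓ ν ≤ n → ℓ κ ≤ n → (series (s κ) *ˢ vandermonde n) (strict ν n) ≈ δ ν κ
  schur-coefficient {n} ν κ l l′ = begin
    (series (s κ) *ˢ vandermonde n) (strict ν n)
      ≈⟨ schur-alternant κ n l′ (strict ν n) (List.length-tabulate _) ⟩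
    separated (alternant κ n) (strict ν n)
      ≈⟨ separated-strict (alternant κ n) ν ⟩
    Det (λ i j → shifts (shiftedParts κ n j) unit (shiftedParts ν n i))
      ≈⟨ Det-delta ν κ l l′ pattern′ ⟩
    δ ν κ ∎
    where
    pattern′ : DeltaPattern (λ i → part ν (toℕ i)) (λ i → part κ (toℕ i)) (λ i j → shifts (shiftedParts κ n j) unit (shiftedParts ν n i))
    pattern′ = record
      { p-decreasing = part-decreasing ν
      ; q-decreasing = part-decreasing κ
      ; above    = λ i j i<j q<p → monomial-zero _ _ (≡.≢-sym (ℕ.<⇒≢ (ℕ.+-mono-< q<p (staircase-decreasing i j i<j))))
      ; below    = λ i j j<i p≤q → monomial-zero _ _ (ℕ.<⇒≢ (ℕ.+-mono-≤-< p≤q (staircase-decreasing j i j<i)))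
      ; diagonal = λ i p≡q → trans (reflexive (≡.cong (λ x → shifts (shiftedParts κ n i) unit (x ℕ.+ staircase n i)) p≡q)) (monomial-one (shiftedParts κ n i))
      ; off      = λ i p≢q → monomial-zero _ _ (λ e → p≢q (ℕ.+-cancelʳ-≡ (staircase n i) _ _ e))
      }

  -- Finite combinations as an inductive family, so that linear functionals are compared one Schur
  -- function at a time. P keeps track of the range of sizes for the inductions on order.
  data Span {p} (P : Partition → Set p) : Λ → Set (a ⊔ b ⊔ p) where
    none : ∀ {F} → F ≈ᴸ 0ᴸ → Span P F
    more : ∀ {F F′ ν} → P ν → ∀ c → Span P F′ → F ≈ᴸ c • s ν Λᵏ.+ F′ → Span P F

  span-cong : ∀ {p} {P : Partition → Set p} {F G} → F ≈ᴸ G → Span P F → Span P G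
  span-cong e (none z)         = none (λ α → trans (sym (e α)) (z α))
  span-cong e (more q c F′ e′) = more q c F′ (λ α → trans (sym (e α)) (e′ α))

  span-agree : ∀ {p} {P : Partition → Set p} {ψ χ} → Linear ψ → Linear χ → (∀ ν → P ν → ψ (s ν) ≈ χ (s ν)) →
               ∀ {F} → Span P F → ψ F ≈ χ F
  span-agree Ψ X p (none z) = trans (Linear.cong Ψ z) (trans (Linear.at-0 Ψ) (sym (trans (Linear.cong X z) (Linear.at-0 X))))
  span-agree {ψ = ψ} {χ} Ψ X p {F} (more {F′ = F′} {ν} q c F″ e) = begin
    ψ F                       ≈⟨ Linear.cong Ψ e ⟩
    ψ (c • s ν Λᵏ.+ F′)       ≈⟨ trans (Linear.additive Ψ _ _) (+-congʳ (Linear.scales Ψ c (s ν))) ⟩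
    c * ψ (s ν) + ψ F′        ≈⟨ +-cong (*-congˡ (p ν q)) (span-agree Ψ X p F″) ⟩
    c * χ (s ν) + χ F′        ≈⟨ trans (Linear.additive X _ _) (+-congʳ (Linear.scales X c (s ν))) ⟨
    χ (c • s ν Λᵏ.+ F′)       ≈⟨ Linear.cong X e ⟨
    χ F                       ∎

  private
    module Elimination (n : ℕ) {P : Partition → Set} (P? : ∀ ν → Dec (P ν)) (bounded : ∀ ν → P ν → ℓ ν ≤ n) (F : Λ) where
      coefficient : Partition → Λ → Carrier
      coefficient ν G = (series G *ˢ vandermonde n) (strict ν n)

      linear : ∀ ν → Linear (coefficient ν)
      linear ν = linear-coefficient (vandermonde n) (strict ν n)

      coefficient-parts : ∀ {ν κ} → parts ν ≡ parts κ → ∀ G → coefficient ν G ≈ coefficient κ G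
      coefficient-parts p G = reflexive (≡.cong (λ α → (series G *ˢ vandermonde n) (List.tabulate (λ j → nth α (toℕ j) ℕ.+ staircase n j))) p)

      Eliminated : List (List ℕ) → Λ → Set b
      Eliminated L G = ∀ α (dec : Linked _≥_ α) → α ∈ L → P (toPartition α dec) → coefficient (toPartition α dec) (F Λᵏ.- G) ≈ 0#

      -- By `schur-coefficient`, among the coefficients at the exponents κ + δ a multiple of s_ν
      -- changes only the one at ν + δ. So the coefficients already cleared for the rest of the list
      -- stay zero.
      eliminate : ∀ L → ∃[ G ] Span P G × Eliminated L G
      eliminate []      = 0ᴸ , none (λ _ → refl) , λ _ _ ()
      eliminate (α ∷ L) with eliminate L | Linked.linked? (λ x y → y ℕ.≤? x) α
      ... | G , G∈ , elim | no ¬dec = G , G∈ , λ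
        { γ dec (here ≡.refl) q → contradiction dec ¬dec
        ; γ dec (there γ∈) q → elim γ dec γ∈ q }
      ... | G , G∈ , elim | yes dec with P? (toPartition α dec)
      ...   | no ¬q = G , G∈ , λ
        { γ dec′ (here ≡.refl) q → contradiction (≡.subst (λ d → P (toPartition α d)) (Linked.irrelevant ℕ.≤-irrelevant dec′ dec) q) ¬q
        ; γ dec′ (there γ∈) q → elim γ dec′ γ∈ q }
      ...   | yes q = c • s ν Λᵏ.+ G , more q c G∈ (λ _ → refl) , elim′
        where
        ν = toPartition α dec
        c = coefficient ν (F Λᵏ.- G)
        elim′ : Eliminated (α ∷ L) (c • s ν Λᵏ.+ G)
        elim′ γ dec′ γ∈ q′ = begin
          coefficient κ (F Λᵏ.- (c • s ν Λᵏ.+ G))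
            ≈⟨ Linear.cong (linear κ) {F Λᵏ.- (c • s ν Λᵏ.+ G)} {(F Λᵏ.- G) Λᵏ.- c • s ν} (λ ε → regroup (series F ε) c (series (s ν) ε) (series G ε)) ⟩
          coefficient κ ((F Λᵏ.- G) Λᵏ.- c • s ν)
            ≈⟨ trans (Linear.minus (linear κ) (F Λᵏ.- G) (c • s ν)) (+-congˡ (-‿cong (Linear.scales (linear κ) c (s ν)))) ⟩
          coefficient κ (F Λᵏ.- G) - c * coefficient κ (s ν)
            ≈⟨ +-congˡ (-‿cong (*-congˡ (schur-coefficient κ ν (bounded κ q′) (bounded ν q)))) ⟩
          coefficient κ (F Λᵏ.- G) - c * δ κ ν
            ≈⟨ by-parts (List.≡-dec ℕ._≟_ (parts κ) (parts ν)) ⟩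
          0# ∎
          where
          κ = toPartition γ dec′
          open IntegerImage.Solver k
          regroup : ∀ f c s g → f + - (c * s + g) ≈ (f + - g) + - (c * s)
          regroup = solve 4 (λ f c s g → f :+ :- (c :* s :+ g) := (f :+ :- g) :+ :- (c :* s)) refl
          by-parts : Dec (parts κ ≡ parts ν) → coefficient κ (F Λᵏ.- G) - c * δ κ ν ≈ 0#
          by-parts (yes e) = begin
            coefficient κ (F Λᵏ.- G) - c * δ κ ν  ≈⟨ +-cong (coefficient-parts {κ} {ν} e (F Λᵏ.- G)) (-‿cong (trans (*-congˡ (δ-one {κ} {ν} e)) (*-identityʳ c))) ⟩
            c - c                                 ≈⟨ -‿inverseʳ c ⟩
            0#                                    ∎
          by-parts (no ≢) = begin
            coefficient κ (F Λᵏ.- G) - c * δ κ ν  ≈⟨ +-cong (remaining γ∈) (-‿cong (trans (*-congˡ (δ-zero {κ} {ν} ≢)) (zeroʳ c))) ⟩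
            0# - 0#                               ≈⟨ -‿inverseʳ 0# ⟩
            0#                                    ∎
            where
            remaining : γ ∈ α ∷ L → coefficient κ (F Λᵏ.- G) ≈ 0#
            remaining (here e)   = contradiction (≡.cong trim e) ≢
            remaining (there γ∈) = elim γ dec′ γ∈ q′

  -- Subtract Schur functions to kill the coefficients of all x^(ν+δ) in F ∏(xᵢ - xⱼ); the rest,
  -- being alternating, is zero.
  expansion : ∀ F e → (∀ α → total α < e → series F α ≈ 0#) → Span (λ ν → e ≤ size ν × size ν ≤ deg F) F
  expansion F e low = span-cong (λ α → sym (x-y≈0⇒x≈y (D-zero α))) G∈
    where
    -- F and the Schur functions subtracted from it have degree at most n, so n variables determine
    -- the difference.
    n = deg F
    P : Partition → Set
    P ν = e ≤ size ν × size ν ≤ n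
    P? : ∀ ν → Dec (P ν)
    P? ν = (e ℕ.≤? size ν) ×-dec (size ν ℕ.≤? n)
    open Elimination n P? (λ ν q → ℕ.≤-trans (ℓ≤size ν) (proj₂ q)) F
    result = eliminate (boundedLists n n)
    G = proj₁ result
    G∈ = proj₁ (proj₂ result)
    D = F Λᵏ.- G
    x-y≈0⇒x≈y : ∀ {x y} → x - y ≈ 0# → x ≈ y
    x-y≈0⇒x≈y {x} {y} e = trans (+-inverseˡ-unique x (- y) e) (-‿involutive y)
    G-outside : ∀ α → ¬ (e ≤ total α × total α ≤ n) → series G α ≈ 0#
    G-outside α out = span-agree (linear-at α) linear-zero
      (λ ν q → schur-homogeneous ν α (λ t → out (≡.subst (λ d → e ≤ d × d ≤ n) (≡.sym t) q))) G∈
    D-outside : ∀ α → ¬ (e ≤ total α × total α ≤ n) → series D α ≈ 0#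
    D-outside α out = trans (+-cong F-outside (-‿cong (G-outside α out))) (-‿inverseʳ 0#)
      where
      F-outside : series F α ≈ 0#
      F-outside with e ℕ.≤? total α | total α ℕ.≤? n
      ... | no e≰t | _       = low α (ℕ.≰⇒> e≰t)
      ... | yes _  | no t≰n  = bounded F α (ℕ.≰⇒> t≰n)
      ... | yes e≤t | yes t≤n = contradiction (e≤t , t≤n) out
    strictly : ∀ γ → Linked _>_ γ → length γ ≡ n → (series D *ˢ vandermonde n) γ ≈ 0#
    strictly γ dec l with unstrict n γ dec l
    ... | α , dec′ , l′ , ≡.refl with P? (toPartition α dec′)
    ...   | yes q = proj₂ (proj₂ result) α dec′ (≡.subst (λ m → α ∈ boundedLists n m) l′ (∈-boundedLists n α
            (≡.subst (_≤ n) same-total (proj₂ q)))) q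
      where
      same-total : size (toPartition α dec′) ≡ total α
      same-total = ≡.trans (≡.sym (total-tabulate-nth (length α) (trim α) (length-trim α)))
        (≡.trans (≡.cong total (List.tabulate-cong {n = length α} (λ j → nth-trim dec′ (toℕ j)))) (total-tabulate-nth (length α) α ℕ.≤-refl))
    -- The Vandermonde product takes up the degree |δ|, so D is evaluated in degree |ν|, outside the
    -- range in which it can be nonzero.
    ...   | no ¬q = *ˢ-vanish {series D} {vandermonde n} (strict ν n) λ ε ε′ _ m t → vanish ε ε′ m t (total ε′ ℕ.≟ staircaseTotal n)
      where
      ν = toPartition α dec′
      vanish : ∀ ε ε′ → length ε′ ≡ length (strict ν n) → total ε ℕ.+ total ε′ ≡ total (strict ν n) →
               Dec (total ε′ ≡ staircaseTotal n) → series D ε * vandermonde n ε′ ≈ 0#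
      vanish ε ε′ m t (no ≢)  = trans (*-congˡ (vandermonde-homogeneous n ε′ (≡.trans m l) ≢)) (zeroʳ _)
      vanish ε ε′ m t (yes e′) = trans (*-congʳ (D-outside ε (λ q → ¬q (≡.subst (λ d → e ≤ d × d ≤ n) t′ q)))) (zeroˡ _)
        where
        t′ : total ε ≡ size ν
        t′ = ℕ.+-cancelʳ-≡ (staircaseTotal n) _ _ (≡.trans (≡.cong (total ε ℕ.+_) (≡.sym e′)) (≡.trans t
          (total-strict ν n (ℕ.≤-trans (length-trim α) (ℕ.≤-reflexive l′)))))
    product-zero : series D *ˢ vandermonde n ≈[ n ] 0ˢ
    product-zero = alternating-zero (symmetric-*-alternating n (symmetric D) (vandermonde-alternating n)) strictly
    D-zero : ∀ α → series D α ≈ 0#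
    D-zero α with total α ℕ.≤? n
    ... | no t≰n  = D-outside α (λ q → t≰n (proj₂ q))
    ... | yes t≤n = from-n-variables D ℕ.≤-refl
      (λ γ l _ → regular-vandermonde n (series D) (total γ) (λ ε l′ _ → product-zero ε l′) γ l ≡.refl) α t≤n

-- Duality of complete and monomial functions.

module Duality {a b} (k : CommutativeRing a b) (s : Partition → SymmetricFunctions.Λ k)
  (isSchur : ∀ ν → SymmetricFunctions.IsSchur k ν (s ν)) (H : SymmetricFunctions.HallProduct k s) where
  open CommutativeRing k hiding (zero)
  open RingProperties ring
  private module Λᵏ = SymmetricFunctions k
  open Λᵏ hiding (_+_; _*_; -_; _-_)
  open SeriesRing k
  open Variables k
  open Determinant k
  open Separated k
  open Functionals k
  open Schur k s isSchur
  open JacobiTrudi k using (shifts; unit)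
  open BinomialSeries k 0# using (binomialFamily; binomialFamily-shifts; power-zero; hˢ-one; hˢ-zero)
  open HallProduct H
  open SetoidReasoning setoid

  linearˡ : ∀ g → Linear (λ F → ⟨ F , g ⟩)
  linearˡ g = record { cong = λ p → HallProduct.cong H p (λ _ → refl) ; additive = λ F G → +-left F G g ; scales = λ c F → •-left c F g }

  linearʳ : ∀ f → Linear (λ G → ⟨ f , G ⟩)
  linearʳ f = record { cong = λ p → HallProduct.cong H (λ _ → refl) p ; additive = +-right f ; scales = λ c G → •-right c f G }

  expand : ∀ F → Span (λ ν → 0 ≤ size ν × size ν ≤ deg F) F
  expand F = expansion F 0 (λ _ ())

  -- F is a combination of s_ν with |ν| > N, and g of s_κ with |κ| ≤ N; these are orthogonal.
  pairing-order : ∀ F g {N} → deg g ≤ N → (∀ α → total α ≤ N → series F α ≈ 0#) → ⟨ F , g ⟩ ≈ 0#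
  pairing-order F g {N} d≤N low = span-agree (linearˡ g) linear-zero
    (λ ν q → span-agree (linearʳ (s ν)) linear-zero
      (λ κ q′ → trans (orthonormal ν κ) (δ-zero {ν} {κ} (λ e → ℕ.<⇒≢ (ℕ.≤-<-trans (ℕ.≤-trans (proj₂ q′) d≤N) (proj₁ q)) (≡.cong total (≡.sym e)))))
      (expand g))
    (expansion F (suc N) (λ α t → low α (ℕ.s≤s⁻¹ t)))

  pairing-agree : ∀ F G g {N} → deg g ≤ N → (∀ α → total α ≤ N → series F α ≈ series G α) → ⟨ F , g ⟩ ≈ ⟨ G , g ⟩
  pairing-agree F G g d≤N p = begin
    ⟨ F , g ⟩  ≈⟨ +-identityʳ _ ⟨
    ⟨ F , g ⟩ + 0#  ≈⟨ +-congˡ (trans (sym (Linear.minus (linearˡ g) G F)) (pairing-order (G Λᵏ.- F) g d≤N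
                        (λ α t → trans (+-congʳ (sym (p α t))) (-‿inverseʳ _)))) ⟨
    ⟨ F , g ⟩ + (⟨ G , g ⟩ - ⟨ F , g ⟩)  ≈⟨ cancel _ _ ⟩
    ⟨ G , g ⟩  ∎
    where
    open IntegerImage.Solver k
    cancel : ∀ x y → x + (y - x) ≈ y
    cancel = solve 2 (λ x y → x :+ (y :- x) := y) refl

  -- h_{g - e}, zero for g < e.
  hFamily : ∀ e g → S.shifts e (λ m → hˢ (+ m)) g ≈ˢ binomialFamily (+ 0) e g
  hFamily (suc e) zero    α = refl
  hFamily (suc e) (suc g) α = hFamily e g α
  hFamily zero    g       α with total α ℕ.≟ g
  ... | yes ≡.refl = trans (hˢ-one {α = α} ≡.refl) (sym (trans (JacobiTrudi.shifts-cong k (total α) power-zero (total α)) (monomial-one (total α))))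
  ... | no t≢g = trans (hˢ-zero (+ g) {α} (λ e → t≢g (≡.sym (ℤ.+-injective e)))) (sym (trans (JacobiTrudi.shifts-cong k (total α) power-zero g) (monomial-zero (total α) g (≡.≢-sym t≢g))))

  regular-cancel : ∀ n {f g} → f *ˢ vandermonde n ≈[ n ] g *ˢ vandermonde n → f ≈[ n ] g
  regular-cancel n {f} {g} p α l = trans (+-inverseˡ-unique (f α) (- g α)
    (regular-vandermonde n (f +ˢ -ˢ g) (total α) vanish α l ≡.refl)) (-‿involutive (g α))
    where
    vanish : ∀ γ → length γ ≡ n → total γ ≡ total α ℕ.+ staircaseTotal n → ((f +ˢ -ˢ g) *ˢ vandermonde n) γ ≈ 0#
    vanish γ l _ = begin
      ((f +ˢ -ˢ g) *ˢ vandermonde n) γ                    ≈⟨ *ˢ-distribʳ (vandermonde n) f (-ˢ g) γ ⟩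
      (f *ˢ vandermonde n) γ + ((-ˢ g) *ˢ vandermonde n) γ ≈⟨ +-cong (p γ l) (sym (RingProperties.-‿distribˡ-* S.ring g (vandermonde n) γ)) ⟩
      (g *ˢ vandermonde n) γ - (g *ˢ vandermonde n) γ     ≈⟨ -‿inverseʳ _ ⟩
      0#                                                  ∎

  -- `Det-complete` over the ring of series with the variables for y, followed by cancellation of
  -- the Vandermonde product.
  jacobiTrudi : ∀ ν n → ℓ ν ≤ n →
    series (s ν) ≈[ n ] S.Det (λ i j → binomialFamily (+ 0) (staircase n j) (shiftedParts ν n i))
  jacobiTrudi ν n l = regular-cancel n λ γ e → begin
    (series (s ν) *ˢ vandermonde n) γ
      ≈⟨ isSchur ν n l γ e ⟩
    detˢ (λ i j → var (toℕ i) ^ˢ shiftedParts ν n j) γ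
      ≡⟨ ≡.cong (λ f → f γ) (S.det-def _) ⟩
    S.Det (λ i j → var (toℕ i) ^ˢ shiftedParts ν n j) γ
      ≈⟨ S.Det-complete {n} (λ i → var (toℕ i)) (shiftedParts ν n) γ ⟩
    (vandermonde n *ˢ S.Det (λ i j → S.shifts (staircase n i) (S.complete {n} (λ i → var (toℕ i)) S.unit) (shiftedParts ν n j))) γ
      ≈⟨ *ˢ-comm (vandermonde n) _ γ ⟩
    (S.Det (λ i j → S.shifts (staircase n i) (S.complete {n} (λ i → var (toℕ i)) S.unit) (shiftedParts ν n j)) *ˢ vandermonde n) γ
      ≈⟨ *ˢ-cong-at {g = vandermonde n} γ (λ ε e′ → trans
           (Detˢ-cong-at ε (λ i j ε′ e″ → trans (complete-shifts (staircase n i) (shiftedParts ν n j) ε′ (≡.trans e″ (≡.trans e′ e))) (hFamily (staircase n i) (shiftedParts ν n j) ε′)))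
           -- The bialternant has the parts of ν in its columns, whereas `Det-shifts` reads the
           -- entries of ν + δ as row indices.
           (S.Det-transpose (λ i j → binomialFamily (+ 0) (staircase n i) (shiftedParts ν n j)) ε)) (λ _ _ → refl) ⟩
    (S.Det (λ i j → binomialFamily (+ 0) (staircase n j) (shiftedParts ν n i)) *ˢ vandermonde n) γ ∎
    where
    complete-shifts : ∀ m g ε → length ε ≡ n →
      S.shifts m (S.complete {n} (λ i → var (toℕ i)) S.unit) g ε ≈ S.shifts m (λ m → hˢ (+ m)) g ε
    complete-shifts zero    g       ε e = complete-variables n g ε e
    complete-shifts (suc m) zero    ε e = refl
    complete-shifts (suc m) (suc g) ε e = complete-shifts m g ε e

  deg-completes : ∀ α → deg (completes α) ≡ total α
  deg-completes []      = ≡.refl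
  deg-completes (x ∷ α) = ≡.cong (x ℕ.+_) (deg-completes α)

  -- By linearity X = s_ν. The coefficient at α of its Jacobi-Trudi determinant is the coefficient
  -- of x^(ν+δ) in h_α times the Vandermonde product, by `Det-shifts`, and this is the coefficient
  -- of s_ν in h_α. The two bounds make `length α` variables enough for all Schur functions
  -- involved.
  duality : ∀ (X : Λ) α → deg X ≤ length α → total α ≤ length α → series X α ≈ ⟨ X , completes α ⟩
  duality X α d t = span-agree (linear-at α) (linearˡ (completes α)) (λ ν q → schur ν (ℕ.≤-trans (proj₂ q) d)) (expand X)
    where
    n = length α
    schur : ∀ ν → size ν ≤ n → series (s ν) α ≈ ⟨ s ν , completes α ⟩
    schur ν l = begin
      series (s ν) α
        ≈⟨ jacobiTrudi ν n ℓν≤n α ≡.refl ⟩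
      S.Det (λ i j → binomialFamily (+ 0) (staircase n j) (shiftedParts ν n i)) α
        ≈⟨ S.Det-cong (λ i j → S.reflexive (≡.cong (binomialFamily (+ 0) (staircase n j)) (nth-tabulate (shiftedParts ν n) i))) α ⟨
      S.Det (λ i j → binomialFamily (+ 0) (staircase n j) (nth (strict ν n) (toℕ i))) α
        ≈⟨ Det-shifts (λ i j → binomialFamily (+ 0) (staircase n j)) (λ i j → binomialFamily-shifts (+ 0) (staircase n j)) α (strict ν n) lν ⟩
      (series (completes α) *ˢ separated (λ i j g → binomialFamily (+ 0) (staircase n j) g [])) (strict ν n)
        ≈⟨ *ˢ-cong-at {series (completes α)} (strict ν n) (λ _ _ → refl) (λ γ e → trans
             (Det-cong λ i j → trans (sym (hFamily (staircase n j) _ [])) (h-constant (staircase n j) _))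
             (sym (vandermonde-alternant n γ (≡.trans e lν)))) ⟩
      (series (completes α) *ˢ vandermonde n) (strict ν n)
        ≈⟨ span-agree (linearʳ (s ν)) (linear-coefficient (vandermonde n) (strict ν n))
             (λ κ q → trans (orthonormal ν κ) (sym (schur-coefficient ν κ ℓν≤n
               (ℕ.≤-trans (ℓ≤size κ) (ℕ.≤-trans (proj₂ q) (ℕ.≤-trans (ℕ.≤-reflexive (deg-completes α)) t))))))
             (expand (completes α)) ⟨
      ⟨ s ν , completes α ⟩ ∎
      where
      ℓν≤n = ℕ.≤-trans (ℓ≤size ν) l
      lν = List.length-tabulate (shiftedParts ν n)
      h-constant : ∀ m g → S.shifts m (λ m → hˢ (+ m)) g [] ≈ shifts m unit g
      h-constant zero    zero    = refl
      h-constant zero    (suc g) = refl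
      h-constant (suc m) zero    = refl
      h-constant (suc m) (suc g) = h-constant m g

-- Grothendieck polynomials and the pairing with their dual family.

module Grothendieck {a b} (k : CommutativeRing a b) (β : CommutativeRing.Carrier k) (s : Partition → SymmetricFunctions.Λ k)
  (isSchur : ∀ ν → SymmetricFunctions.IsSchur k ν (s ν)) (H : SymmetricFunctions.HallProduct k s)
  (G : Partition → SymmetricFunctions.Completion.Λ̂ k s)
  (isGrothendieck : ∀ ν → SymmetricFunctions.Completion.IsStableGrothendieck k s β ν (G ν)) where
  open CommutativeRing k hiding (zero)
  open RingProperties ring
  private module Λᵏ = SymmetricFunctions k
  open Λᵏ hiding (_+_; _*_; -_; _-_)
  open Completion s
  open SeriesRing k
  open Variables k
  open Determinant k
  open Separated k
  open Functionals k
  open Schur k s isSchur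
  open Duality k s isSchur H
  open JacobiTrudi k using (shifts; unit; shifts-≤; shifts->)
  open BinomialSeries k β
  open HallProduct H
  open SetoidReasoning setoid

  -- |ν| ≥ ℓ(ν) > n, so an element of Iₙ has no terms of degree at most n. Working modulo Iₙ is
  -- thereby replaced by truncating degrees.
  ideal-order : ∀ {F n} → F ∈I n → ∀ α → total α ≤ n → series F α ≈ 0#
  ideal-order {F} {n} (m , c , ν , n<ℓ , e) α t = trans (e α) (trans (sumᴸ-series (λ i → c i • s (ν i)) α) (∑-zero λ i →
    trans (*-congˡ (schur-homogeneous (ν i) α (ℕ.<⇒≢ (ℕ.≤-<-trans t (ℕ.<-≤-trans (n<ℓ i) (ℓ≤size (ν i))))))) (zeroʳ _)))

  -- The pairing uses the representative at the degree of g_λ, while the determinants need one for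
  -- more variables.
  image-agree : ∀ (F : Λ̂) N d α → total α ≤ N → series (image F (d ℕ.+ N)) α ≈ series (image F N) α
  image-agree F N zero    α t = refl
  image-agree F N (suc d) α t = trans
    (trans (+-inverseˡ-unique _ _ (ideal-order {image F (suc (d ℕ.+ N)) Λᵏ.- image F (d ℕ.+ N)} (compatible F (d ℕ.+ N)) α (ℕ.≤-trans t (ℕ.m≤n+m N d)))) (-‿involutive _))
    (image-agree F N d α t)

  product-agree : ∀ F F′ p N → (∀ α → total α ≤ N → series F α ≈ series F′ α) →
                  ∀ α → total α ≤ N → series (F Λᵏ.* p) α ≈ series (F′ Λᵏ.* p) α
  product-agree F F′ p N e α t = trans (+-inverseˡ-unique _ _ (begin
    (series F *ˢ series p) α - (series F′ *ˢ series p) α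
      ≈⟨ +-congˡ (RingProperties.-‿distribˡ-* S.ring (series F′) (series p) α) ⟩
    (series F *ˢ series p) α + ((-ˢ series F′) *ˢ series p) α
      ≈⟨ *ˢ-distribʳ (series p) (series F) (-ˢ series F′) α ⟨
    (series (F Λᵏ.- F′) *ˢ series p) α
      ≈⟨ order-*ˢ (suc N) (series p) (λ γ t → trans (+-congʳ (e γ (ℕ.s≤s⁻¹ t))) (-‿inverseʳ _)) α (s≤s t) ⟩
    0# ∎)) (-‿involutive _)

  alternantᵝ : Partition → ∀ n → Fin n → Fin n → Row
  alternantᵝ ν n i j = shifts (shiftedParts ν n j) (power (+ toℕ j))

  grothendieck-alternant : ∀ ν n → ℓ ν ≤ n → series (image (G ν) n) *ˢ vandermonde n ≈[ n ] separated (alternantᵝ ν n)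
  grothendieck-alternant ν n l γ e = begin
    (series (image (G ν) n) *ˢ vandermonde n) γ
      ≈⟨ isGrothendieck ν n l γ e ⟩
    detˢ (λ i j → var (toℕ i) ^ˢ shiftedParts ν n j *ˢ (1ˢ +ˢ β •ˢ var (toℕ i)) ^ˢ toℕ j) γ
      ≡⟨ ≡.cong (λ f → f γ) (S.det-def _) ⟩
    S.Det (λ i j → var (toℕ i) ^ˢ shiftedParts ν n j *ˢ (1ˢ +ˢ β •ˢ var (toℕ i)) ^ˢ toℕ j) γ
      ≈⟨ S.Det-cong (λ i j → S.trans (*ˢ-cong {var (toℕ i) ^ˢ shiftedParts ν n j} S.refl (inVar-power (toℕ i) (toℕ j)))
           (var-^-* (toℕ i) (shiftedParts ν n j) (power (+ toℕ j)))) γ ⟩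
    S.Det (λ i j → inVar (toℕ i) (alternantᵝ ν n i j)) γ
      ≈⟨ Det-inVar (alternantᵝ ν n) γ e ⟩
    separated (alternantᵝ ν n) γ ∎

  -- ∏ (1 + βxᵢ)^(-(i - 1))
  twist : ∀ n → Series
  twist n = weights {n} (λ i → power (ℤ.- + toℕ i))

  twisted : Partition → ∀ n → Fin n → Fin n → Row
  twisted ν n i j = shifts (shiftedParts ν n j) (power (+ toℕ j ℤ.- + toℕ i))

  alternantᵝ-twist : ∀ ν n → separated (alternantᵝ ν n) *ˢ twist n ≈[ n ] separated (twisted ν n)
  alternantᵝ-twist ν n γ e = trans (separated-*-weights (alternantᵝ ν n) (λ i → power (ℤ.- + toℕ i)) γ e)
    (Det-cong λ i j → trans (shifts-⋆ (shiftedParts ν n j) (power (+ toℕ j)) (power (ℤ.- + toℕ i)) _)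
      (shifts-cong (shiftedParts ν n j) (power-⋆ (toℕ j) (ℤ.- + toℕ i)) _))
    where open JacobiTrudi k using (shifts-cong)

  -- Entry (i, j) is the coefficient of t^m in (1 + βt)^(j-i), where m = λᵢ - νⱼ - i + j. Below the
  -- diagonal λᵢ ≤ νⱼ makes m negative; above it λᵢ > νⱼ makes m larger than the degree j - i; on
  -- the diagonal the series is 1.
  twisted-coefficient : ∀ {n} lam ν → ℓ lam ≤ n → ℓ ν ≤ n → separated (twisted ν n) (strict lam n) ≈ δ lam ν
  twisted-coefficient {n} lam ν l l′ = trans (separated-strict (twisted ν n) lam) (Det-delta lam ν l l′ record
    { p-decreasing = part-decreasing lam
    ; q-decreasing = part-decreasing ν
    ; above    = above
    ; below    = λ i j j<i p≤q → reflexive (shifts-> (shiftedParts ν n j) _ (ℕ.+-mono-≤-< p≤q (staircase-decreasing j i j<i)))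
    ; diagonal = λ i p≡q → trans (diagonal-entry i) (trans (reflexive (≡.cong (λ x → shifts (shiftedParts ν n i) unit (x ℕ.+ staircase n i)) p≡q)) (monomial-one (shiftedParts ν n i)))
    ; off      = λ i p≢q → trans (diagonal-entry i) (monomial-zero (shiftedParts ν n i) _ (λ e → p≢q (ℕ.+-cancelʳ-≡ (staircase n i) _ _ e)))
    })
    where
    diagonal-entry : ∀ i → twisted ν n i i (shiftedParts lam n i) ≈ shifts (shiftedParts ν n i) unit (shiftedParts lam n i)
    diagonal-entry i = trans (reflexive (≡.cong (λ z → shifts (shiftedParts ν n i) (power z) (shiftedParts lam n i)) (ℤ.+-inverseʳ (+ toℕ i))))
      (JacobiTrudi.shifts-cong k (shiftedParts ν n i) power-zero (shiftedParts lam n i))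
    above : ∀ i j → i Fin.< j → part ν (toℕ j) < part lam (toℕ i) → twisted ν n i j (shiftedParts lam n i) ≈ 0#
    above i j i<j q<p = trans
      (reflexive (≡.trans (shifts-≤ (shiftedParts ν n j) _ (ℕ.<⇒≤ e<g)) (≡.cong (λ z → power z (shiftedParts lam n i ∸ shiftedParts ν n j)) exponent)))
      (power-beyond (toℕ j ∸ toℕ i) _ (ℕ.m+n≤o⇒m≤o∸n (suc (toℕ j ∸ toℕ i)) bound))
      where
      e<g : shiftedParts ν n j < shiftedParts lam n i
      e<g = ℕ.+-mono-< q<p (staircase-decreasing i j i<j)
      exponent : + toℕ j ℤ.- + toℕ i ≡ + (toℕ j ∸ toℕ i)
      exponent = ≡.trans (ℤ.m-n≡m⊖n (toℕ j) (toℕ i)) (ℤ.⊖-≥ (ℕ.<⇒≤ i<j))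
      difference : (toℕ j ∸ toℕ i) ℕ.+ staircase n j ≡ staircase n i
      difference = ≡.trans (≡.cong (ℕ._+ staircase n j) (≡.sym (ℕ.[m+n]∸[m+o]≡n∸o 1 (toℕ j) (toℕ i))))
        (≡.trans (ℕ.+-comm (suc (toℕ j) ∸ suc (toℕ i)) _) (≡.trans (≡.sym (ℕ.+-∸-assoc (staircase n j) (s≤s (ℕ.<⇒≤ i<j))))
          (≡.cong (_∸ suc (toℕ i)) (ℕ.m∸n+n≡m (Fin.toℕ<n j)))))
      bound : suc (toℕ j ∸ toℕ i) ℕ.+ shiftedParts ν n j ≤ shiftedParts lam n i
      bound = begin-≤
        where
        open +-*-Solver
        begin-≤ : suc (toℕ j ∸ toℕ i) ℕ.+ shiftedParts ν n j ≤ shiftedParts lam n i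
        begin-≤ = ℕ.≤-trans
          (ℕ.≤-reflexive (≡.trans
            (solve 3 (λ d q t → con 1 :+ d :+ (q :+ t) := con 1 :+ q :+ (d :+ t)) ≡.refl (toℕ j ∸ toℕ i) (part ν (toℕ j)) (staircase n j))
            (≡.cong (suc (part ν (toℕ j)) ℕ.+_) difference)))
          (ℕ.+-monoˡ-≤ (staircase n i) q<p)

  -- The pairing with g_λ, see dual-pairing.
  coefficientᵝ : Partition → ℕ → Λ → Carrier
  coefficientᵝ lam n F = (series F *ˢ (vandermonde n *ˢ twist n)) (strict lam n)

  linear-coefficientᵝ : ∀ lam n → Linear (coefficientᵝ lam n)
  linear-coefficientᵝ lam n = linear-coefficient (vandermonde n *ˢ twist n) (strict lam n)

  -- λ + δ has degree |λ| + |δ|, the Vandermonde product uses |δ| of it and the twist a nonnegative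
  -- amount, so at most |λ| ≤ n is left for F.
  coefficientᵝ-order : ∀ lam n F → size lam ≤ n → (∀ α → total α ≤ n → series F α ≈ 0#) → coefficientᵝ lam n F ≈ 0#
  coefficientᵝ-order lam n F l low = *ˢ-vanish {series F} {vandermonde n *ˢ twist n} (strict lam n) vanish
    where
    vanish : ∀ γ γ′ → length γ ≡ length (strict lam n) → length γ′ ≡ length (strict lam n) →
             total γ ℕ.+ total γ′ ≡ total (strict lam n) → series F γ * (vandermonde n *ˢ twist n) γ′ ≈ 0#
    vanish γ γ′ _ e t with total γ ℕ.≤? n
    ... | yes t≤n = trans (*-congʳ (low γ t≤n)) (zeroˡ _)
    ... | no  t≰n = trans (*-congˡ (*ˢ-vanish {vandermonde n} {twist n} γ′ λ ε ε′ e′ _ t′ → trans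
      (*-congʳ (vandermonde-homogeneous n ε (≡.trans e′ (≡.trans e (List.length-tabulate _)))
        (ℕ.<⇒≢ (ℕ.≤-<-trans (ℕ.≤-trans (ℕ.m≤m+n (total ε) (total ε′)) (ℕ.≤-reflexive t′)) small)))) (zeroˡ _))) (zeroʳ _)
      where
      small : total γ′ < staircaseTotal n
      small = ℕ.+-cancelˡ-< (size lam) _ _ (ℕ.<-≤-trans (ℕ.+-monoˡ-< (total γ′) (ℕ.≤-<-trans l (ℕ.≰⇒> t≰n)))
        (ℕ.≤-reflexive (≡.trans t (total-strict lam n (ℕ.≤-trans (ℓ≤size lam) l)))))

  grothendieck-twist : ∀ ν n → ℓ ν ≤ n → series (image (G ν) n) *ˢ (vandermonde n *ˢ twist n) ≈[ n ] separated (twisted ν n)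
  grothendieck-twist ν n l γ e = begin
    (F *ˢ (vandermonde n *ˢ twist n)) γ   ≈⟨ *ˢ-assoc F (vandermonde n) (twist n) γ ⟨
    ((F *ˢ vandermonde n) *ˢ twist n) γ   ≈⟨ *ˢ-cong-at {g = twist n} γ (λ ε e′ → grothendieck-alternant ν n l ε (≡.trans e′ e)) (λ _ _ → refl) ⟩
    (separated (alternantᵝ ν n) *ˢ twist n) γ  ≈⟨ alternantᵝ-twist ν n γ e ⟩
    separated (twisted ν n) γ             ∎
    where F = series (image (G ν) n)

  -- The factor (1 + βt)ʲ has constant term 1, so the columns of the two determinants have the same
  -- leading terms. After multiplication by the Vandermonde product the difference starts above
  -- degree |ν| + |δ|, and regularity removes that factor.
  grothendieck-lowest : ∀ ν n → size ν ≤ n → ∀ α → total α ≤ size ν → series (image (G ν) n Λᵏ.- s ν) α ≈ 0#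
  grothendieck-lowest ν n l = from-n-variables D l λ α e t →
    regular-vandermonde n (series D) (total α) (λ γ e′ t′ → begin
      (series D *ˢ vandermonde n) γ
        ≈⟨ *ˢ-distribʳ (vandermonde n) (series (image (G ν) n)) (-ˢ series (s ν)) γ ⟩
      (series (image (G ν) n) *ˢ vandermonde n) γ + ((-ˢ series (s ν)) *ˢ vandermonde n) γ
        ≈⟨ +-cong (grothendieck-alternant ν n ℓν≤n γ e′)
             (trans (sym (RingProperties.-‿distribˡ-* S.ring (series (s ν)) (vandermonde n) γ)) (-‿cong (schur-alternant ν n ℓν≤n γ e′))) ⟩
      separated (alternantᵝ ν n) γ - separated (alternant ν n) γ
        ≈⟨ +-congʳ (separated-lowest (shiftedParts ν n) (alternantᵝ ν n) (alternant ν n)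
             (λ i j g g<e → reflexive (shifts-> (shiftedParts ν n j) _ g<e))
             (λ i j g g≢e → monomial-zero (shiftedParts ν n j) g g≢e)
             (λ i j → trans (leading (shiftedParts ν n j) (toℕ j)) (sym (monomial-one (shiftedParts ν n j))))
             γ e′ (ℕ.≤-trans (ℕ.≤-reflexive t′) (ℕ.≤-trans (ℕ.+-monoˡ-≤ (staircaseTotal n) t) (ℕ.≤-reflexive (≡.sym (total-strict ν n ℓν≤n)))))) ⟩
      separated (alternant ν n) γ - separated (alternant ν n) γ
        ≈⟨ -‿inverseʳ _ ⟩
      0# ∎) α e ≡.refl
    where
    D = image (G ν) n Λᵏ.- s ν
    ℓν≤n = ℕ.≤-trans (ℓ≤size ν) l
    leading : ∀ e d → shifts e (power (+ d)) e ≈ 1#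
    leading e d = trans (reflexive (≡.trans (shifts-≤ e _ ℕ.≤-refl) (≡.cong (power (+ d)) (ℕ.n∸n≡0 e)))) (power-constant (+ d))

  skewEntry : Partition → ∀ n → Fin n → Fin n → ℕ → Series
  skewEntry μ n i j = binomialFamily (+ toℕ j ℤ.- + toℕ i) (shiftedParts μ n j)

  module _ (g : Partition → Λ) (dual : IsDualFamily H G g) (lam : Partition) (d : ℕ) where
    private
      N = deg (g lam)
      -- At least the degree of g_λ, so that the images at n and at N pair alike with g_λ; d leaves
      -- room for further lower bounds on the number of variables.
      n = d ℕ.+ N

    module _ (l : size lam ≤ n) where
      private
        grothendieck-paired : ∀ ν → size ν ≤ n → ⟨ image (G ν) n , g lam ⟩ ≈ coefficientᵝ lam n (image (G ν) n)
        grothendieck-paired ν l′ = begin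
          ⟨ image (G ν) n , g lam ⟩  ≈⟨ pairing-agree (image (G ν) n) (image (G ν) N) (g lam) ℕ.≤-refl (image-agree (G ν) N d) ⟩
          ⟨ image (G ν) N , g lam ⟩  ≈⟨ dual ν lam ⟩
          δ ν lam                    ≈⟨ δ-sym ν lam ⟩
          δ lam ν                    ≈⟨ twisted-coefficient lam ν (ℕ.≤-trans (ℓ≤size lam) l) ℓν≤n ⟨
          separated (twisted ν n) (strict lam n) ≈⟨ grothendieck-twist ν n ℓν≤n (strict lam n) (List.length-tabulate _) ⟨
          coefficientᵝ lam n (image (G ν) n) ∎
          where ℓν≤n = ℕ.≤-trans (ℓ≤size ν) l′

        -- Descending induction on the order of F: both sides vanish for large orders, and
        -- agree on G_ν = s_ν + higher order.
        descend : ∀ c e → e ℕ.+ c ≡ suc n → ∀ F → (∀ α → total α < e → series F α ≈ 0#) →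
                  ⟨ F , g lam ⟩ ≈ coefficientᵝ lam n F
        -- Here e = n + 1. The pairing vanishes because g_λ has degree at most n, the coefficient
        -- because |λ| is at most n.
        descend zero e p F low = trans (pairing-order F (g lam) (ℕ.m≤n+m N d) low′) (sym (coefficientᵝ-order lam n F l low′))
          where
          low′ : ∀ α → total α ≤ n → series F α ≈ 0#
          low′ α t = low α (ℕ.≤-trans (s≤s t) (ℕ.≤-reflexive (≡.trans (≡.sym p) (ℕ.+-identityʳ e))))
        descend (suc c) e p F low = span-agree (linearˡ (g lam)) (linear-coefficientᵝ lam n) agree (expansion F e low)
          where
          p′ : suc e ℕ.+ c ≡ suc n
          p′ = ≡.trans (≡.sym (ℕ.+-suc e c)) p
          agree : ∀ ν → e ≤ size ν × size ν ≤ deg F → ⟨ s ν , g lam ⟩ ≈ coefficientᵝ lam n (s ν)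
          agree ν (e≤ , _) with e ℕ.≟ size ν
          ... | no  e≢ = descend c (suc e) p′ (s ν) (λ α t → schur-homogeneous ν α
            (ℕ.<⇒≢ (ℕ.<-≤-trans t (ℕ.≤∧≢⇒< e≤ e≢))))
          ... | yes ≡.refl = agree-from-difference (linearˡ (g lam)) (linear-coefficientᵝ lam n) (image (G ν) n) (s ν)
            (grothendieck-paired ν size≤n)
            (descend c (suc e) p′ (image (G ν) n Λᵏ.- s ν) (λ α t → grothendieck-lowest ν n size≤n α (ℕ.s≤s⁻¹ t)))
            where
            size≤n : size ν ≤ n
            size≤n = ℕ.s≤s⁻¹ (ℕ.≤-trans (ℕ.m≤m+n (suc (size ν)) c) (ℕ.≤-reflexive p′))

      dual-pairing : ∀ F → ⟨ F , g lam ⟩ ≈ coefficientᵝ lam n F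
      dual-pairing F = descend (suc n) 0 ≡.refl F (λ _ ())

      skew-coefficient : ∀ μ → ℓ μ ≤ n → ∀ α →
        ⟨ image (G μ) N Λᵏ.* completes α , g lam ⟩ ≈
        S.Det (λ i j → skewEntry μ n i j (shiftedParts lam n i)) α
      skew-coefficient μ l′ α = begin
        ⟨ image (G μ) N Λᵏ.* completes α , g lam ⟩
          ≈⟨ pairing-agree (image (G μ) n Λᵏ.* completes α) (image (G μ) N Λᵏ.* completes α) (g lam) ℕ.≤-refl
               (product-agree (image (G μ) n) (image (G μ) N) (completes α) N (image-agree (G μ) N d)) ⟨
        ⟨ image (G μ) n Λᵏ.* completes α , g lam ⟩
          ≈⟨ dual-pairing (image (G μ) n Λᵏ.* completes α) ⟩
        ((F *ˢ h′) *ˢ (vandermonde n *ˢ twist n)) (strict lam n)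
          ≈⟨ *ˢ-cong {g = vandermonde n *ˢ twist n} (*ˢ-comm F h′) (λ _ → refl) (strict lam n) ⟩
        ((h′ *ˢ F) *ˢ (vandermonde n *ˢ twist n)) (strict lam n)
          ≈⟨ *ˢ-assoc h′ F (vandermonde n *ˢ twist n) (strict lam n) ⟩
        (h′ *ˢ (F *ˢ (vandermonde n *ˢ twist n))) (strict lam n)
          ≈⟨ *ˢ-cong-at {h′} (strict lam n) (λ _ _ → refl) (λ γ e → trans (grothendieck-twist μ n l′ γ (≡.trans e lengthλ))
               -- The constant terms of the families are the twisted entries, once `total []` = 0 is
               -- added to the shift.
               (Det-cong λ i j → reflexive (≡.cong (λ m → shifts m (power (+ toℕ j ℤ.- + toℕ i)) (nth γ (toℕ i))) (≡.sym (ℕ.+-identityʳ (shiftedParts μ n j)))))) ⟩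
        (h′ *ˢ separated (λ i j g → skewEntry μ n i j g [])) (strict lam n)
          ≈⟨ Det-shifts (skewEntry μ n)
               (λ i j → binomialFamily-shifts _ (shiftedParts μ n j)) α (strict lam n) lengthλ ⟨
        S.Det (λ i j → skewEntry μ n i j (nth (strict lam n) (toℕ i))) α
          ≈⟨ S.Det-cong (λ i j → S.reflexive (≡.cong (skewEntry μ n i j) (nth-tabulate (shiftedParts lam n) i))) α ⟩
        S.Det (λ i j → skewEntry μ n i j (shiftedParts lam n i)) α ∎
        where
        F = series (image (G μ) n)
        h′ = series (completes α)
        lengthλ = List.length-tabulate (shiftedParts lam n)

-- The determinant of the theorem and its independence of the size.

module SkewDeterminant {a b} (k : CommutativeRing a b) (β : CommutativeRing.Carrier k) (lam μ : Partition) (μ⊂λ : μ ⊂ lam) where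
  open CommutativeRing k hiding (zero)
  private module Λᵏ = SymmetricFunctions k
  open Λᵏ hiding (_+_; _*_; -_; _-_)
  open SeriesRing k
  open BinomialSeries k β
  open SetoidReasoning setoid

  -- Indexed by natural numbers, so that determinants of different sizes share their entries.
  entry : ℕ → ℕ → Λ
  entry i j = binomialSum β (+ j ℤ.- + i) (+ part lam i ℤ.- + part μ j ℤ.- + i ℤ.+ + j)

  sum-series : ∀ {n} (f : Fin n → Λ) → series (sumᴸ f) ≈ˢ S.∑ (λ i → series (f i))
  sum-series {zero}  f = S.reflexive (≡.sym (S.∑-empty _))
  sum-series {suc n} f = S.trans (S.+-congˡ {series (f zero)} (sum-series (λ i → f (suc i)))) (S.reflexive (≡.sym (S.∑-suc _)))

  det-series : ∀ {n} (M : Fin n → Fin n → Λ) → series (det M) ≈ˢ S.Det (λ i j → series (M i j))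
  det-series {zero}  M = S.reflexive (≡.sym (S.Det-empty _))
  det-series {suc n} M = S.trans (sum-series (λ (j : Fin (suc n)) →
      ((Λᵏ.- 1ᴸ) ^ toℕ j) Λᵏ.* (M zero j Λᵏ.* det (λ p q → M (suc p) (punchIn j q))))) (S.trans
    (S.∑-cong λ j → *ˢ-cong (sign-series (toℕ j)) (*ˢ-cong {series (M zero j)} S.refl (det-series (λ p q → M (suc p) (punchIn j q)))))
    (S.reflexive (≡.sym (S.Det-expand _))))
    where
    open RawSemiringDefs (RawRing.rawSemiring Λ-ring) using (_^_)
    sign-series : ∀ m → series ((Λᵏ.- 1ᴸ) ^ m) ≈ˢ (-ˢ 1ˢ) ^ˢ m
    sign-series zero    = S.refl
    sign-series (suc m) = *ˢ-cong { -ˢ 1ˢ} S.refl (sign-series m)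

  -- Adding n - 1 - i to the i-th part of λ and n - 1 - j to the j-th part of μ changes their
  -- difference by j - i.
  entry-family : ∀ {n} (i j : Fin n) → series (entry (toℕ i) (toℕ j)) ≈ˢ
                 binomialFamily (+ toℕ j ℤ.- + toℕ i) (shiftedParts μ n j) (shiftedParts lam n i)
  entry-family {n} i j = binomialFamily-binomialSum (+ toℕ j ℤ.- + toℕ i) _ (shiftedParts μ n j) (shiftedParts lam n i) index
    where
    open ℤSolver.+-*-Solver
    stair : ∀ (i : Fin n) → + staircase n i ≡ + n ℤ.- (+ 1 ℤ.+ + toℕ i)
    stair i = ≡.sym (≡.trans (ℤ.m-n≡m⊖n n (suc (toℕ i))) (ℤ.⊖-≥ (Fin.toℕ<n i)))
    index : + part lam (toℕ i) ℤ.- + part μ (toℕ j) ℤ.- + toℕ i ℤ.+ + toℕ j ≡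
            (+ part lam (toℕ i) ℤ.+ + staircase n i) ℤ.- (+ part μ (toℕ j) ℤ.+ + staircase n j)
    index = ≡.trans
      (solve 5 (λ l m i j n → l :- m :- i :+ j := (l :+ (n :- (con (+ 1) :+ i))) :- (m :+ (n :- (con (+ 1) :+ j)))) ≡.refl
        (+ part lam (toℕ i)) (+ part μ (toℕ j)) (+ toℕ i) (+ toℕ j) (+ n))
      (≡.cong₂ (λ x y → (+ part lam (toℕ i) ℤ.+ x) ℤ.- (+ part μ (toℕ j) ℤ.+ y)) (≡.sym (stair i)) (≡.sym (stair j)))

  Det-entries : ℕ → Series
  Det-entries n = S.Det {n} (λ i j → series (entry (toℕ i) (toℕ j)))

  module _ {r} (l : ℓ lam ≤ r) where
    private
      part-λ : ∀ {i} → r ≤ i → part lam i ≡ 0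
      part-λ r≤i = nth-beyond (parts lam) _ (ℕ.≤-trans l r≤i)

      part-μ : ∀ {i} → r ≤ i → part μ i ≡ 0
      part-μ {i} r≤i = ℕ.n≤0⇒n≡0 (ℕ.≤-trans (μ⊂λ i) (ℕ.≤-reflexive (part-λ r≤i)))

      entry-left : ∀ {i j} → r ≤ i → j < i → series (entry i j) ≈ˢ 0ˢ
      entry-left {i} {j} r≤i j<i α = trans
        (binomialFamily-binomialSum (+ j ℤ.- + i) _ (part μ j ℕ.+ i) j index α)
        (reflexive (JacobiTrudi.shifts-> k (part μ j ℕ.+ i ℕ.+ total α) _ (ℕ.<-≤-trans j<i (ℕ.≤-trans (ℕ.m≤n+m i (part μ j)) (ℕ.m≤m+n _ (total α))))))
        where
        open ℤSolver.+-*-Solver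
        index : + part lam i ℤ.- + part μ j ℤ.- + i ℤ.+ + j ≡ + j ℤ.- (+ part μ j ℤ.+ + i)
        index = ≡.trans (≡.cong (λ x → + x ℤ.- + part μ j ℤ.- + i ℤ.+ + j) (part-λ r≤i))
          (solve 3 (λ m i j → con (+ 0) :- m :- i :+ j := j :- (m :+ i)) ≡.refl (+ part μ j) (+ i) (+ j))

      entry-diagonal : ∀ {i} → r ≤ i → series (entry i i) ≈ˢ 1ˢ
      entry-diagonal {i} r≤i α = trans
        (reflexive (≡.cong₂ (λ d m → series (binomialSum β d m) α) (ℤ.+-inverseʳ (+ i)) index))
        (trans (binomialFamily-binomialSum (+ 0) (+ 0) 0 0 ≡.refl α) (constant (total α) ≡.refl))
        where
        open ℤSolver.+-*-Solver
        index : + part lam i ℤ.- + part μ i ℤ.- + i ℤ.+ + i ≡ + 0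
        index = ≡.trans (≡.cong₂ (λ x y → + x ℤ.- + y ℤ.- + i ℤ.+ + i) (part-λ r≤i) (part-μ r≤i))
          (solve 1 (λ i → con (+ 0) :- con (+ 0) :- i :+ i := con (+ 0)) ≡.refl (+ i))
        constant : ∀ t → total α ≡ t → JacobiTrudi.shifts k t (power (+ 0)) 0 ≈ 1ˢ α
        constant zero    e = trans (power-constant (+ 0)) (sym (hˢ-one {α = α} (≡.cong +_ (≡.sym e))))
        constant (suc t) e = sym (hˢ-zero (+ 0) {α} (λ e′ → contradiction (≡.trans (ℤ.+-injective e′) e) λ ()))

    -- In a row i ≥ r the part of λ is 0. To the left of the diagonal the index of h is then
    -- negative; on the diagonal the part of μ is 0 too and the entry is h₀ = 1.
    Det-entries-stable : ∀ d → Det-entries (d ℕ.+ r) ≈ˢ Det-entries r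
    Det-entries-stable zero    = S.refl
    Det-entries-stable (suc d) = S.trans
      (S.trans (S.Det-last-row _ left diagonal)
        (S.Det-cong λ i j → S.reflexive (≡.cong₂ (λ i j → series (entry i j)) (Fin.toℕ-inject₁ i) (Fin.toℕ-inject₁ j))))
      (Det-entries-stable d)
      where
      n = d ℕ.+ r
      left : ∀ j → series (entry (toℕ (fromℕ n)) (toℕ (inject₁ j))) ≈ˢ 0ˢ
      left j = S.trans
        (S.reflexive (≡.cong₂ (λ i j → series (entry i j)) (Fin.toℕ-fromℕ n) (Fin.toℕ-inject₁ j)))
        (entry-left (ℕ.m≤n+m r d) (Fin.toℕ<n j))
      diagonal : series (entry (toℕ (fromℕ n)) (toℕ (fromℕ n))) ≈ˢ 1ˢ
      diagonal = S.trans (S.reflexive (≡.cong (λ i → series (entry i i)) (Fin.toℕ-fromℕ n))) (entry-diagonal (ℕ.m≤n+m r d))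

proposition5p2 : ∀ {a b} (k : CommutativeRing a b) (β : CommutativeRing.Carrier k) →
    let open SymmetricFunctions k in
    (s : Partition → Λ) → (∀ ν → IsSchur ν (s ν)) →
    (H : HallProduct s) →
    let open Completion s in
    (G : Partition → Λ̂) → (∀ ν → IsStableGrothendieck β ν (G ν)) →
    (g : Partition → Λ) → IsDualFamily H G g →
    (λ′ μ : Partition) → μ ⊂ λ′ →
    (g[λ/μ] : Λ) → IsSkewing H G μ (g λ′) g[λ/μ] →
    (r : ℕ) → 1 ≤ r → ℓ λ′ ≤ r →
    g[λ/μ] ≈ᴸ det {r} (λ i j →
    binomialSum β (+ toℕ j ℤ.- + toℕ i)
    (+ part λ′ (toℕ i) ℤ.- + part μ (toℕ j) ℤ.- + toℕ i ℤ.+ + toℕ j))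
proposition5p2 k β s isSchur H G isGrothendieck g dual λ′ μ μ⊂λ g[λ/μ] skewing r 1≤r ℓ≤r α = begin
  series g[λ/μ] α
    -- `duality` asks for at least as many exponents as the degree bound of g_{λ/μ} and the total of
    -- α; trailing zeros supply them and are removed again at the end.
    ≈⟨ pad g[λ/μ] m α ⟨
  series g[λ/μ] α′
    ≈⟨ Duality.duality k s isSchur H g[λ/μ] α′
         (≤length (ℕ.m≤m+n (deg g[λ/μ]) (total α)))
         (≤length (ℕ.≤-trans (ℕ.≤-reflexive (replicate-total m α)) (ℕ.m≤n+m (total α) (deg g[λ/μ])))) ⟩
  ⟨ g[λ/μ] , completes α′ ⟩
    ≈⟨ skewing (completes α′) ⟩
  ⟨ image (G μ) N *ᴸ completes α′ , g λ′ ⟩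
    ≈⟨ Grothendieck.skew-coefficient k β s isSchur H G isGrothendieck g dual λ′ d
         (≤n (ℕ.m≤m+n (size λ′) (ℓ μ))) μ (≤n (ℕ.m≤n+m (ℓ μ) (size λ′))) α′ ⟩
  Det (λ i j → binomialFamily (+ toℕ j ℤ.- + toℕ i) (shiftedParts μ n j) (shiftedParts λ′ n i)) α′
    ≈⟨ Det-cong (entry-family {n}) α′ ⟨
  Det-entries n α′
    ≡⟨ ≡.cong (λ n → Det-entries n α′) (ℕ.m∸n+n≡m r≤n) ⟨
  Det-entries (n ∸ r ℕ.+ r) α′
    ≈⟨ Det-entries-stable ℓ≤r (n ∸ r) α′ ⟩
  Det-entries r α′
    ≈⟨ det-series entries α′ ⟨
  series (det entries) α′
    ≈⟨ pad (det entries) m α ⟩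
  series (det entries) α ∎
  where
  open CommutativeRing k using (setoid)
  open SetoidReasoning setoid
  open SymmetricFunctions k using (Λ; series; deg; det; module HallProduct; module Completion) renaming (_*_ to _*ᴸ_)
  open HallProduct H using (⟨_,_⟩)
  open Completion s using (image)
  open Functionals k
  open Separated k using (completes)
  open BinomialSeries k β using (binomialFamily)
  open SkewDeterminant k β λ′ μ μ⊂λ
  open Determinant (SeriesRing.seriesCommutativeRing k) using (Det; Det-cong)
  N = deg (g λ′)
  -- |λ| is needed for the pairing with g_λ, ℓ(μ) for the bialternant of G_μ, and r in order that
  -- the determinant can be cut down to r rows.
  d = size λ′ ℕ.+ ℓ μ ℕ.+ r
  n = d ℕ.+ N
  m = deg g[λ/μ] ℕ.+ total α
  α′ = α List.++ List.replicate m 0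
  entries : Fin r → Fin r → Λ
  entries i j = entry (toℕ i) (toℕ j)
  r≤n : r ≤ n
  r≤n = ℕ.≤-trans (ℕ.m≤n+m r (size λ′ ℕ.+ ℓ μ)) (ℕ.m≤m+n d N)
  ≤n : ∀ {x} → x ≤ size λ′ ℕ.+ ℓ μ → x ≤ n
  ≤n p = ℕ.≤-trans p (ℕ.≤-trans (ℕ.m≤m+n _ r) (ℕ.m≤m+n d N))
  ≤length : ∀ {x} → x ≤ m → x ≤ length α′
  ≤length p = ℕ.≤-trans p (ℕ.≤-trans (ℕ.m≤n+m m (length α)) (ℕ.≤-reflexive (≡.sym (replicate-length m α))))
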